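{- Let $d\ge1$, let $n$ be an even positive integer, and let $D$ be the uniform distribution on all $x\in\{\pm1\}^n$ with $\sum_{i=1}^n x_i=0$. For every multilinear polynomial $g$ in $x_1,\dots,x_n$ of degree at most $d$, $$\mathbb E_{D}[g^4]\le 12\,d\cdot 9^{2d}\cdot\big(\mathbb E_D[g^2]\big)^2 .$$
   Context: Polynomials have real coefficients. -}

module Defs where

open import Data.Bool.Base using (if_then_else_)
open import Data.Fin.Subset using (Subset; inside; outside; ∣_∣)
open import Data.Integer.Base as ℤ using (ℤ; 0ℤ; 1ℤ)
open import Data.Integer.Properties as ℤₚ using ()
open import Data.List.Base as List using (List; []; _∷_)
open import Data.List.Membership.Propositional using (_∈_)
open import Data.List.Membership.Propositional.Properties
  using (∈-cartesianProductWith⁺; ∈-filter⁺)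
open import Data.List.Relation.Unary.Any using (here; there)
open import Data.Nat.Base as ℕ using (ℕ; zero; suc)
open import Data.Nat.Divisibility.Core using (_∣_; divides)
open import Data.Nat.Properties as ℕₚ using ()
open import Data.Product.Base using (∃-syntax; _×_; _,_)
open import Data.Rational.Base as ℚ using (ℚ; 0ℚ; 1ℚ; ½)
open import Data.Rational.Properties as ℚₚ using ()
open import Data.Rational.Solver using (module +-*-Solver)
open import Data.Sign.Base as Sign using (Sign)
open import Data.Vec.Base as Vec using (Vec; []; _∷_)
open import Relation.Binary.PropositionalEquality.Core
  using (_≡_; refl; sym; trans; cong; cong₂; subst)
open import Relation.Nullary.Decidable.Core using (Dec)

------------------------------------------------------------------------
-- The Cauchy reals: Cauchy sequences of rationals, with the equality
-- _≃_ below in place of a quotient.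

IsCauchy : (ℕ → ℚ) → Set
IsCauchy s = ∀ ε → 0ℚ ℚ.< ε →
  ∃[ N ] ∀ m n → N ℕ.≤ m → N ℕ.≤ n → ℚ.∣ s m ℚ.- s n ∣ ℚ.< ε

record ℝ : Set where
  constructor mkℝ
  field
    seq    : ℕ → ℚ
    cauchy : IsCauchy seq

open ℝ public

infix 4 _≃_ _≤_

_≃_ : ℝ → ℝ → Set
x ≃ y = ∀ ε → 0ℚ ℚ.< ε →
  ∃[ N ] ∀ n → N ℕ.≤ n → ℚ.∣ seq x n ℚ.- seq y n ∣ ℚ.< ε

-- The ε is essential: comparing the sequences termwise from some index
-- on would not respect _≃_.
_≤_ : ℝ → ℝ → Set
x ≤ y = ∀ ε → 0ℚ ℚ.< ε →
  ∃[ N ] ∀ n → N ℕ.≤ n → seq x n ℚ.< seq y n ℚ.+ ε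

private
  0<½* : ∀ {ε} → 0ℚ ℚ.< ε → 0ℚ ℚ.< ½ ℚ.* ε
  0<½* {ε} ε>0 =
    ℚₚ.positive⁻¹ _ {{ℚₚ.pos*pos⇒pos ½ ε {{ℚ.positive ε>0}}}}

  ½+½ : ∀ ε → ½ ℚ.* ε ℚ.+ ½ ℚ.* ε ≡ ε
  ½+½ ε = trans (sym (ℚₚ.*-distribʳ-+ ε ½ ½)) (ℚₚ.*-identityˡ ε)

  const-cauchy : ∀ q → IsCauchy (λ _ → q)
  const-cauchy q ε ε>0 = 0 , λ _ _ _ _ →
    subst (ℚ._< ε) (sym (cong ℚ.∣_∣ (ℚₚ.+-inverseʳ q))) ε>0

  +-cauchy : ∀ s t → IsCauchy s → IsCauchy t →
             IsCauchy (λ n → s n ℚ.+ t n)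
  +-cauchy s t cs ct ε ε>0
    with N , p ← cs (½ ℚ.* ε) (0<½* ε>0)
       | M , q ← ct (½ ℚ.* ε) (0<½* ε>0) =
    N ℕ.⊔ M , λ m n m≥ n≥ → begin-strict
      ℚ.∣ (s m ℚ.+ t m) ℚ.- (s n ℚ.+ t n) ∣
        ≡⟨ cong ℚ.∣_∣ (rearrange (s m) (t m) (s n) (t n)) ⟩
      ℚ.∣ (s m ℚ.- s n) ℚ.+ (t m ℚ.- t n) ∣
        ≤⟨ ℚₚ.∣p+q∣≤∣p∣+∣q∣ (s m ℚ.- s n) (t m ℚ.- t n) ⟩
      ℚ.∣ s m ℚ.- s n ∣ ℚ.+ ℚ.∣ t m ℚ.- t n ∣
        <⟨ ℚₚ.+-mono-<
             (p m n (ℕₚ.m⊔n≤o⇒m≤o N M m≥) (ℕₚ.m⊔n≤o⇒m≤o N M n≥))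
             (q m n (ℕₚ.m⊔n≤o⇒n≤o N M m≥) (ℕₚ.m⊔n≤o⇒n≤o N M n≥)) ⟩
      ½ ℚ.* ε ℚ.+ ½ ℚ.* ε
        ≡⟨ ½+½ ε ⟩
      ε ∎
    where
    open ℚₚ.≤-Reasoning
    rearrange : ∀ a b c d → (a ℚ.+ b) ℚ.- (c ℚ.+ d) ≡ (a ℚ.- c) ℚ.+ (b ℚ.- d)
    rearrange = solve 4 (λ a b c d →
      (a :+ b) :- (c :+ d) := (a :- c) :+ (b :- d)) refl
      where open +-*-Solver

  sumAbs : (ℕ → ℚ) → ℕ → ℚ
  sumAbs s zero    = ℚ.∣ s 0 ∣
  sumAbs s (suc N) = sumAbs s N ℚ.+ ℚ.∣ s (suc N) ∣

  p≤p+∣q∣ : ∀ p q → p ℚ.≤ p ℚ.+ ℚ.∣ q ∣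
  p≤p+∣q∣ p q = subst (ℚ._≤ p ℚ.+ ℚ.∣ q ∣) (ℚₚ.+-identityʳ p)
    (ℚₚ.+-monoʳ-≤ p (ℚₚ.0≤∣p∣ q))

  ∣q∣≤p+∣q∣ : ∀ p q → 0ℚ ℚ.≤ p → ℚ.∣ q ∣ ℚ.≤ p ℚ.+ ℚ.∣ q ∣
  ∣q∣≤p+∣q∣ p q p≥0 = subst (ℚ._≤ p ℚ.+ ℚ.∣ q ∣) (ℚₚ.+-identityˡ ℚ.∣ q ∣)
    (ℚₚ.+-monoˡ-≤ ℚ.∣ q ∣ p≥0)

  0≤sumAbs : ∀ s N → 0ℚ ℚ.≤ sumAbs s N
  0≤sumAbs s zero    = ℚₚ.0≤∣p∣ (s 0)
  0≤sumAbs s (suc N) = ℚₚ.≤-trans (0≤sumAbs s N) (p≤p+∣q∣ _ (s (suc N)))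

  ∣s∣≤sumAbs : ∀ s N → ℚ.∣ s N ∣ ℚ.≤ sumAbs s N
  ∣s∣≤sumAbs s zero    = ℚₚ.≤-refl
  ∣s∣≤sumAbs s (suc N) = ∣q∣≤p+∣q∣ _ (s (suc N)) (0≤sumAbs s N)

  eventually-bounded : ∀ {s} → IsCauchy s →
    ∃[ B ] 0ℚ ℚ.< B × ∃[ N ] ∀ n → N ℕ.≤ n → ℚ.∣ s n ∣ ℚ.< B
  eventually-bounded {s} cs with N , p ← cs 1ℚ (ℚₚ.positive⁻¹ 1ℚ) =
    sumAbs s N ℚ.+ 1ℚ ,
    ℚₚ.+-mono-≤-< (0≤sumAbs s N) (ℚₚ.positive⁻¹ 1ℚ) ,
    N , λ n n≥N → begin-strict
      ℚ.∣ s n ∣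
        ≡⟨ cong ℚ.∣_∣ (split (s N) (s n)) ⟩
      ℚ.∣ s N ℚ.+ (s n ℚ.- s N) ∣
        ≤⟨ ℚₚ.∣p+q∣≤∣p∣+∣q∣ (s N) (s n ℚ.- s N) ⟩
      ℚ.∣ s N ∣ ℚ.+ ℚ.∣ s n ℚ.- s N ∣
        <⟨ ℚₚ.+-mono-≤-< (∣s∣≤sumAbs s N) (p n N n≥N ℕₚ.≤-refl) ⟩
      sumAbs s N ℚ.+ 1ℚ ∎
    where
    open ℚₚ.≤-Reasoning
    split : ∀ a b → b ≡ a ℚ.+ (b ℚ.- a)
    split = solve 2 (λ a b → b := a :+ (b :- a)) refl
      where open +-*-Solver

  -- A tolerance δ for one factor such that B * δ is the tolerance ε.
  divided-tolerance : ∀ {B ε} → 0ℚ ℚ.< B → 0ℚ ℚ.< ε →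
    ∃[ δ ] 0ℚ ℚ.< δ × B ℚ.* δ ≡ ε
  divided-tolerance {B} {ε} B>0 ε>0 =
    ℚ.1/ B ℚ.* ε ,
    ℚₚ.positive⁻¹ _ {{ℚₚ.pos*pos⇒pos (ℚ.1/ B) {{ℚₚ.1/pos⇒pos B}} ε}} ,
    trans (sym (ℚₚ.*-assoc B (ℚ.1/ B) ε))
      (trans (cong (ℚ._* ε) (ℚₚ.*-inverseʳ B)) (ℚₚ.*-identityˡ ε))
    where
    instance
      B⁺ = ℚ.positive B>0
      ε⁺ = ℚ.positive ε>0
      B≢0 = ℚₚ.pos⇒nonZero B

  ∣pq∣< : ∀ p q {B δ} → 0ℚ ℚ.< B → ℚ.∣ p ∣ ℚ.< B → ℚ.∣ q ∣ ℚ.< δ →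
          ℚ.∣ p ℚ.* q ∣ ℚ.< B ℚ.* δ
  ∣pq∣< p q {B} {δ} B>0 p<B q<δ = begin-strict
    ℚ.∣ p ℚ.* q ∣
      ≡⟨ ℚₚ.∣p*q∣≡∣p∣*∣q∣ p q ⟩
    ℚ.∣ p ∣ ℚ.* ℚ.∣ q ∣
      ≤⟨ ℚₚ.*-monoʳ-≤-nonNeg ℚ.∣ q ∣ {{ℚ.nonNegative (ℚₚ.0≤∣p∣ q)}} (ℚₚ.<⇒≤ p<B) ⟩
    B ℚ.* ℚ.∣ q ∣
      <⟨ ℚₚ.*-monoʳ-<-pos B {{ℚ.positive B>0}} q<δ ⟩
    B ℚ.* δ ∎
    where open ℚₚ.≤-Reasoning

  product-difference : ∀ a b c d →
    a ℚ.* b ℚ.- c ℚ.* d ≡ a ℚ.* (b ℚ.- d) ℚ.+ d ℚ.* (a ℚ.- c)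
  product-difference = solve 4 (λ a b c d →
    a :* b :- c :* d := a :* (b :- d) :+ d :* (a :- c)) refl
    where open +-*-Solver

  ∣ab-cd∣< : ∀ a b c d {A B α β ε} →
    0ℚ ℚ.< A → ℚ.∣ a ∣ ℚ.< A → ℚ.∣ b ℚ.- d ∣ ℚ.< α → A ℚ.* α ≡ ½ ℚ.* ε →
    0ℚ ℚ.< B → ℚ.∣ d ∣ ℚ.< B → ℚ.∣ a ℚ.- c ∣ ℚ.< β → B ℚ.* β ≡ ½ ℚ.* ε →
    ℚ.∣ a ℚ.* b ℚ.- c ℚ.* d ∣ ℚ.< ε
  ∣ab-cd∣< a b c d {A} {B} {α} {β} {ε} A>0 a<A b-d Aα B>0 d<B a-c Bβ =
    begin-strict
      ℚ.∣ a ℚ.* b ℚ.- c ℚ.* d ∣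
        ≡⟨ cong ℚ.∣_∣ (product-difference a b c d) ⟩
      ℚ.∣ a ℚ.* (b ℚ.- d) ℚ.+ d ℚ.* (a ℚ.- c) ∣
        ≤⟨ ℚₚ.∣p+q∣≤∣p∣+∣q∣ (a ℚ.* (b ℚ.- d)) (d ℚ.* (a ℚ.- c)) ⟩
      ℚ.∣ a ℚ.* (b ℚ.- d) ∣ ℚ.+ ℚ.∣ d ℚ.* (a ℚ.- c) ∣
        <⟨ ℚₚ.+-mono-< (∣pq∣< a (b ℚ.- d) A>0 a<A b-d)
                       (∣pq∣< d (a ℚ.- c) B>0 d<B a-c) ⟩
      A ℚ.* α ℚ.+ B ℚ.* β
        ≡⟨ cong₂ ℚ._+_ Aα Bβ ⟩
      ½ ℚ.* ε ℚ.+ ½ ℚ.* ε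
        ≡⟨ ½+½ ε ⟩
      ε ∎
    where open ℚₚ.≤-Reasoning

  *-cauchy : ∀ s t → IsCauchy s → IsCauchy t →
             IsCauchy (λ n → s n ℚ.* t n)
  *-cauchy s t cs ct ε ε>0 =
    let A , A>0 , N₁ , s<A = eventually-bounded cs
        B , B>0 , N₂ , t<B = eventually-bounded ct
        α , α>0 , Aα = divided-tolerance A>0 (0<½* ε>0)
        β , β>0 , Bβ = divided-tolerance B>0 (0<½* ε>0)
        N₃ , t-close = ct α α>0
        N₄ , s-close = cs β β>0
        N₁₂ = N₁ ℕ.⊔ N₂
        N₃₄ = N₃ ℕ.⊔ N₄
    in N₁₂ ℕ.⊔ N₃₄ , λ m n m≥ n≥ →
      let m≥N₁₂ = ℕₚ.m⊔n≤o⇒m≤o N₁₂ N₃₄ m≥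
          n≥N₁₂ = ℕₚ.m⊔n≤o⇒m≤o N₁₂ N₃₄ n≥
          m≥N₃₄ = ℕₚ.m⊔n≤o⇒n≤o N₁₂ N₃₄ m≥
          n≥N₃₄ = ℕₚ.m⊔n≤o⇒n≤o N₁₂ N₃₄ n≥
      in ∣ab-cd∣< (s m) (t m) (s n) (t n)
           A>0 (s<A m (ℕₚ.m⊔n≤o⇒m≤o N₁ N₂ m≥N₁₂))
           (t-close m n (ℕₚ.m⊔n≤o⇒m≤o N₃ N₄ m≥N₃₄) (ℕₚ.m⊔n≤o⇒m≤o N₃ N₄ n≥N₃₄)) Aα
           B>0 (t<B n (ℕₚ.m⊔n≤o⇒n≤o N₁ N₂ n≥N₁₂))
           (s-close m n (ℕₚ.m⊔n≤o⇒n≤o N₃ N₄ m≥N₃₄) (ℕₚ.m⊔n≤o⇒n≤o N₃ N₄ n≥N₃₄)) Bβ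

infixl 6 _+_
infixl 7 _*_
infixr 8 _^_

fromℚ : ℚ → ℝ
fromℚ q = mkℝ (λ _ → q) (const-cauchy q)

fromℤ : ℤ → ℝ
fromℤ k = fromℚ (k ℚ./ 1)

fromℕ : ℕ → ℝ
fromℕ k = fromℤ (ℤ.+ k)

0ℝ 1ℝ : ℝ
0ℝ = fromℚ 0ℚ
1ℝ = fromℚ 1ℚ

_+_ _*_ : ℝ → ℝ → ℝ
x + y = mkℝ (λ n → seq x n ℚ.+ seq y n) (+-cauchy (seq x) (seq y) (cauchy x) (cauchy y))
x * y = mkℝ (λ n → seq x n ℚ.* seq y n) (*-cauchy (seq x) (seq y) (cauchy x) (cauchy y))

_^_ : ℝ → ℕ → ℝ
x ^ zero  = 1ℝ
x ^ suc k = x * x ^ k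

sumℝ : List ℝ → ℝ
sumℝ = List.foldr _+_ 0ℝ

------------------------------------------------------------------------
-- Multilinear polynomials

-- All vectors of length n with entries from the given list.
vectors : {A : Set} → List A → ∀ n → List (Vec A n)
vectors as zero    = [] ∷ []
vectors as (suc n) = List.cartesianProductWith _∷_ as (vectors as n)

subsets : ∀ n → List (Subset n)
subsets = vectors (outside ∷ inside ∷ [])

-- g represents Σ_S g(S) ∏_{i ∈ S} xᵢ, with S ranging over the subsets
-- of the n variables.
MultilinearPolynomial : ℕ → Set
MultilinearPolynomial n = Subset n → ℝ

DegreeAtMost : ∀ {n} → ℕ → MultilinearPolynomial n → Set
DegreeAtMost d g = ∀ S → d ℕ.< ∣ S ∣ → g S ≃ 0ℝ

monomial : ∀ {n} → Subset n → Vec ℝ n → ℝ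
monomial []      []       = 1ℝ
monomial (b ∷ S) (x ∷ xs) = if b then x * monomial S xs else monomial S xs

eval : ∀ {n} → MultilinearPolynomial n → Vec ℝ n → ℝ
eval {n} g x = sumℝ (List.map (λ S → g S * monomial S x) (subsets n))

------------------------------------------------------------------------
-- The uniform distribution on the middle slice of the hypercube

signToℤ : Sign → ℤ
signToℤ s = s ℤ.◃ 1

sumℤ : ∀ {n} → Vec Sign n → ℤ
sumℤ x = Vec.foldr′ ℤ._+_ 0ℤ (Vec.map signToℤ x)

signs : List Sign
signs = Sign.+ ∷ Sign.- ∷ []

cube : ∀ n → List (Vec Sign n)
cube = vectors signs

Balanced : ∀ {n} → Vec Sign n → Set
Balanced x = sumℤ x ≡ 0ℤ

balanced? : ∀ {n} (x : Vec Sign n) → Dec (Balanced x)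
balanced? x = sumℤ x ℤₚ.≟ 0ℤ

slice : ∀ n → List (Vec Sign n)
slice n = List.filter balanced? (cube n)

private
  ∈-signs : ∀ s → s ∈ signs
  ∈-signs Sign.+ = here refl
  ∈-signs Sign.- = there (here refl)

  ∈-cube : ∀ {n} (x : Vec Sign n) → x ∈ cube n
  ∈-cube []       = here refl
  ∈-cube (s ∷ x) = ∈-cartesianProductWith⁺ _∷_ (∈-signs s) (∈-cube x)

  alternating : ∀ k → Vec Sign (k ℕ.* 2)
  alternating zero    = []
  alternating (suc k) = Sign.+ ∷ Sign.- ∷ alternating k

  alternating-balanced : ∀ k → Balanced (alternating k)
  alternating-balanced zero    = refl
  alternating-balanced (suc k) rewrite alternating-balanced k = refl

  ∈⇒nonEmpty : {A : Set} {a : A} {as : List A} → a ∈ as →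
               ℕ.NonZero (List.length as)
  ∈⇒nonEmpty {as = _ ∷ _} _ = _

slice-nonEmpty : ∀ {n} → 2 ∣ n → ℕ.NonZero (List.length (slice n))
slice-nonEmpty (divides k refl) = ∈⇒nonEmpty
  (∈-filter⁺ balanced? (∈-cube (alternating k)) (alternating-balanced k))

-- Expectation under the uniform distribution on a list without
-- repetitions.
𝔼-uniform : {A : Set} (as : List A) .{{_ : ℕ.NonZero (List.length as)}} →
            (A → ℝ) → ℝ
𝔼-uniform as f =
  fromℚ (1ℤ ℚ./ List.length as) * sumℝ (List.map f as)

𝔼-slice : ∀ {n} → .(2 ∣ n) → (Vec Sign n → ℝ) → ℝ
𝔼-slice {n} even = 𝔼-uniform (slice n) {{slice-nonEmpty even}}

evalSigns : ∀ {n} → MultilinearPolynomial n → Vec Sign n → ℝ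
evalSigns g x = eval g (Vec.map (λ s → fromℤ (signToℤ s)) x)

module Submission where

-- A balanced x is generated by choosing a random pair (i, j), a random sign
-- xᵢ = - xⱼ and a balanced point on the remaining coordinates. At the pair a
-- polynomial f of degree d splits as a + xᵢ b with deg a ≤ d and deg b ≤ d - 1,
-- and induction as in Bonami's inequality bounds 𝔼 f⁴ by 81ᵈ times the mean over
-- the pairs of α² + ⅔αβ + β²/81, where α = 𝔼 a² and β = 𝔼 b². The mean of α + β is
-- 𝔼 f²; the variance of α + β over the pairs is twice the mean over the pairs and
-- over i of 𝔼[a b xᵢ]², up to a factor below 1. Cauchy-Schwarz bounds the latter by
-- αβ, so that α² + β² has mean at most (𝔼 f²)². When n ≥ 9d a bound on the
-- Dirichlet form by the degree improves αβ to ⅔αβ, and the induction closes with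
-- no loss; when n ≤ 9d the loss of a constant factor per pair is affordable.

open import Data.Bool.Base using (true; false; if_then_else_)
open import Data.Empty using (⊥-elim)
open import Data.Fin.Base using (Fin; zero; suc)
open import Data.Fin.Subset using (Subset) renaming (∣_∣ to ∣_∣ˢ)
open import Data.Integer.Base as ℤ using (ℤ; 1ℤ)
open import Data.Integer.Properties as ℤₚ using ()
open import Data.List.Base as List using (List; []; _∷_; length)
open import Data.List.Properties as Listₚ using ()
open import Data.List.Relation.Binary.Permutation.Propositional using (_↭_; ↭-refl)
  renaming (refl to ↭-reflexivity; prep to ↭-prep; swap to ↭-swap; trans to ↭-transitivity)
open import Data.List.Relation.Binary.Permutation.Propositional.Properties using (↭-length)
open import Data.Nat.Base as ℕ using (ℕ; zero; suc)
open import Data.Nat.Divisibility.Core using (_∣_; quotient)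
open import Data.Nat.Properties as ℕₚ using ()
open import Data.Product.Base using (Σ-syntax; ∃-syntax; _×_; _,_; proj₁; proj₂)
open import Data.Rational.Base as ℚ using (ℚ; 0ℚ; 1ℚ; ½)
open import Data.Rational.Properties as ℚₚ using ()
open import Data.Sign.Base as Sign using (Sign)
open import Data.Sum.Base using (_⊎_; inj₁; inj₂)
open import Data.Vec.Base as Vec using (Vec; []; _∷_; updateAt; replicate)
open import Level using (0ℓ)
open import Relation.Binary.PropositionalEquality
  using (_≡_; _≢_; _≗_; refl; sym; trans; cong; cong₂; subst; subst₂; module ≡-Reasoning)
open import Relation.Nullary.Decidable using (Dec; dec⇒maybe; yes; no)
open import Relation.Nullary.Negation.Core using (¬_)
open import Tactic.RingSolver using (solve-∀)
open import Tactic.RingSolver.Core.AlmostCommutativeRing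
  using (AlmostCommutativeRing; fromCommutativeRing)

-- Fixing an opposite pair, unlike fixing one coordinate, leaves a balanced slice on the others, so
-- the induction stays within one family. The price is that two coordinates are opposite only with
-- probability n/(2(n-1)): for a single pair α + β is a conditional mean that may differ from 𝔼 f²,
-- and only the average over all pairs restores it. On the product cube this fluctuation is absent.
-- With f of degree d, the step yields 81α² + 54αβ + β² up to a common factor, while the energy
-- bound controls α² + (2 - 2ℓ)αβ + β², where ℓαβ bounds the squared correlations; 81(2 - 2ℓ) = 54
-- singles out ℓ = ⅔. In turn ⅔ is 2/9 + 4/9, the 4/9 being a term of size about 4d/n at n = 9d. For
-- n ≤ 9d the base 16 with a loss of 10/7 per pair suffices, because 16 (10/7)^(9/2) < 81. The
-- estimates are made over the rationals, where equality is decidable and degenerate cases can be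
-- split off; they reach the reals index by index along the Cauchy sequences of the coefficients.

module RationalMoments where

  open import Data.Rational.Base
  open import Data.Rational.Properties
  open import Data.Rational.Unnormalised.Base as ℚᵘ using (mkℚᵘ; *≡*) renaming (_≃_ to _≃ᵘ_)
  open import Data.Rational.Unnormalised.Properties as ℚᵘₚ using ()
  open import Defs using (cube; slice; slice-nonEmpty; subsets; sumℤ; Balanced; balanced?)

  -- Rational arithmetic

  ring : AlmostCommutativeRing 0ℓ 0ℓ
  ring = fromCommutativeRing +-*-commutativeRing (λ x → dec⇒maybe (0ℚ ≟ x))

  #_ : ℕ → ℚ
  # n = ℤ.+ n / 1

  infix 10 #_

  sq : ℚ → ℚ
  sq x = x * x

  #-toℚᵘ : ∀ n → toℚᵘ (# n) ≃ᵘ mkℚᵘ (ℤ.+ n) 0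
  #-toℚᵘ n = toℚᵘ-fromℚᵘ (mkℚᵘ (ℤ.+ n) 0)

  #-+ : ∀ m n → # (m ℕ.+ n) ≡ # m + # n
  #-+ m n = toℚᵘ-injective (begin
    toℚᵘ (# (m ℕ.+ n))                      ≈⟨ #-toℚᵘ (m ℕ.+ n) ⟩
    mkℚᵘ (ℤ.+ (m ℕ.+ n)) 0                  ≈⟨ *≡* (cong (ℤ._* 1ℤ) (sym
      (cong₂ ℤ._+_ (ℤₚ.*-identityʳ (ℤ.+ m)) (ℤₚ.*-identityʳ (ℤ.+ n))))) ⟩
    mkℚᵘ (ℤ.+ m) 0 ℚᵘ.+ mkℚᵘ (ℤ.+ n) 0      ≈⟨ ℚᵘₚ.+-cong (#-toℚᵘ m) (#-toℚᵘ n) ⟨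
    toℚᵘ (# m) ℚᵘ.+ toℚᵘ (# n)              ≈⟨ toℚᵘ-homo-+ (# m) (# n) ⟨
    toℚᵘ (# m + # n)                        ∎)
    where open ℚᵘₚ.≃-Reasoning

  #-* : ∀ m n → # (m ℕ.* n) ≡ # m * # n
  #-* m n = toℚᵘ-injective (begin
    toℚᵘ (# (m ℕ.* n))                      ≈⟨ #-toℚᵘ (m ℕ.* n) ⟩
    mkℚᵘ (ℤ.+ (m ℕ.* n)) 0                  ≈⟨ *≡* (cong (ℤ._* 1ℤ) (ℤₚ.pos-* m n)) ⟩
    mkℚᵘ (ℤ.+ m) 0 ℚᵘ.* mkℚᵘ (ℤ.+ n) 0      ≈⟨ ℚᵘₚ.*-cong (#-toℚᵘ m) (#-toℚᵘ n) ⟨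
    toℚᵘ (# m) ℚᵘ.* toℚᵘ (# n)              ≈⟨ toℚᵘ-homo-* (# m) (# n) ⟨
    toℚᵘ (# m * # n)                        ∎)
    where open ℚᵘₚ.≃-Reasoning

  #-suc : ∀ n → # (suc n) ≡ 1ℚ + # n
  #-suc = #-+ 1

  #-inverse : ∀ n .{{_ : ℕ.NonZero n}} → # n * (1ℤ / n) ≡ 1ℚ
  #-inverse n@(suc n-1) = toℚᵘ-injective (begin
    toℚᵘ (# n * (1ℤ / n))                   ≈⟨ toℚᵘ-homo-* (# n) (1ℤ / n) ⟩
    toℚᵘ (# n) ℚᵘ.* toℚᵘ (1ℤ / n)           ≈⟨ ℚᵘₚ.*-cong (#-toℚᵘ n) (toℚᵘ-fromℚᵘ (mkℚᵘ 1ℤ n-1)) ⟩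
    mkℚᵘ (ℤ.+ n) 0 ℚᵘ.* mkℚᵘ 1ℤ n-1         ≈⟨ ℚᵘₚ.*-inverseʳ (mkℚᵘ (ℤ.+ n) 0) ⟩
    toℚᵘ 1ℚ                                 ∎)
    where open ℚᵘₚ.≃-Reasoning

  0≤# : ∀ n → 0ℚ ≤ # n
  0≤# n = nonNegative⁻¹ (# n) {{normalize-nonNeg n 1}}

  infixl 6 _⊕_
  infixl 7 _⊗_

  _⊕_ : ∀ {p q} → 0ℚ ≤ p → 0ℚ ≤ q → 0ℚ ≤ p + q
  _⊕_ = +-mono-≤

  _⊗_ : ∀ {p q} → 0ℚ ≤ p → 0ℚ ≤ q → 0ℚ ≤ p * q
  _⊗_ {p} {q} 0≤p 0≤q = subst (_≤ p * q) (*-zeroʳ p) (*-monoˡ-≤-nonNeg p {{nonNegative 0≤p}} 0≤q)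

  0≤sq : ∀ x → 0ℚ ≤ sq x
  0≤sq x with ≤-total 0ℚ x
  ... | inj₁ 0≤x = 0≤x ⊗ 0≤x
  ... | inj₂ x≤0 = subst (0ℚ ≤_) (neg² x) (neg-antimono-≤ x≤0 ⊗ neg-antimono-≤ x≤0)
    where
    neg² : ∀ x → - x * - x ≡ x * x
    neg² = solve-∀ ring

  0≤½ : 0ℚ ≤ ½
  0≤½ = nonNegative⁻¹ ½

  0≤-gap : ∀ {x y} → x ≤ y → 0ℚ ≤ y - x
  0≤-gap {x} {y} x≤y = subst (_≤ y - x) (+-inverseʳ x) (+-monoˡ-≤ (- x) x≤y)

  -- The main tool for inequalities below: the difference of the two sides is exhibited as a
  -- combination of quantities already known to be nonnegative, and the ring solver checks that
  -- identity.
  ≤-by-gap : ∀ {x y p} → 0ℚ ≤ p → y - x ≡ p → x ≤ y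
  ≤-by-gap {x} {y} 0≤p y-x≡p = subst₂ _≤_ (+-identityˡ x) (cancel x y)
    (+-monoˡ-≤ x (subst (0ℚ ≤_) (sym y-x≡p) 0≤p))
    where
    cancel : ∀ x y → y - x + x ≡ y
    cancel = solve-∀ ring

  ≤∧≢⇒< : ∀ {x y} → x ≤ y → x ≢ y → x < y
  ≤∧≢⇒< x≤y x≢y = ≰⇒> (λ y≤x → x≢y (≤-antisym x≤y y≤x))

  sq-cancel-≤ : ∀ {x y} → 0ℚ ≤ y → sq x ≤ sq y → x ≤ y
  sq-cancel-≤ {x} {y} 0≤y x²≤y² with ≤-total x y
  ... | inj₁ x≤y = x≤y
  ... | inj₂ y≤x with y ≟ x
  ...   | yes refl = ≤-refl
  ...   | no y≢x = ⊥-elim (<-irrefl refl (<-≤-trans (≤-<-trans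
            (*-monoˡ-≤-nonNeg y {{nonNegative 0≤y}} y≤x)
            (*-monoˡ-<-pos x {{positive (≤-<-trans 0≤y y<x)}} y<x)) x²≤y²))
    where y<x = ≤∧≢⇒< y≤x y≢x

  am-gm : ∀ {x p q} → 0ℚ ≤ p → 0ℚ ≤ q → sq x ≤ p * q → # 2 * x ≤ p + q
  am-gm {x} {p} {q} 0≤p 0≤q x²≤pq = sq-cancel-≤ (0≤p ⊕ 0≤q)
    (≤-by-gap (0≤# 4 ⊗ 0≤-gap x²≤pq ⊕ 0≤sq (p - q)) (certificate x p q))
    where
    certificate : ∀ x p q → (p + q) * (p + q) - (# 2 * x) * (# 2 * x)
                  ≡ # 4 * (p * q - x * x) + (p - q) * (p - q)
    certificate = solve-∀ ring

  -- At (s, t) = (-β, α) the form equals α(αγ - β²), and a nonzero α is positive and can be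
  -- cancelled. If α vanishes and γ does not, γ takes its place.
  discriminant-≤ : ∀ {α β γ} → (∀ s t → 0ℚ ≤ sq s * α + # 2 * (s * t) * β + sq t * γ) →
                   sq β ≤ α * γ
  discriminant-≤ {α} {β} {γ} form≥0 with α ≟ 0ℚ | γ ≟ 0ℚ
  ... | no α≢0 | _ = ≤-by-gap (*-cancelˡ-≤-pos α {{positive α>0}}
          (subst₂ _≤_ (sym (*-zeroʳ α)) (certificate α β γ) (form≥0 (- β) α))) refl
    where
    α≥0 : 0ℚ ≤ α
    α≥0 = subst (0ℚ ≤_) (at-1-0 α β γ) (form≥0 1ℚ 0ℚ)
      where
      at-1-0 : ∀ α β γ → 1ℚ * 1ℚ * α + # 2 * (1ℚ * 0ℚ) * β + 0ℚ * 0ℚ * γ ≡ α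
      at-1-0 = solve-∀ ring
    α>0 = ≤∧≢⇒< α≥0 (λ 0≡α → α≢0 (sym 0≡α))
    certificate : ∀ α β γ → (- β) * (- β) * α + # 2 * (- β * α) * β + α * α * γ
                  ≡ α * (α * γ - β * β)
    certificate = solve-∀ ring
  ... | yes _ | no γ≢0 = ≤-by-gap (*-cancelˡ-≤-pos γ {{positive γ>0}}
          (subst₂ _≤_ (sym (*-zeroʳ γ)) (certificate α β γ) (form≥0 γ (- β)))) refl
    where
    γ≥0 : 0ℚ ≤ γ
    γ≥0 = subst (0ℚ ≤_) (at-0-1 α β γ) (form≥0 0ℚ 1ℚ)
      where
      at-0-1 : ∀ α β γ → 0ℚ * 0ℚ * α + # 2 * (0ℚ * 1ℚ) * β + 1ℚ * 1ℚ * γ ≡ γ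
      at-0-1 = solve-∀ ring
    γ>0 = ≤∧≢⇒< γ≥0 (λ 0≡γ → γ≢0 (sym 0≡γ))
    certificate : ∀ α β γ → γ * γ * α + # 2 * (γ * - β) * β + (- β) * (- β) * γ
                  ≡ γ * (α * γ - β * β)
    certificate = solve-∀ ring
  -- With α = γ = 0 the form is 2stβ; its values at (1, 1) and (1, -1) are both nonnegative and
  -- multiply to -4β².
  ... | yes refl | yes refl = ≤-by-gap (0≤# 2 ⊗ (form≥0 1ℚ 1ℚ ⊗ form≥0 1ℚ (- 1ℚ)) ⊕ 0≤sq β ⊗ 0≤# 7)
          (certificate β)
    where
    certificate : ∀ β → 0ℚ * 0ℚ - β * β
      ≡ # 2 * ((1ℚ * 1ℚ * 0ℚ + # 2 * (1ℚ * 1ℚ) * β + 1ℚ * 1ℚ * 0ℚ)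
         * (1ℚ * 1ℚ * 0ℚ + # 2 * (1ℚ * - 1ℚ) * β + (- 1ℚ) * (- 1ℚ) * 0ℚ)) + β * β * # 7
    certificate = solve-∀ ring

  -- Sums over the choices of a list entry

  -- ∑ L φ is the sum of φ i M over the ways of picking an entry i of L, with
  -- M the list of the remaining entries in their original order.
  ∑ : {I : Set} → List I → (I → List I → ℚ) → ℚ
  ∑ []      φ = 0ℚ
  ∑ (i ∷ L) φ = φ i L + ∑ L (λ k M → φ k (i ∷ M))

  module _ {I : Set} where

    ∑-cong : ∀ (L : List I) {φ ψ} →
             (∀ k M → L ↭ k ∷ M → φ k M ≡ ψ k M) → ∑ L φ ≡ ∑ L ψ
    ∑-cong []      eq = refl
    ∑-cong (i ∷ L) eq = cong₂ _+_ (eq i L ↭-refl)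
      (∑-cong L (λ k M p → eq k (i ∷ M) (↭-transitivity (↭-prep i p) (↭-swap i k ↭-refl))))

    ∑-mono : ∀ (L : List I) {φ ψ} →
             (∀ k M → L ↭ k ∷ M → φ k M ≤ ψ k M) → ∑ L φ ≤ ∑ L ψ
    ∑-mono []      le = ≤-refl
    ∑-mono (i ∷ L) le = +-mono-≤ (le i L ↭-refl)
      (∑-mono L (λ k M p → le k (i ∷ M) (↭-transitivity (↭-prep i p) (↭-swap i k ↭-refl))))

    ∑-+ : ∀ (L : List I) φ ψ → ∑ L (λ k M → φ k M + ψ k M) ≡ ∑ L φ + ∑ L ψ
    ∑-+ []      φ ψ = refl
    ∑-+ (i ∷ L) φ ψ = trans
      (cong (φ i L + ψ i L +_) (∑-+ L (λ k M → φ k (i ∷ M)) (λ k M → ψ k (i ∷ M))))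
      (interchange (φ i L) (ψ i L) _ _)
      where
      interchange : ∀ a b c d → a + b + (c + d) ≡ a + c + (b + d)
      interchange = solve-∀ ring

    ∑-* : ∀ (L : List I) c φ → ∑ L (λ k M → c * φ k M) ≡ c * ∑ L φ
    ∑-* []      c φ = sym (*-zeroʳ c)
    ∑-* (i ∷ L) c φ = trans (cong (c * φ i L +_) (∑-* L c (λ k M → φ k (i ∷ M))))
      (sym (*-distribˡ-+ c (φ i L) _))

    ∑-const : ∀ (L : List I) c → ∑ L (λ _ _ → c) ≡ # (length L) * c
    ∑-const []      c = sym (*-zeroˡ c)
    ∑-const (i ∷ L) c = trans (cong (c +_) (∑-const L c))
      (trans (suc-* c (# (length L))) (cong (_* c) (sym (#-suc (length L)))))
      where
      suc-* : ∀ c n → c + n * c ≡ (1ℚ + n) * c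
      suc-* = solve-∀ ring

    ∑-0 : ∀ (L : List I) → ∑ L (λ _ _ → 0ℚ) ≡ 0ℚ
    ∑-0 L = trans (∑-const L 0ℚ) (*-zeroʳ (# (length L)))

    0≤∑ : ∀ (L : List I) {φ} → (∀ k M → L ↭ k ∷ M → 0ℚ ≤ φ k M) → 0ℚ ≤ ∑ L φ
    0≤∑ L {φ} φ≥0 = subst (_≤ ∑ L φ) (∑-0 L) (∑-mono L φ≥0)

    ∑-linear : ∀ (L : List I) c d φ ψ →
               ∑ L (λ k M → c * φ k M + d * ψ k M) ≡ c * ∑ L φ + d * ∑ L ψ
    ∑-linear L c d φ ψ = trans (∑-+ L (λ k M → c * φ k M) (λ k M → d * ψ k M))
      (cong₂ _+_ (∑-* L c φ) (∑-* L d ψ))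

    ∑-swap : ∀ (L : List I) (φ : I → I → List I → ℚ) →
             ∑ L (λ i M → ∑ M (λ j N → φ i j N)) ≡ ∑ L (λ i M → ∑ M (λ j N → φ j i N))
    ∑-swap []      φ = refl
    ∑-swap (x ∷ L) φ = begin
      ∑ L (φ x) + ∑ L (λ k M → φ k x M + ∑ M (λ j N → φ k j (x ∷ N)))
        ≡⟨ cong (∑ L (φ x) +_) (∑-+ L (λ k M → φ k x M) (λ k M → ∑ M (λ j N → φ k j (x ∷ N)))) ⟩
      ∑ L (φ x) + (∑ L (λ k M → φ k x M) + ∑ L (λ k M → ∑ M (λ j N → φ k j (x ∷ N))))
        ≡⟨ cong (λ s → ∑ L (φ x) + (∑ L (λ k M → φ k x M) + s)) (∑-swap L (λ i j N → φ i j (x ∷ N))) ⟩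
      ∑ L (φ x) + (∑ L (λ k M → φ k x M) + ∑ L (λ k M → ∑ M (λ j N → φ j k (x ∷ N))))
        ≡⟨ exchange (∑ L (φ x)) (∑ L (λ k M → φ k x M)) _ ⟩
      ∑ L (λ k M → φ k x M) + (∑ L (φ x) + ∑ L (λ k M → ∑ M (λ j N → φ j k (x ∷ N))))
        ≡⟨ cong (∑ L (λ k M → φ k x M) +_) (∑-+ L (φ x) (λ k M → ∑ M (λ j N → φ j k (x ∷ N)))) ⟨
      ∑ L (λ k M → φ k x M) + ∑ L (λ k M → φ x k M + ∑ M (λ j N → φ j k (x ∷ N))) ∎
      where
      open ≡-Reasoning
      exchange : ∀ a b c → a + (b + c) ≡ b + (a + c)
      exchange = solve-∀ ring

    -- Invariance of `φ` is required only on lists one shorter than `L`, because the main instance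
    -- is `E m`, which is independent of the order only on lists of length `double m`.
    ∑-↭ : ∀ {L L′ : List I} {φ} →
          (∀ k M M′ → suc (length M) ≡ length L → M ↭ M′ → φ k M ≡ φ k M′) →
          L ↭ L′ → ∑ L φ ≡ ∑ L′ φ
    ∑-↭ φ-↭ ↭-reflexivity = refl
    ∑-↭ φ-↭ (↭-prep i p) = cong₂ _+_ (φ-↭ i _ _ refl p)
      (∑-↭ (λ k M M′ eq q → φ-↭ k (i ∷ M) (i ∷ M′) (cong suc eq) (↭-prep i q)) p)
    ∑-↭ {φ = φ} φ-↭ (↭-swap {L} {L′} i j p) = begin
      φ i (j ∷ L) + (φ j (i ∷ L) + ∑ L (λ k M → φ k (i ∷ j ∷ M)))
        ≡⟨ cong₂ (λ a b → a + (b + ∑ L (λ k M → φ k (i ∷ j ∷ M))))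
             (φ-↭ i _ _ refl (↭-prep j p)) (φ-↭ j _ _ refl (↭-prep i p)) ⟩
      φ i (j ∷ L′) + (φ j (i ∷ L′) + ∑ L (λ k M → φ k (i ∷ j ∷ M)))
        ≡⟨ cong (λ s → φ i (j ∷ L′) + (φ j (i ∷ L′) + s)) (trans
             (∑-cong L (λ k M q → φ-↭ k _ _ (cong (λ l → suc (suc l)) (sym (↭-length q)))
               (↭-swap i j ↭-refl)))
             (∑-↭ (λ k M M′ eq q → φ-↭ k _ _ (cong (λ l → suc (suc l)) eq)
               (↭-prep j (↭-prep i q))) p)) ⟩
      φ i (j ∷ L′) + (φ j (i ∷ L′) + ∑ L′ (λ k M → φ k (j ∷ i ∷ M)))
        ≡⟨ exchange (φ i (j ∷ L′)) (φ j (i ∷ L′)) _ ⟩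
      φ j (i ∷ L′) + (φ i (j ∷ L′) + ∑ L′ (λ k M → φ k (j ∷ i ∷ M))) ∎
      where
      open ≡-Reasoning
      exchange : ∀ a b c → a + (b + c) ≡ b + (a + c)
      exchange = solve-∀ ring
    ∑-↭ φ-↭ (↭-transitivity p q) = trans (∑-↭ φ-↭ p)
      (∑-↭ (λ k M M′ eq → φ-↭ k M M′ (trans eq (sym (↭-length p)))) q)

    ∑∑ : List I → (I → I → List I → ℚ) → ℚ
    ∑∑ L φ = ∑ L (λ i M → ∑ M (λ j N → φ i j N))

    pick-pick : ∀ {L M N : List I} {i j} → L ↭ i ∷ M → M ↭ j ∷ N → L ↭ i ∷ j ∷ N
    pick-pick {i = i} p q = ↭-transitivity p (↭-prep i q)

    ∑∑-cong : ∀ (L : List I) {φ ψ} →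
              (∀ i j N → L ↭ i ∷ j ∷ N → φ i j N ≡ ψ i j N) → ∑∑ L φ ≡ ∑∑ L ψ
    ∑∑-cong L eq = ∑-cong L (λ i M p → ∑-cong M (λ j N q → eq i j N (pick-pick p q)))

    ∑∑-mono : ∀ (L : List I) {φ ψ} →
              (∀ i j N → L ↭ i ∷ j ∷ N → φ i j N ≤ ψ i j N) → ∑∑ L φ ≤ ∑∑ L ψ
    ∑∑-mono L le = ∑-mono L (λ i M p → ∑-mono M (λ j N q → le i j N (pick-pick p q)))

    0≤∑∑ : ∀ (L : List I) {φ} → (∀ i j N → L ↭ i ∷ j ∷ N → 0ℚ ≤ φ i j N) → 0ℚ ≤ ∑∑ L φ
    0≤∑∑ L φ≥0 = 0≤∑ L (λ i M p → 0≤∑ M (λ j N q → φ≥0 i j N (pick-pick p q)))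

    ∑∑-linear : ∀ (L : List I) c d φ ψ →
                ∑∑ L (λ i j N → c * φ i j N + d * ψ i j N) ≡ c * ∑∑ L φ + d * ∑∑ L ψ
    ∑∑-linear L c d φ ψ = trans
      (∑-cong L (λ i M _ → ∑-linear M c d (φ i) (ψ i)))
      (∑-linear L c d (λ i M → ∑ M (φ i)) (λ i M → ∑ M (ψ i)))

    ∑∑-* : ∀ (L : List I) c φ → ∑∑ L (λ i j N → c * φ i j N) ≡ c * ∑∑ L φ
    ∑∑-* L c φ = trans (∑-cong L (λ i M _ → ∑-* M c (φ i))) (∑-* L c (λ i M → ∑ M (φ i)))

    ∑∑-+ : ∀ (L : List I) φ ψ → ∑∑ L (λ i j N → φ i j N + ψ i j N) ≡ ∑∑ L φ + ∑∑ L ψ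
    ∑∑-+ L φ ψ = trans (∑-cong L (λ i M _ → ∑-+ M (φ i) (ψ i)))
      (∑-+ L (λ i M → ∑ M (φ i)) (λ i M → ∑ M (ψ i)))

    ∑∑-exchange : ∀ (L : List I) (φ : I → I → I → I → List I → ℚ) →
      ∑∑ L (λ i j N → ∑∑ N (λ k l O → φ i j k l O)) ≡
      ∑∑ L (λ k l N → ∑∑ N (λ i j O → φ i j k l O))
    ∑∑-exchange L φ = begin
      ∑ L (λ i M → ∑ M (λ j N → ∑ N (λ k N₁ → ∑ N₁ (λ l O → φ i j k l O))))
        ≡⟨ ∑-cong L (λ i M _ → ∑-swap M (λ j k N₁ → ∑ N₁ (λ l O → φ i j k l O))) ⟩
      ∑ L (λ i M → ∑ M (λ k N → ∑ N (λ j N₁ → ∑ N₁ (λ l O → φ i j k l O))))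
        ≡⟨ ∑-swap L (λ i k N → ∑ N (λ j N₁ → ∑ N₁ (λ l O → φ i j k l O))) ⟩
      ∑ L (λ k M → ∑ M (λ i N → ∑ N (λ j N₁ → ∑ N₁ (λ l O → φ i j k l O))))
        ≡⟨ ∑-cong L (λ k M _ → ∑-cong M (λ i N _ → ∑-swap N (λ j l O → φ i j k l O))) ⟩
      ∑ L (λ k M → ∑ M (λ i N → ∑ N (λ l N₁ → ∑ N₁ (λ j O → φ i j k l O))))
        ≡⟨ ∑-cong L (λ k M _ → ∑-swap M (λ i l N → ∑ N (λ j O → φ i j k l O))) ⟩
      ∑ L (λ k M → ∑ M (λ l N → ∑ N (λ i N₁ → ∑ N₁ (λ j O → φ i j k l O)))) ∎
      where open ≡-Reasoning

    ∑∑∑-rotate : ∀ (L : List I) (φ : I → I → I → List I → ℚ) →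
      ∑ L (λ i M → ∑∑ M (λ j k N → φ i j k N)) ≡ ∑∑ L (λ j k N → ∑ N (λ i O → φ i j k O))
    ∑∑∑-rotate L φ = trans
      (∑-swap L (λ i j N → ∑ N (λ k O → φ i j k O)))
      (∑-cong L (λ j M _ → ∑-swap M (λ i k O → φ i j k O)))

  -- Splitting a function along a pair of coordinates

  Fun : ℕ → Set
  Fun n = Vec ℚ n → ℚ

  pattern ⊹ = Sign.+
  pattern ⊖ = Sign.-

  sgn : Sign → ℚ
  sgn ⊹ = 1ℚ
  sgn ⊖ = - 1ℚ

  -- Adding ±1 to a coordinate instead of overwriting it makes all shifts
  -- commute, even at equal indices; started at 0 and used once per coordinate,
  -- the shifts produce the points of the cube.
  opaque
    shift : ∀ {n} → Sign → Fin n → Vec ℚ n → Vec ℚ n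
    shift s i x = updateAt x i (sgn s +_)

    shift-comm : ∀ {n} s i s′ j (x : Vec ℚ n) →
                 shift s i (shift s′ j x) ≡ shift s′ j (shift s i x)
    shift-comm s zero    s′ zero    (x ∷ xs) = cong (_∷ xs) (exchange (sgn s) (sgn s′) x)
      where
      exchange : ∀ a b c → a + (b + c) ≡ b + (a + c)
      exchange = solve-∀ ring
    shift-comm s zero    s′ (suc j) (x ∷ xs) = refl
    shift-comm s (suc i) s′ zero    (x ∷ xs) = refl
    shift-comm s (suc i) s′ (suc j) (x ∷ xs) = cong (x ∷_) (shift-comm s i s′ j xs)

  -- The parameter ε merges half the sum and half the difference, so that linearity and commutation
  -- are proved once for all four combinations.
  D : ∀ {n} → ℚ → Fin n → Fin n → Fun n → Fun n
  D ε i j F x = ½ * (F (shift ⊹ i (shift ⊖ j x)) +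
                     ε * F (shift ⊖ i (shift ⊹ j x)))

  -- Writing y for xᵢ = - xⱼ, a function F becomes A i j F + y * B i j F.
  A B : ∀ {n} → Fin n → Fin n → Fun n → Fun n
  A = D 1ℚ
  B = D (- 1ℚ)

  module _ {n : ℕ} where

    D-cong : ∀ {F G : Fun n} ε i j → F ≗ G → D ε i j F ≗ D ε i j G
    D-cong ε i j F≗G x = cong₂ (λ p q → ½ * (p + ε * q)) (F≗G _) (F≗G _)

    D-linear : ∀ ε i j c d (F G : Fun n) x →
               D ε i j (λ y → c * F y + d * G y) x ≡ c * D ε i j F x + d * D ε i j G x
    D-linear ε i j c d F G x = identity c d ε _ _ _ _
      where
      identity : ∀ c d ε p q r s → ½ * ((c * p + d * q) + ε * (c * r + d * s))
                 ≡ c * (½ * (p + ε * r)) + d * (½ * (q + ε * s))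
      identity = solve-∀ ring

    A-sym : ∀ i j (F : Fun n) → A i j F ≗ A j i F
    A-sym i j F x = trans (identity (F (shift ⊹ i (shift ⊖ j x))) (F (shift ⊖ i (shift ⊹ j x))))
      (cong₂ (λ p q → ½ * (F p + 1ℚ * F q)) (shift-comm ⊖ i ⊹ j x)
                                            (shift-comm ⊹ i ⊖ j x))
      where
      identity : ∀ p q → ½ * (p + 1ℚ * q) ≡ ½ * (q + 1ℚ * p)
      identity = solve-∀ ring

    B-antisym : ∀ i j (F : Fun n) x → B i j F x ≡ - B j i F x
    B-antisym i j F x = trans (identity (F (shift ⊹ i (shift ⊖ j x))) (F (shift ⊖ i (shift ⊹ j x))))
      (cong₂ (λ p q → - (½ * (F p + - 1ℚ * F q))) (shift-comm ⊖ i ⊹ j x)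
                                                  (shift-comm ⊹ i ⊖ j x))
      where
      identity : ∀ p q → ½ * (p + - 1ℚ * q) ≡ - (½ * (q + - 1ℚ * p))
      identity = solve-∀ ring

    mix : ℚ → ℚ → ℚ → ℚ → ℚ → ℚ → ℚ
    mix δ ε p q r s = ½ * (½ * (p + δ * q) + ε * (½ * (r + δ * s)))

    mix-cong : ∀ δ ε {p p′ q q′ r r′ s s′} → p ≡ p′ → q ≡ q′ → r ≡ r′ → s ≡ s′ →
               mix δ ε p q r s ≡ mix δ ε p′ q′ r′ s′
    mix-cong δ ε refl refl refl refl = refl

    -- No distinctness of the indices is assumed, since additive shifts always commute. This matters
    -- for `Deg`, which quantifies over pairs that may overlap.
    D-comm : ∀ δ ε i j k l (F : Fun n) → D ε i j (D δ k l F) ≗ D δ k l (D ε i j F)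
    D-comm δ ε i j k l F x = trans
      (mix-cong δ ε (move ⊹ ⊖ ⊹ ⊖) (move ⊹ ⊖ ⊖ ⊹) (move ⊖ ⊹ ⊹ ⊖) (move ⊖ ⊹ ⊖ ⊹))
      (identity δ ε (G ⊹ ⊖ ⊹ ⊖) (G ⊹ ⊖ ⊖ ⊹) (G ⊖ ⊹ ⊹ ⊖) (G ⊖ ⊹ ⊖ ⊹))
      where
      G : Sign → Sign → Sign → Sign → ℚ
      G a b c d = F (shift a i (shift b j (shift c k (shift d l x))))
      move : ∀ a b c d → F (shift c k (shift d l (shift a i (shift b j x)))) ≡ G a b c d
      move a b c d = cong F (begin
        shift c k (shift d l (shift a i (shift b j x)))
          ≡⟨ cong (shift c k) (shift-comm d l a i (shift b j x)) ⟩
        shift c k (shift a i (shift d l (shift b j x)))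
          ≡⟨ shift-comm c k a i (shift d l (shift b j x)) ⟩
        shift a i (shift c k (shift d l (shift b j x)))
          ≡⟨ cong (λ y → shift a i (shift c k y)) (shift-comm d l b j x) ⟩
        shift a i (shift c k (shift b j (shift d l x)))
          ≡⟨ cong (shift a i) (shift-comm c k b j (shift d l x)) ⟩
        shift a i (shift b j (shift c k (shift d l x))) ∎)
        where open ≡-Reasoning
      identity : ∀ δ ε p q r s → ½ * (½ * (p + δ * q) + ε * (½ * (r + δ * s)))
                               ≡ ½ * (½ * (p + ε * r) + δ * (½ * (q + ε * s)))
      identity = solve-∀ ring

    -- The signs in ⟨ a , b , c , d ⟩ are those added to the coordinates
    -- i, j, k, l. All identities on four coordinates below compare values of F
    -- at the six balanced sign patterns.
    module Pattern (F : Fun n) (i j k l : Fin n) (x : Vec ℚ n) where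

      ⟨_,_,_,_⟩ : Sign → Sign → Sign → Sign → ℚ
      ⟨ a , b , c , d ⟩ = F (shift a i (shift b j (shift c k (shift d l x))))

      private
        jki : ∀ a b c d → F (shift b j (shift c k (shift a i (shift d l x)))) ≡ ⟨ a , b , c , d ⟩
        jki a b c d = cong F (trans (cong (shift b j) (shift-comm c k a i _)) (shift-comm b j a i _))

        ikj : ∀ a b c d → F (shift a i (shift c k (shift b j (shift d l x)))) ≡ ⟨ a , b , c , d ⟩
        ikj a b c d = cong (λ y → F (shift a i y)) (shift-comm c k b j _)

        kij : ∀ a b c d → F (shift c k (shift a i (shift b j (shift d l x)))) ≡ ⟨ a , b , c , d ⟩
        kij a b c d = trans (cong F (shift-comm c k a i _)) (ikj a b c d)

      D-il-jk : ∀ δ ε → D ε i l (D δ j k F) x ≡ mix δ ε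
        ⟨ ⊹ , ⊹ , ⊖ , ⊖ ⟩ ⟨ ⊹ , ⊖ , ⊹ , ⊖ ⟩
        ⟨ ⊖ , ⊹ , ⊖ , ⊹ ⟩ ⟨ ⊖ , ⊖ , ⊹ , ⊹ ⟩
      D-il-jk δ ε = mix-cong δ ε (jki ⊹ ⊹ ⊖ ⊖) (jki ⊹ ⊖ ⊹ ⊖) (jki ⊖ ⊹ ⊖ ⊹) (jki ⊖ ⊖ ⊹ ⊹)

      D-jl-ik : ∀ δ ε → D ε j l (D δ i k F) x ≡ mix δ ε
        ⟨ ⊹ , ⊹ , ⊖ , ⊖ ⟩ ⟨ ⊖ , ⊹ , ⊹ , ⊖ ⟩
        ⟨ ⊹ , ⊖ , ⊖ , ⊹ ⟩ ⟨ ⊖ , ⊖ , ⊹ , ⊹ ⟩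
      D-jl-ik δ ε = mix-cong δ ε (ikj ⊹ ⊹ ⊖ ⊖) (ikj ⊖ ⊹ ⊹ ⊖) (ikj ⊹ ⊖ ⊖ ⊹) (ikj ⊖ ⊖ ⊹ ⊹)

      D-jl-ki : ∀ δ ε → D ε j l (D δ k i F) x ≡ mix δ ε
        ⟨ ⊖ , ⊹ , ⊹ , ⊖ ⟩ ⟨ ⊹ , ⊹ , ⊖ , ⊖ ⟩
        ⟨ ⊖ , ⊖ , ⊹ , ⊹ ⟩ ⟨ ⊹ , ⊖ , ⊖ , ⊹ ⟩
      D-jl-ki δ ε = mix-cong δ ε (kij ⊖ ⊹ ⊹ ⊖) (kij ⊹ ⊹ ⊖ ⊖) (kij ⊖ ⊖ ⊹ ⊹) (kij ⊹ ⊖ ⊖ ⊹)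

      -- On balanced patterns of four coordinates each term is, with the same factor, a sum of (xᵢ -
      -- xⱼ) F or a cyclic analogue, and (xᵢ - xⱼ) + (xⱼ - xₖ) + (xₖ - xᵢ) = 0.
      B-cocycle : A k l (B i j F) x + A i l (B j k F) x + A j l (B k i F) x ≡ 0ℚ
      B-cocycle = trans
        (cong₂ (λ p q → A k l (B i j F) x + p + q) (D-il-jk (- 1ℚ) 1ℚ) (D-jl-ki (- 1ℚ) 1ℚ))
        (identity ⟨ ⊹ , ⊹ , ⊖ , ⊖ ⟩ ⟨ ⊹ , ⊖ , ⊹ , ⊖ ⟩
                  ⟨ ⊹ , ⊖ , ⊖ , ⊹ ⟩ ⟨ ⊖ , ⊹ , ⊹ , ⊖ ⟩
                  ⟨ ⊖ , ⊹ , ⊖ , ⊹ ⟩ ⟨ ⊖ , ⊖ , ⊹ , ⊹ ⟩)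
        where
        identity : ∀ p q r p′ q′ r′ →
          ½ * (½ * (q + - 1ℚ * p′) + 1ℚ * (½ * (r + - 1ℚ * q′))) +
          ½ * (½ * (p + - 1ℚ * q) + 1ℚ * (½ * (q′ + - 1ℚ * r′))) +
          ½ * (½ * (p′ + - 1ℚ * p) + 1ℚ * (½ * (r′ + - 1ℚ * r))) ≡ 0ℚ
        identity = solve-∀ ring

      -- The left side runs over the patterns with xⱼ ≠ xₖ, signed by xᵢxⱼ. The sign is + where xᵢ =
      -- xⱼ ≠ xₖ and - where xᵢ = xₖ ≠ xⱼ; the patterns with xᵢ opposite to both occur twice on the
      -- right and cancel.
      B-B : B i l (B j k F) x ≡ A j l (A i k F) x - A k l (A i j F) x
      B-B = trans (D-il-jk (- 1ℚ) (- 1ℚ)) (trans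
        (identity ⟨ ⊹ , ⊹ , ⊖ , ⊖ ⟩ ⟨ ⊹ , ⊖ , ⊹ , ⊖ ⟩
                  ⟨ ⊹ , ⊖ , ⊖ , ⊹ ⟩ ⟨ ⊖ , ⊹ , ⊹ , ⊖ ⟩
                  ⟨ ⊖ , ⊹ , ⊖ , ⊹ ⟩ ⟨ ⊖ , ⊖ , ⊹ , ⊹ ⟩)
        (cong (_- A k l (A i j F) x) (sym (D-jl-ik 1ℚ 1ℚ))))
        where
        identity : ∀ p q r p′ q′ r′ →
          ½ * (½ * (p + - 1ℚ * q) + - 1ℚ * (½ * (q′ + - 1ℚ * r′))) ≡
          ½ * (½ * (p + 1ℚ * p′) + 1ℚ * (½ * (r + 1ℚ * r′))) -
          ½ * (½ * (q + 1ℚ * p′) + 1ℚ * (½ * (r + 1ℚ * q′)))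
        identity = solve-∀ ring

      -- Where xᵢ ≠ xⱼ, exactly one of the two differs from xₖ, so each subtracted pattern is also
      -- added once. The two patterns with xᵢ = xⱼ ≠ xₖ remain.
      0≤A+A-A : (∀ y → 0ℚ ≤ F y) →
                0ℚ ≤ A j l (A i k F) x + A i l (A j k F) x - A k l (A i j F) x
      0≤A+A-A F≥0 = subst (0ℚ ≤_) (sym (trans
        (cong₂ (λ p q → p + q - A k l (A i j F) x) (D-jl-ik 1ℚ 1ℚ) (D-il-jk 1ℚ 1ℚ))
        (identity ⟨ ⊹ , ⊹ , ⊖ , ⊖ ⟩ ⟨ ⊹ , ⊖ , ⊹ , ⊖ ⟩
                  ⟨ ⊹ , ⊖ , ⊖ , ⊹ ⟩ ⟨ ⊖ , ⊹ , ⊹ , ⊖ ⟩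
                  ⟨ ⊖ , ⊹ , ⊖ , ⊹ ⟩ ⟨ ⊖ , ⊖ , ⊹ , ⊹ ⟩)))
        (0≤½ ⊗ (F≥0 _ ⊕ F≥0 _))
        where
        identity : ∀ p q r p′ q′ r′ →
          ½ * (½ * (p + 1ℚ * p′) + 1ℚ * (½ * (r + 1ℚ * r′))) +
          ½ * (½ * (p + 1ℚ * q) + 1ℚ * (½ * (q′ + 1ℚ * r′))) -
          ½ * (½ * (q + 1ℚ * p′) + 1ℚ * (½ * (r + 1ℚ * q′))) ≡ ½ * (p + r′)
        identity = solve-∀ ring

  -- Means over balanced sign patterns

  double : ℕ → ℕ
  double zero    = zero
  double (suc m) = suc (suc (double m))

  odd : ℕ → ℚ
  odd m = # (suc (double m))

  opaque
    odd⁻¹ : ℕ → ℚ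
    odd⁻¹ m = 1ℤ / suc (double m)

    odd*odd⁻¹ : ∀ m → odd m * odd⁻¹ m ≡ 1ℚ
    odd*odd⁻¹ m = #-inverse (suc (double m))

    0≤odd⁻¹ : ∀ m → 0ℚ ≤ odd⁻¹ m
    0≤odd⁻¹ m = nonNegative⁻¹ _ {{normalize-nonNeg 1 (suc (double m))}}

  odd-cancel : ∀ m x → odd m * (odd⁻¹ m * x) ≡ x
  odd-cancel m x = trans (sym (*-assoc (odd m) (odd⁻¹ m) x))
    (trans (cong (_* x) (odd*odd⁻¹ m)) (*-identityˡ x))

  #-double-suc : ∀ m → # (double (suc m)) ≡ 1ℚ + odd m
  #-double-suc m = #-suc (suc (double m))

  module _ {n : ℕ} where

    -- E m L F is the mean of F over the balanced sign patterns on the 2m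
    -- coordinates in L: the entry i is matched with a uniformly random other
    -- entry k, and xᵢ = - xₖ is a uniformly random sign.
    E : ℕ → List (Fin n) → Fun n → ℚ
    E zero    L       F = F (replicate n 0ℚ)
    E (suc m) []      F = 0ℚ
    E (suc m) (i ∷ L) F = odd⁻¹ m * ∑ L (λ k M → E m M (A i k F))

    -- The mean of xᵢ * G over the balanced sign patterns on i ∷ M.
    Γ : ℕ → Fin n → List (Fin n) → Fun n → ℚ
    -- A list `i ∷ M` never has 0 entries, so this is a default value; 0 keeps homogeneity and the
    -- Cauchy-Schwarz bound valid at m = 0.
    Γ zero    i M G = 0ℚ
    Γ (suc m) i M G = odd⁻¹ m * ∑ M (λ k N → E m N (B i k G))

    E-cong : ∀ m L {F G : Fun n} → F ≗ G → E m L F ≡ E m L G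
    E-cong zero    L       F≗G = F≗G _
    E-cong (suc m) []      F≗G = refl
    E-cong (suc m) (i ∷ L) F≗G = cong (odd⁻¹ m *_)
      (∑-cong L (λ k M _ → E-cong m M (D-cong 1ℚ i k F≗G)))

    E-linear : ∀ m L c d (F G : Fun n) →
               E m L (λ x → c * F x + d * G x) ≡ c * E m L F + d * E m L G
    E-linear zero    L       c d F G = refl
    E-linear (suc m) []      c d F G = sym (identity c d)
      where
      identity : ∀ c d → c * 0ℚ + d * 0ℚ ≡ 0ℚ
      identity = solve-∀ ring
    E-linear (suc m) (i ∷ L) c d F G = trans
      (cong (odd⁻¹ m *_) (trans
        (∑-cong L (λ k M _ → trans (E-cong m M (D-linear 1ℚ i k c d F G))
                                   (E-linear m M c d (A i k F) (A i k G))))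
        (∑-linear L c d (λ k M → E m M (A i k F)) (λ k M → E m M (A i k G)))))
      (identity (odd⁻¹ m) c d (∑ L (λ k M → E m M (A i k F))) (∑ L (λ k M → E m M (A i k G))))
      where
      identity : ∀ o c d p q → o * (c * p + d * q) ≡ c * (o * p) + d * (o * q)
      identity = solve-∀ ring

    E-* : ∀ m L c (F : Fun n) → E m L (λ x → c * F x) ≡ c * E m L F
    E-* m L c F = trans (E-cong m L (λ x → expand c (F x)))
      (trans (E-linear m L c 0ℚ F F) (sym (expand c (E m L F))))
      where
      expand : ∀ c p → c * p ≡ c * p + 0ℚ * p
      expand = solve-∀ ring

    E-+ : ∀ m L (F G : Fun n) → E m L (λ x → F x + G x) ≡ E m L F + E m L G
    E-+ m L F G = trans (E-cong m L (λ x → expand (F x) (G x)))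
      (trans (E-linear m L 1ℚ 1ℚ F G) (sym (expand (E m L F) (E m L G))))
      where
      expand : ∀ p q → p + q ≡ 1ℚ * p + 1ℚ * q
      expand = solve-∀ ring

    0≤A : ∀ i j {F : Fun n} → (∀ x → 0ℚ ≤ F x) → ∀ x → 0ℚ ≤ A i j F x
    0≤A i j {F} F≥0 x = subst (0ℚ ≤_)
      (cong (λ z → ½ * (F (shift ⊹ i (shift ⊖ j x)) + z)) (sym (*-identityˡ (F (shift ⊖ i (shift ⊹ j x))))))
      (0≤½ ⊗ (F≥0 _ ⊕ F≥0 _))

    0≤E : ∀ m L {F : Fun n} → (∀ x → 0ℚ ≤ F x) → 0ℚ ≤ E m L F
    0≤E zero    L       F≥0 = F≥0 _
    0≤E (suc m) []      F≥0 = ≤-refl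
    0≤E (suc m) (i ∷ L) F≥0 = 0≤odd⁻¹ m ⊗ 0≤∑ L (λ k M _ → 0≤E m M (0≤A i k F≥0))

    0≤Esq : ∀ m L (f : Fun n) → 0ℚ ≤ E m L (λ x → sq (f x))
    0≤Esq m L f = 0≤E m L (λ x → 0≤sq (f x))

    -- If i and j are matched with each other, `A-sym` suffices. Otherwise each takes its own
    -- partner from `L`, and the two partners can be chosen in either order.
    E-swap : ∀ m i j L (F : Fun n) → length L ≡ double m →
             E (suc m) (i ∷ j ∷ L) F ≡ E (suc m) (j ∷ i ∷ L) F
    E-swap zero    i j [] F len = cong (λ s → odd⁻¹ 0 * (s + 0ℚ)) (A-sym i j F _)
    E-swap (suc m) i j L  F len = cong (odd⁻¹ (suc m) *_) (cong₂ _+_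
      (E-cong (suc m) L (A-sym i j F)) (begin
      ∑ L (λ k M → odd⁻¹ m * ∑ M (λ l N → E m N (A j l (A i k F))))
        ≡⟨ ∑-* L (odd⁻¹ m) (λ k M → ∑ M (λ l N → E m N (A j l (A i k F)))) ⟩
      odd⁻¹ m * ∑∑ L (λ k l N → E m N (A j l (A i k F)))
        ≡⟨ cong (odd⁻¹ m *_) (∑-swap L (λ k l N → E m N (A j l (A i k F)))) ⟩
      odd⁻¹ m * ∑∑ L (λ k l N → E m N (A j k (A i l F)))
        ≡⟨ cong (odd⁻¹ m *_) (∑∑-cong L (λ k l N _ → E-cong m N (D-comm 1ℚ 1ℚ j k i l F))) ⟩
      odd⁻¹ m * ∑∑ L (λ k l N → E m N (A i l (A j k F)))
        ≡⟨ ∑-* L (odd⁻¹ m) (λ k M → ∑ M (λ l N → E m N (A i l (A j k F)))) ⟨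
      ∑ L (λ k M → odd⁻¹ m * ∑ M (λ l N → E m N (A i l (A j k F)))) ∎))
      where open ≡-Reasoning

    E-↭ : ∀ m {L L′} F → length L ≡ double m → L ↭ L′ → E m L F ≡ E m L′ F
    E-↭ zero    F len p = refl
    E-↭ (suc m) F len ↭-reflexivity = refl
    E-↭ (suc m) F len (↭-prep i p) = cong (odd⁻¹ m *_) (∑-↭
      (λ k M M′ eq → E-↭ m (A i k F) (ℕₚ.suc-injective (trans eq (ℕₚ.suc-injective len)))) p)
    E-↭ (suc m) F len (↭-swap {L} {L′} i j p) = trans (E-swap m i j L F len′)
      (cong (odd⁻¹ m *_) (cong₂ _+_ (E-↭ m _ len′ p) (∑-↭ (λ k M M′ eq q →
        E-↭ m (A j k F) (trans eq len′) (↭-prep i q)) p)))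
      where len′ = ℕₚ.suc-injective (ℕₚ.suc-injective len)
    E-↭ (suc m) F len (↭-transitivity p q) = trans (E-↭ (suc m) F len p)
      (E-↭ (suc m) F (trans (sym (↭-length p)) len) q)

    E-row : ∀ m {L i M} F → length L ≡ double (suc m) → L ↭ i ∷ M →
            odd m * E (suc m) L F ≡ ∑ M (λ j N → E m N (A i j F))
    E-row m F len p = trans (cong (odd m *_) (E-↭ (suc m) F len p)) (odd-cancel m _)

    E-pairs : ∀ m {L} F → length L ≡ double (suc m) →
              ∑∑ L (λ i j N → E m N (A i j F)) ≡ # (double (suc m)) * (odd m * E (suc m) L F)
    E-pairs m {L} F len = trans (∑-cong L (λ i M p → sym (E-row m F len p)))
      (trans (∑-const L _) (cong (λ l → # l * (odd m * E (suc m) L F)) len))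

    Γ-row : ∀ m i M G → odd m * Γ (suc m) i M G ≡ ∑ M (λ j N → E m N (B i j G))
    Γ-row m i M G = odd-cancel m _

    Γ-↭ : ∀ m i {M M′} G → length M ≡ suc (double m) → M ↭ M′ →
          Γ (suc m) i M G ≡ Γ (suc m) i M′ G
    Γ-↭ m i G len p = cong (odd⁻¹ m *_) (∑-↭
      (λ k N N′ eq → E-↭ m (B i k G) (ℕₚ.suc-injective (trans eq len))) p)

    Γ-cong : ∀ m i M {F G : Fun n} → F ≗ G → Γ m i M F ≡ Γ m i M G
    Γ-cong zero    i M F≗G = refl
    Γ-cong (suc m) i M F≗G = cong (odd⁻¹ m *_)
      (∑-cong M (λ k N _ → E-cong m N (D-cong (- 1ℚ) i k F≗G)))

    Γ-* : ∀ m i M c G → Γ m i M (λ x → c * G x) ≡ c * Γ m i M G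
    Γ-* zero    i M c G = sym (*-zeroʳ c)
    Γ-* (suc m) i M c G = trans
      (cong (odd⁻¹ m *_) (trans
        (∑-cong M (λ k N _ → trans (E-cong m N (B-* k)) (E-* m N c (B i k G))))
        (∑-* M c (λ k N → E m N (B i k G)))))
      (exchange (odd⁻¹ m) c _)
      where
      exchange : ∀ o c s → o * (c * s) ≡ c * (o * s)
      exchange = solve-∀ ring
      scale : ∀ c p q → ½ * (c * p + - 1ℚ * (c * q)) ≡ c * (½ * (p + - 1ℚ * q))
      scale = solve-∀ ring
      B-* : ∀ k → B i k (λ x → c * G x) ≗ (λ x → c * B i k G x)
      B-* k x = scale c (G (shift ⊹ i (shift ⊖ k x))) (G (shift ⊖ i (shift ⊹ k x)))

    E-cauchy-schwarz : ∀ m L (u v : Fun n) → sq (E m L (λ x → u x * v x)) ≤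
                       E m L (λ x → sq (u x)) * E m L (λ x → sq (v x))
    E-cauchy-schwarz m L u v = discriminant-≤ (λ s t → subst (0ℚ ≤_)
      (begin
        E m L (λ x → sq (s * u x + t * v x))
          ≡⟨ E-cong m L (λ x → expand s t (u x) (v x)) ⟩
        E m L (λ x → 1ℚ * (sq s * sq (u x) + # 2 * (s * t) * (u x * v x)) + sq t * sq (v x))
          ≡⟨ E-linear m L 1ℚ (sq t) _ (λ x → sq (v x)) ⟩
        1ℚ * E m L (λ x → sq s * sq (u x) + # 2 * (s * t) * (u x * v x)) + sq t * E m L (λ x → sq (v x))
          ≡⟨ cong (_+ sq t * E m L (λ x → sq (v x))) (trans (*-identityˡ _)
               (E-linear m L (sq s) (# 2 * (s * t)) (λ x → sq (u x)) (λ x → u x * v x))) ⟩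
        sq s * E m L (λ x → sq (u x)) + # 2 * (s * t) * E m L (λ x → u x * v x)
          + sq t * E m L (λ x → sq (v x)) ∎)
      (0≤E m L (λ x → 0≤sq (s * u x + t * v x))))
      where
      open ≡-Reasoning
      expand : ∀ s t a b → (s * a + t * b) * (s * a + t * b)
        ≡ 1ℚ * (s * s * (a * a) + # 2 * (s * t) * (a * b)) + t * t * (b * b)
      expand = solve-∀ ring

    -- The quadratic form E (s u + t xᵢ v)² is nonnegative.
    Γ-cauchy-schwarz : ∀ m i M (u v : Fun n) → sq (Γ m i M (λ x → u x * v x)) ≤
                       E m (i ∷ M) (λ x → sq (u x)) * E m (i ∷ M) (λ x → sq (v x))
    Γ-cauchy-schwarz zero    i M u v = 0≤Esq 0 (i ∷ M) u ⊗ 0≤Esq 0 (i ∷ M) v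
    Γ-cauchy-schwarz (suc m) i M u v = discriminant-≤ (λ s t → subst (0ℚ ≤_)
      (begin
        odd⁻¹ m * ∑ M (λ k N → E m N (λ x → ½ * (sq (up k s t x) + sq (down k s t x))))
          ≡⟨ cong (odd⁻¹ m *_) (∑-cong M (λ k N _ → split s t k N)) ⟩
        odd⁻¹ m * ∑ M (λ k N → 1ℚ * (sq s * α k N + # 2 * (s * t) * β k N) + sq t * γ k N)
          ≡⟨ cong (odd⁻¹ m *_) (∑-linear M 1ℚ (sq t) (λ k N → sq s * α k N + # 2 * (s * t) * β k N) γ) ⟩
        odd⁻¹ m * (1ℚ * ∑ M (λ k N → sq s * α k N + # 2 * (s * t) * β k N) + sq t * ∑ M γ)
          ≡⟨ cong (λ z → odd⁻¹ m * (1ℚ * z + sq t * ∑ M γ)) (∑-linear M (sq s) (# 2 * (s * t)) α β) ⟩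
        odd⁻¹ m * (1ℚ * (sq s * ∑ M α + # 2 * (s * t) * ∑ M β) + sq t * ∑ M γ)
          ≡⟨ distribute (odd⁻¹ m) s t (∑ M α) (∑ M β) (∑ M γ) ⟩
        sq s * (odd⁻¹ m * ∑ M α) + # 2 * (s * t) * (odd⁻¹ m * ∑ M β) + sq t * (odd⁻¹ m * ∑ M γ) ∎)
      (0≤odd⁻¹ m ⊗ 0≤∑ M (λ k N _ → 0≤E m N (λ x → 0≤½ ⊗ (0≤sq (up k s t x) ⊕ 0≤sq (down k s t x))))))
      where
      open ≡-Reasoning
      α β γ : Fin n → List (Fin n) → ℚ
      α k N = E m N (A i k (λ x → sq (u x)))
      β k N = E m N (B i k (λ x → u x * v x))
      γ k N = E m N (A i k (λ x → sq (v x)))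
      up down : Fin n → ℚ → ℚ → Fun n
      up k s t x = s * u (shift ⊹ i (shift ⊖ k x)) + t * v (shift ⊹ i (shift ⊖ k x))
      down k s t x = s * u (shift ⊖ i (shift ⊹ k x)) - t * v (shift ⊖ i (shift ⊹ k x))
      expand : ∀ s t a b a′ b′ →
        ½ * ((s * a + t * b) * (s * a + t * b) + (s * a′ - t * b′) * (s * a′ - t * b′)) ≡
        1ℚ * (s * s * (½ * (a * a + 1ℚ * (a′ * a′))) + # 2 * (s * t) * (½ * (a * b + - 1ℚ * (a′ * b′))))
          + t * t * (½ * (b * b + 1ℚ * (b′ * b′)))
      expand = solve-∀ ring
      split : ∀ s t k N → E m N (λ x → ½ * (sq (up k s t x) + sq (down k s t x))) ≡
              1ℚ * (sq s * α k N + # 2 * (s * t) * β k N) + sq t * γ k N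
      split s t k N = trans
        (E-cong m N (λ x → expand s t (u (shift ⊹ i (shift ⊖ k x))) (v (shift ⊹ i (shift ⊖ k x)))
                                      (u (shift ⊖ i (shift ⊹ k x))) (v (shift ⊖ i (shift ⊹ k x)))))
        (trans (E-linear m N 1ℚ (sq t)
                 (λ x → sq s * A i k (λ y → sq (u y)) x + # 2 * (s * t) * B i k (λ y → u y * v y) x)
                 (A i k (λ y → sq (v y))))
               (cong (λ z → 1ℚ * z + sq t * γ k N)
                 (E-linear m N (sq s) (# 2 * (s * t)) (A i k (λ y → sq (u y))) (B i k (λ y → u y * v y)))))
      distribute : ∀ o s t a b c →
        o * (1ℚ * (s * s * a + # 2 * (s * t) * b) + t * t * c) ≡
        s * s * (o * a) + # 2 * (s * t) * (o * b) + t * t * (o * c)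
      distribute = solve-∀ ring

  ≤-cancel-factor : ∀ {c x y} → 0ℚ < c → c * x ≤ c * y → x ≤ y
  ≤-cancel-factor {c} 0<c = *-cancelˡ-≤-pos c {{positive 0<c}}

  0<#suc : ∀ n → 0ℚ < # (suc n)
  0<#suc n = positive⁻¹ (# (suc n)) {{normalize-pos (suc n) 1}}

  -- The two halves at a pair and relations between different pairs

  module _ {n : ℕ} where

    E² E⁴ : ℕ → List (Fin n) → Fun n → ℚ
    E² m L f = E m L (λ x → sq (f x))
    E⁴ m L f = E m L (λ x → sq (sq (f x)))

    A-sq : ∀ i j (f : Fun n) x → A i j (λ y → sq (f y)) x ≡ sq (A i j f x) + sq (B i j f x)
    A-sq i j f x = identity (f (shift ⊹ i (shift ⊖ j x))) (f (shift ⊖ i (shift ⊹ j x)))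
      where
      identity : ∀ p q → ½ * (p * p + 1ℚ * (q * q)) ≡
        (½ * (p + 1ℚ * q)) * (½ * (p + 1ℚ * q)) + (½ * (p + - 1ℚ * q)) * (½ * (p + - 1ℚ * q))
      identity = solve-∀ ring

    B-sq : ∀ i j (f : Fun n) x → B i j (λ y → sq (f y)) x ≡ # 2 * (A i j f x * B i j f x)
    B-sq i j f x = identity (f (shift ⊹ i (shift ⊖ j x))) (f (shift ⊖ i (shift ⊹ j x)))
      where
      identity : ∀ p q → ½ * (p * p + - 1ℚ * (q * q)) ≡
        # 2 * ((½ * (p + 1ℚ * q)) * (½ * (p + - 1ℚ * q)))
      identity = solve-∀ ring

    B-* : ∀ i j (f g : Fun n) x → B i j (λ y → f y * g y) x ≡
          A i j f x * B i j g x + B i j f x * A i j g x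
    B-* i j f g x = identity (f (shift ⊹ i (shift ⊖ j x))) (f (shift ⊖ i (shift ⊹ j x)))
                             (g (shift ⊹ i (shift ⊖ j x))) (g (shift ⊖ i (shift ⊹ j x)))
      where
      identity : ∀ p q r s → ½ * (p * r + - 1ℚ * (q * s)) ≡
        (½ * (p + 1ℚ * q)) * (½ * (r + - 1ℚ * s)) + (½ * (p + - 1ℚ * q)) * (½ * (r + 1ℚ * s))
      identity = solve-∀ ring

    A-pow4 : ∀ i j (f : Fun n) x → A i j (λ y → sq (sq (f y))) x ≡
             sq (sq (A i j f x)) + # 6 * (sq (A i j f x) * sq (B i j f x)) + sq (sq (B i j f x))
    A-pow4 i j f x = identity (f (shift ⊹ i (shift ⊖ j x))) (f (shift ⊖ i (shift ⊹ j x)))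
      where
      identity′ : ∀ a b →
        ½ * (((a + b) * (a + b)) * ((a + b) * (a + b)) +
             1ℚ * (((a - b) * (a - b)) * ((a - b) * (a - b)))) ≡
        (a * a) * (a * a) + # 6 * ((a * a) * (b * b)) + (b * b) * (b * b)
      identity′ = solve-∀ ring
      sum-half : ∀ p q → ½ * (p + 1ℚ * q) + ½ * (p + - 1ℚ * q) ≡ p
      sum-half = solve-∀ ring
      difference-half : ∀ p q → ½ * (p + 1ℚ * q) - ½ * (p + - 1ℚ * q) ≡ q
      difference-half = solve-∀ ring
      identity : ∀ p q → let a = ½ * (p + 1ℚ * q); b = ½ * (p + - 1ℚ * q) in
        ½ * (sq (sq p) + 1ℚ * sq (sq q)) ≡ sq (sq a) + # 6 * (sq a * sq b) + sq (sq b)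
      identity p q = trans
        (cong₂ (λ p q → ½ * (sq (sq p) + 1ℚ * sq (sq q)))
          (sym (sum-half p q)) (sym (difference-half p q)))
        (identity′ (½ * (p + 1ℚ * q)) (½ * (p + - 1ℚ * q)))

    E-A-sq : ∀ m L i j f → E m L (A i j (λ x → sq (f x))) ≡ E² m L (A i j f) + E² m L (B i j f)
    E-A-sq m L i j f = trans (E-cong m L (A-sq i j f))
      (E-+ m L (λ x → sq (A i j f x)) (λ x → sq (B i j f x)))

    E-cocycle : ∀ m i j k M G →
      E (suc m) (k ∷ M) (B i j G) + E (suc m) (i ∷ M) (B j k G) + E (suc m) (j ∷ M) (B k i G) ≡ 0ℚ
    E-cocycle m i j k M G = begin
      odd⁻¹ m * ∑ M φ + odd⁻¹ m * ∑ M χ + odd⁻¹ m * ∑ M ψ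
        ≡⟨ factor (odd⁻¹ m) (∑ M φ) (∑ M χ) (∑ M ψ) ⟩
      odd⁻¹ m * (∑ M φ + ∑ M χ + ∑ M ψ)
        ≡⟨ cong (odd⁻¹ m *_) (trans (cong (_+ ∑ M ψ) (sym (∑-+ M φ χ)))
             (sym (∑-+ M (λ l N → φ l N + χ l N) ψ))) ⟩
      odd⁻¹ m * ∑ M (λ l N → φ l N + χ l N + ψ l N)
        ≡⟨ cong (odd⁻¹ m *_) (trans (∑-cong M (λ l N _ → vanish l N)) (∑-0 M)) ⟩
      odd⁻¹ m * 0ℚ
        ≡⟨ *-zeroʳ (odd⁻¹ m) ⟩
      0ℚ ∎
      where
      open ≡-Reasoning
      φ χ ψ : Fin n → List (Fin n) → ℚ
      φ l N = E m N (A k l (B i j G))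
      χ l N = E m N (A i l (B j k G))
      ψ l N = E m N (A j l (B k i G))
      factor : ∀ o a b c → o * a + o * b + o * c ≡ o * (a + b + c)
      factor = solve-∀ ring
      vanish : ∀ l N → φ l N + χ l N + ψ l N ≡ 0ℚ
      vanish l N = begin
        φ l N + χ l N + ψ l N
          ≡⟨ cong (_+ ψ l N) (sym (E-+ m N (A k l (B i j G)) (A i l (B j k G)))) ⟩
        E m N (λ x → A k l (B i j G) x + A i l (B j k G) x) + ψ l N
          ≡⟨ sym (E-+ m N (λ x → A k l (B i j G) x + A i l (B j k G) x) (A j l (B k i G))) ⟩
        E m N (λ x → A k l (B i j G) x + A i l (B j k G) x + A j l (B k i G) x)
          ≡⟨ E-cong m N (λ x → trans (Pattern.B-cocycle G i j k l x) (sym (*-zeroˡ 0ℚ))) ⟩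
        E m N (λ x → 0ℚ * 0ℚ)
          ≡⟨ trans (E-* m N 0ℚ (λ _ → 0ℚ)) (*-zeroˡ (E m N (λ _ → 0ℚ))) ⟩
        0ℚ ∎

    -- This turns a difference of two conditional means into one correlation with xᵢ, and is the way
    -- in which the variance over pairs becomes a sum of squared correlations.
    Γ-B : ∀ m i j k M F → Γ (suc m) i M (B j k F) ≡
          E (suc m) (j ∷ M) (A i k F) - E (suc m) (k ∷ M) (A i j F)
    Γ-B m i j k M F = begin
      odd⁻¹ m * ∑ M (λ l N → E m N (B i l (B j k F)))
        ≡⟨ cong (odd⁻¹ m *_) (∑-cong M (λ l N _ → trans
             (E-cong m N (λ x → trans (Pattern.B-B F i j k l x) (expand (A j l (A i k F) x) _)))
             (E-linear m N 1ℚ (- 1ℚ) (A j l (A i k F)) (A k l (A i j F))))) ⟩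
      odd⁻¹ m * ∑ M (λ l N → 1ℚ * φ l N + - 1ℚ * ψ l N)
        ≡⟨ cong (odd⁻¹ m *_) (∑-linear M 1ℚ (- 1ℚ) φ ψ) ⟩
      odd⁻¹ m * (1ℚ * ∑ M φ + - 1ℚ * ∑ M ψ)
        ≡⟨ distribute (odd⁻¹ m) (∑ M φ) (∑ M ψ) ⟩
      odd⁻¹ m * ∑ M φ - odd⁻¹ m * ∑ M ψ ∎
      where
      open ≡-Reasoning
      φ ψ : Fin n → List (Fin n) → ℚ
      φ l N = E m N (A j l (A i k F))
      ψ l N = E m N (A k l (A i j F))
      expand : ∀ p q → p - q ≡ 1ℚ * p + - 1ℚ * q
      expand = solve-∀ ring
      distribute : ∀ o p q → o * (1ℚ * p + - 1ℚ * q) ≡ o * p - o * q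
      distribute = solve-∀ ring

    E-A-subadditive : ∀ m i j k M {F} → (∀ x → 0ℚ ≤ F x) → E (suc m) (k ∷ M) (A i j F) ≤
                      E (suc m) (j ∷ M) (A i k F) + E (suc m) (i ∷ M) (A j k F)
    E-A-subadditive m i j k M {F} F≥0 = ≤-by-gap
      (0≤odd⁻¹ m ⊗ 0≤∑ M (λ l N _ → 0≤E m N (λ x → Pattern.0≤A+A-A F i j k l x F≥0)))
      (sym (begin
        odd⁻¹ m * ∑ M (λ l N → E m N (λ x → A j l (A i k F) x + A i l (A j k F) x - A k l (A i j F) x))
          ≡⟨ cong (odd⁻¹ m *_) (∑-cong M (λ l N _ → split l N)) ⟩
        odd⁻¹ m * ∑ M (λ l N → 1ℚ * (φ l N + χ l N) + - 1ℚ * ψ l N)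
          ≡⟨ cong (odd⁻¹ m *_) (∑-linear M 1ℚ (- 1ℚ) (λ l N → φ l N + χ l N) ψ) ⟩
        odd⁻¹ m * (1ℚ * ∑ M (λ l N → φ l N + χ l N) + - 1ℚ * ∑ M ψ)
          ≡⟨ cong (λ z → odd⁻¹ m * (1ℚ * z + - 1ℚ * ∑ M ψ)) (∑-+ M φ χ) ⟩
        odd⁻¹ m * (1ℚ * (∑ M φ + ∑ M χ) + - 1ℚ * ∑ M ψ)
          ≡⟨ distribute (odd⁻¹ m) (∑ M φ) (∑ M χ) (∑ M ψ) ⟩
        odd⁻¹ m * ∑ M φ + odd⁻¹ m * ∑ M χ - odd⁻¹ m * ∑ M ψ ∎))
      where
      open ≡-Reasoning
      φ χ ψ : Fin n → List (Fin n) → ℚ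
      φ l N = E m N (A j l (A i k F))
      χ l N = E m N (A i l (A j k F))
      ψ l N = E m N (A k l (A i j F))
      expand : ∀ p q r → p + q - r ≡ 1ℚ * (p + q) + - 1ℚ * r
      expand = solve-∀ ring
      distribute : ∀ o p q r → o * (1ℚ * (p + q) + - 1ℚ * r) ≡ o * p + o * q - o * r
      distribute = solve-∀ ring
      split : ∀ l N → E m N (λ x → A j l (A i k F) x + A i l (A j k F) x - A k l (A i j F) x)
                    ≡ 1ℚ * (φ l N + χ l N) + - 1ℚ * ψ l N
      split l N = trans
        (E-cong m N (λ x → expand (A j l (A i k F) x) (A i l (A j k F) x) (A k l (A i j F) x)))
        (trans (E-linear m N 1ℚ (- 1ℚ) (λ x → A j l (A i k F) x + A i l (A j k F) x) (A k l (A i j F)))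
          (cong (λ z → 1ℚ * z + - 1ℚ * ψ l N) (E-+ m N (A j l (A i k F)) (A i l (A j k F)))))

    -- Conditioning on xᵢ ≠ xⱼ multiplies a mean of a nonnegative function by at
    -- most the reciprocal 2 (2m+1) / (2m+2) of the probability of that event.
    E-A-≤ : ∀ m i j N {F} → length N ≡ double m → (∀ x → 0ℚ ≤ F x) →
            # (double (suc m)) * E m N (A i j F) ≤ # 2 * (odd m * E (suc m) (i ∷ j ∷ N) F)
    E-A-≤ m i j N {F} len F≥0 = ≤-by-gap (0≤-gap (bound m N len)) (begin
      # 2 * (odd m * E (suc m) (i ∷ j ∷ N) F) - # (double (suc m)) * w
        ≡⟨ cong₂ _-_ (double-sum (odd m * E (suc m) (i ∷ j ∷ N) F))
             (cong (_* w) (trans (#-double-suc m) (cong (1ℚ +_) (trans (#-suc (double m)) (cong (λ l → 1ℚ + # l) (sym len)))))) ⟩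
      odd m * E (suc m) (i ∷ j ∷ N) F + odd m * E (suc m) (i ∷ j ∷ N) F - (1ℚ + (1ℚ + # (length N))) * w
        ≡⟨ cong (_- (1ℚ + (1ℚ + # (length N))) * w) (cong₂ _+_ (odd-cancel m _)
             (trans (cong (odd m *_) (E-swap m i j N F len)) (trans (odd-cancel m _)
               (cong (_+ ∑ N ψ) (E-cong m N (A-sym j i F)))))) ⟩
      w + ∑ N φ + (w + ∑ N ψ) - (1ℚ + (1ℚ + # (length N))) * w
        ≡⟨ regroup w (∑ N φ) (∑ N ψ) (# (length N)) ⟩
      ∑ N φ + ∑ N ψ - # (length N) * w ∎)
      where
      open ≡-Reasoning
      w = E m N (A i j F)
      φ ψ : Fin n → List (Fin n) → ℚ
      φ k O = E m (j ∷ O) (A i k F)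
      ψ k O = E m (i ∷ O) (A j k F)
      double-sum : ∀ e → # 2 * e ≡ e + e
      double-sum = solve-∀ ring
      regroup : ∀ w p q l → w + p + (w + q) - (1ℚ + (1ℚ + l)) * w ≡ p + q - l * w
      regroup = solve-∀ ring
      -- The triangle-type inequality is summed over the third coordinate k. The rows of i and of j
      -- in the mean of `F` contain exactly the terms on its right side, besides `w` once each.
      bound : ∀ m N → length N ≡ double m →
        # (length N) * E m N (A i j F) ≤
        ∑ N (λ k O → E m (j ∷ O) (A i k F)) + ∑ N (λ k O → E m (i ∷ O) (A j k F))
      bound zero    [] len = ≤-reflexive (*-zeroˡ (E 0 [] (A i j F)))
      bound (suc m) N  len = subst₂ _≤_
        (∑-const N _)
        (∑-+ N (λ k O → E (suc m) (j ∷ O) (A i k F)) (λ k O → E (suc m) (i ∷ O) (A j k F)))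
        (∑-mono N (λ k O p → subst (_≤ _) (sym (E-↭ (suc m) (A i j F) len p))
          (E-A-subadditive m i j k O F≥0)))

  -- Energy and degree bounds

  module _ {I : Set} where

    -- Lagrange's identity. Inside a double choice the list left over by j appears as `k ∷ O`, a
    -- permutation of what j alone leaves over, so `w` has to be insensitive to the order.
    ∑-variance : ∀ (M : List I) (w : I → List I → ℚ) →
      (∀ k N N′ → suc (length N) ≡ length M → N ↭ N′ → w k N ≡ w k N′) →
      ∑∑ M (λ j k O → sq (w j (k ∷ O) - w k (j ∷ O))) ≡
      # 2 * (# (length M) * ∑ M (λ j N → sq (w j N)) - sq (∑ M w))
    ∑-variance M w w-↭ = begin
      ∑∑ M (λ j k O → sq (w j (k ∷ O) - w k (j ∷ O)))
        ≡⟨ ∑∑-cong M (λ j k O _ → expand (w j (k ∷ O)) (w k (j ∷ O))) ⟩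
      ∑∑ M (λ j k O → u j k O + u k j O)
        ≡⟨ ∑∑-+ M u (λ j k O → u k j O) ⟩
      ∑∑ M u + ∑∑ M (λ j k O → u k j O)
        ≡⟨ cong (∑∑ M u +_) (∑-swap M (λ j k O → u k j O)) ⟩
      ∑∑ M u + ∑∑ M u
        ≡⟨ cong (λ z → z + z) (trans (∑-cong M row)
             (∑-linear M (# (length M)) (- ∑ M w) (λ j N → sq (w j N)) w)) ⟩
      (# (length M) * ∑ M (λ j N → sq (w j N)) + - ∑ M w * ∑ M w) +
      (# (length M) * ∑ M (λ j N → sq (w j N)) + - ∑ M w * ∑ M w)
        ≡⟨ collect (# (length M)) (∑ M (λ j N → sq (w j N))) (∑ M w) ⟩
      # 2 * (# (length M) * ∑ M (λ j N → sq (w j N)) - sq (∑ M w)) ∎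
      where
      open ≡-Reasoning
      u : I → I → List I → ℚ
      u j k O = w j (k ∷ O) * (w j (k ∷ O) - w k (j ∷ O))
      expand : ∀ a b → (a - b) * (a - b) ≡ a * (a - b) + b * (b - a)
      expand = solve-∀ ring
      collect : ∀ l q s → (l * q + - s * s) + (l * q + - s * s) ≡ # 2 * (l * q - s * s)
      collect = solve-∀ ring
      rearrange : ∀ a l r → a * (l * a + - 1ℚ * r) ≡ (1ℚ + l) * (a * a) + - (a + r) * a
      rearrange = solve-∀ ring
      minus : ∀ a b → a - b ≡ 1ℚ * a + - 1ℚ * b
      minus = solve-∀ ring
      row : ∀ j N → M ↭ j ∷ N → ∑ N (u j) ≡ # (length M) * sq (w j N) + - ∑ M w * w j N
      row j N p = begin
        ∑ N (u j)
          ≡⟨ ∑-cong N (λ k O q → trans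
               (cong (λ z → z * (z - w k (j ∷ O))) (sym (w-↭ j N (k ∷ O) (sym (↭-length p)) q)))
               (cong (w j N *_) (minus (w j N) (w k (j ∷ O))))) ⟩
        ∑ N (λ k O → w j N * (1ℚ * w j N + - 1ℚ * w k (j ∷ O)))
          ≡⟨ trans (∑-* N (w j N) (λ k O → 1ℚ * w j N + - 1ℚ * w k (j ∷ O)))
               (cong (w j N *_) (∑-linear N 1ℚ (- 1ℚ) (λ _ _ → w j N) (λ k O → w k (j ∷ O)))) ⟩
        w j N * (1ℚ * ∑ N (λ _ _ → w j N) + - 1ℚ * ∑ N (λ k O → w k (j ∷ O)))
          ≡⟨ cong (λ z → w j N * (z + - 1ℚ * ∑ N (λ k O → w k (j ∷ O))))
               (trans (*-identityˡ _) (∑-const N (w j N))) ⟩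
        w j N * (# (length N) * w j N + - 1ℚ * ∑ N (λ k O → w k (j ∷ O)))
          ≡⟨ rearrange (w j N) (# (length N)) (∑ N (λ k O → w k (j ∷ O))) ⟩
        (1ℚ + # (length N)) * sq (w j N) + - (w j N + ∑ N (λ k O → w k (j ∷ O))) * w j N
          ≡⟨ cong₂ (λ l s → l * sq (w j N) + - s * w j N)
               (trans (sym (#-suc (length N))) (cong #_ (sym (↭-length p))))
               (sym (∑-↭ w-↭ p)) ⟩
        # (length M) * sq (w j N) + - ∑ M w * w j N ∎

    length-tail : ∀ {L M : List I} {i k} → length L ≡ suc k → L ↭ i ∷ M → length M ≡ k
    length-tail len p = ℕₚ.suc-injective (trans (sym (↭-length p)) len)

    length-tail₂ : ∀ {L M : List I} {i j k} → length L ≡ suc (suc k) → L ↭ i ∷ j ∷ M → length M ≡ k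
    length-tail₂ len p = ℕₚ.suc-injective (length-tail len p)

  module _ {n : ℕ} where

    -- For fixed i the means `E m N (A i j F)` average over j to the mean of `F`. Their variance is
    -- a sum of squared differences over j and k, and by `Γ-B` each difference is, up to sign, the
    -- correlation of `B j k F` with xᵢ.
    pair-variance : ∀ m {L} (F : Fun n) → length L ≡ double (suc m) →
      # 2 * (odd m * ∑∑ L (λ i j N → sq (E m N (A i j F)))) ≡
      # 2 * (odd m * (# (double (suc m)) * (odd m * sq (E (suc m) L F)))) +
      ∑∑ L (λ j k N → ∑ N (λ i O → sq (Γ m i O (B j k F))))
    pair-variance m {L} F len = begin
      # 2 * (odd m * ∑ L (λ i M → ∑ M (λ j N → sq (W i j N))))
        ≡⟨ scale-in ⟩
      ∑ L (λ i M → # 2 * odd m * ∑ M (λ j N → sq (W i j N)))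
        ≡⟨ ∑-cong L row ⟩
      ∑ L (λ i M → # 2 * sq (odd m * e) + ∑∑ M (λ j k O → sq (Γ m i O (B j k F))))
        ≡⟨ ∑-+ L (λ _ _ → # 2 * sq (odd m * e)) (λ i M → ∑∑ M (λ j k O → sq (Γ m i O (B j k F)))) ⟩
      ∑ L (λ _ _ → # 2 * sq (odd m * e)) + ∑ L (λ i M → ∑∑ M (λ j k O → sq (Γ m i O (B j k F))))
        ≡⟨ cong₂ _+_ (trans (∑-const L _) (trans (cong (λ l → # l * (# 2 * sq (odd m * e))) len)
             (regroup (# (double (suc m))) (odd m) e)))
             (∑∑∑-rotate L (λ i j k O → sq (Γ m i O (B j k F)))) ⟩
      # 2 * (odd m * (# (double (suc m)) * (odd m * sq e))) +
        ∑∑ L (λ j k N → ∑ N (λ i O → sq (Γ m i O (B j k F)))) ∎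
      where
      open ≡-Reasoning
      e = E (suc m) L F
      W : Fin n → Fin n → List (Fin n) → ℚ
      W i j N = E m N (A i j F)
      scale-in = trans (sym (*-assoc (# 2) (odd m) _))
        (sym (∑-* L (# 2 * odd m) (λ i M → ∑ M (λ j N → sq (W i j N)))))
      regroup : ∀ l o e → l * (# 2 * ((o * e) * (o * e))) ≡ # 2 * (o * (l * (o * (e * e))))
      regroup = solve-∀ ring
      solve-for : ∀ o q s v → v ≡ # 2 * (o * q - s * s) → # 2 * o * q ≡ # 2 * (s * s) + v
      solve-for o q s v refl = identity o q s
        where
        identity : ∀ o q s → # 2 * o * q ≡ # 2 * (s * s) + # 2 * (o * q - s * s)
        identity = solve-∀ ring
      difference : ∀ m i j k O M → length M ≡ suc (double m) → M ↭ j ∷ k ∷ O →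
        sq (E m (k ∷ O) (A i j F) - E m (j ∷ O) (A i k F)) ≡ sq (Γ m i O (B j k F))
      difference zero    i j k O M len p with () ← trans (sym (↭-length p)) len
      difference (suc m) i j k O M len p = trans (flip-sq (E (suc m) (k ∷ O) (A i j F)) (E (suc m) (j ∷ O) (A i k F))) (cong sq (sym (Γ-B m i j k O F)))
        where
        flip-sq : ∀ a b → (a - b) * (a - b) ≡ (b - a) * (b - a)
        flip-sq = solve-∀ ring
      row : ∀ i M → L ↭ i ∷ M → # 2 * odd m * ∑ M (λ j N → sq (W i j N)) ≡
            # 2 * sq (odd m * e) + ∑∑ M (λ j k O → sq (Γ m i O (B j k F)))
      row i M p = trans
        (solve-for (odd m) (∑ M (λ j N → sq (W i j N))) (∑ M (W i)) _
          (trans (∑-variance M (W i) (λ j N N′ l → E-↭ m (A i j F) (ℕₚ.suc-injective (trans l lenM))))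
            (cong (λ l → # 2 * (# l * ∑ M (λ j N → sq (W i j N)) - sq (∑ M (W i)))) lenM)))
        (cong₂ (λ s v → # 2 * sq s + v)
          (sym (E-row m F len p))
          (∑∑-cong M (λ j k O q → difference m i j k O M lenM q)))
        where
        lenM = length-tail len p

    -- The sum in the hypothesis collects the squared correlations of
    -- A j k f * B j k f with the coordinates; ℓ = 1 is Cauchy-Schwarz.
    pair-energy : ∀ m {L} (f : Fun n) ℓ → length L ≡ double (suc m) → 0ℚ ≤ ℓ →
      (∀ j k N → L ↭ j ∷ k ∷ N →
        ∑ N (λ i O → sq (Γ m i O (λ x → A j k f x * B j k f x))) ≤
        # (double m) * (ℓ * (E² m N (A j k f) * E² m N (B j k f)))) →
      ∑∑ L (λ j k N → sq (E² m N (A j k f) + E² m N (B j k f)) -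
                      # 2 * ℓ * (E² m N (A j k f) * E² m N (B j k f))) ≤
      # (double (suc m)) * (odd m * sq (E² (suc m) L f))
    pair-energy m {L} f ℓ len 0≤ℓ level = ≤-cancel-factor (0<#suc 1)
      (≤-cancel-factor (0<#suc (double m)) (≤-by-gap
        -- The second summand accounts for the gap between `double m`, the number of coordinates
        -- outside a pair, and the factor `odd m` in the variance identity.
        (0≤-gap correlations ⊕ 0≤# 4 ⊗ (0≤ℓ ⊗ 0≤αβ))
        (trans (cong (λ s → odd m * (# 2 * (# (double (suc m)) * (odd m * sq e))) - odd m * (# 2 * s)) split)
          (gap (odd m) (# (double m)) (∑∑ L (λ j k N → sq (E m N (A j k F)))) (∑∑ L αβ) ℓ
               (# (double (suc m)) * (odd m * sq e)) R (#-suc (double m)) (pair-variance m {L} F len)))))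
      where
      F : Fun n
      F x = sq (f x)
      e = E² (suc m) L f
      αβ : Fin n → Fin n → List (Fin n) → ℚ
      αβ j k N = E² m N (A j k f) * E² m N (B j k f)
      0≤αβ = 0≤∑∑ L (λ j k N _ → 0≤Esq m N (A j k f) ⊗ 0≤Esq m N (B j k f))
      R = ∑∑ L (λ j k N → ∑ N (λ i O → sq (Γ m i O (B j k F))))
      minus : ∀ a c b → a - c * b ≡ 1ℚ * a + - c * b
      minus = solve-∀ ring
      split : ∑∑ L (λ j k N → sq (E² m N (A j k f) + E² m N (B j k f)) - # 2 * ℓ * αβ j k N) ≡
              1ℚ * ∑∑ L (λ j k N → sq (E m N (A j k F))) + - (# 2 * ℓ) * ∑∑ L αβ
      split = trans
        (∑∑-cong L (λ j k N _ → trans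
          (cong (λ z → sq z - # 2 * ℓ * αβ j k N) (sym (E-A-sq m N j k f)))
          (minus (sq (E m N (A j k F))) (# 2 * ℓ) (αβ j k N))))
        (∑∑-linear L 1ℚ (- (# 2 * ℓ)) (λ j k N → sq (E m N (A j k F))) αβ)
      quadruple : ∀ g → (# 2 * g) * (# 2 * g) ≡ # 4 * (g * g)
      quadruple = solve-∀ ring
      correlations : R ≤ # 4 * (# (double m) * (ℓ * ∑∑ L αβ))
      correlations = subst₂ _≤_
        (sym (trans
          (∑∑-cong L (λ j k N _ → trans
            (∑-cong N (λ i O _ → trans
              (cong sq (trans (Γ-cong m i O (B-sq j k f)) (Γ-* m i O (# 2) (λ x → A j k f x * B j k f x))))
              (quadruple (Γ m i O (λ x → A j k f x * B j k f x)))))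
            (∑-* N (# 4) (λ i O → sq (Γ m i O (λ x → A j k f x * B j k f x))))))
          (∑∑-* L (# 4) (λ j k N → ∑ N (λ i O → sq (Γ m i O (λ x → A j k f x * B j k f x)))))))
        (cong (# 4 *_) (trans
          (∑∑-* L (# (double m)) (λ j k N → ℓ * αβ j k N))
          (cong (# (double m) *_) (∑∑-* L ℓ αβ))))
        (*-monoˡ-≤-nonNeg (# 4) (∑∑-mono L level))
      gap : ∀ o d q p ℓ e r → o ≡ 1ℚ + d → # 2 * (o * q) ≡ # 2 * (o * e) + r →
        o * (# 2 * e) - o * (# 2 * (1ℚ * q + - (# 2 * ℓ) * p)) ≡
        # 4 * (d * (ℓ * p)) - r + # 4 * (ℓ * p)
      gap o d q p ℓ e r refl variance = begin
        o * (# 2 * e) - o * (# 2 * (1ℚ * q + - (# 2 * ℓ) * p))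
          ≡⟨ expand o q p ℓ e ⟩
        # 2 * (o * e) + # 4 * (o * (ℓ * p)) - # 2 * (o * q)
          ≡⟨ cong (λ z → # 2 * (o * e) + # 4 * (o * (ℓ * p)) - z) variance ⟩
        # 2 * (o * e) + # 4 * (o * (ℓ * p)) - (# 2 * (o * e) + r)
          ≡⟨ collect d p ℓ e r ⟩
        # 4 * (d * (ℓ * p)) - r + # 4 * (ℓ * p) ∎
        where
        open ≡-Reasoning
        expand : ∀ o q p ℓ e → o * (# 2 * e) - o * (# 2 * (1ℚ * q + - (# 2 * ℓ) * p))
                 ≡ # 2 * (o * e) + # 4 * (o * (ℓ * p)) - # 2 * (o * q)
        expand = solve-∀ ring
        collect : ∀ d p ℓ e r → # 2 * ((1ℚ + d) * e) + # 4 * ((1ℚ + d) * (ℓ * p)) - (# 2 * ((1ℚ + d) * e) + r)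
                  ≡ # 4 * (d * (ℓ * p)) - r + # 4 * (ℓ * p)
        collect = solve-∀ ring

    pair-energy-basic : ∀ m {L} (f : Fun n) → length L ≡ double (suc m) →
      ∑∑ L (λ j k N → sq (E² m N (A j k f)) + sq (E² m N (B j k f))) ≤
      # (double (suc m)) * (odd m * sq (E² (suc m) L f))
    pair-energy-basic m {L} f len = subst (_≤ # (double (suc m)) * (odd m * sq (E² (suc m) L f)))
      (∑∑-cong L (λ j k N _ → simplify (E² m N (A j k f)) (E² m N (B j k f))))
      (pair-energy m f 1ℚ len (0≤# 1) level)
      where
      simplify : ∀ a b → (a + b) * (a + b) - # 2 * 1ℚ * (a * b) ≡ a * a + b * b
      simplify = solve-∀ ring
      level : ∀ j k N → L ↭ j ∷ k ∷ N →
        ∑ N (λ i O → sq (Γ m i O (λ x → A j k f x * B j k f x))) ≤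
        # (double m) * (1ℚ * (E² m N (A j k f) * E² m N (B j k f)))
      level j k N p = ≤-trans
        (∑-mono N (λ i O q → subst (sq (Γ m i O (λ x → A j k f x * B j k f x)) ≤_)
          (trans (cong₂ _*_ (sym (E-↭ m _ lenN q)) (sym (E-↭ m _ lenN q))) (sym (*-identityˡ _)))
          (Γ-cauchy-schwarz m i O (A j k f) (B j k f))))
        (≤-reflexive (trans (∑-const N _)
          (cong (λ l → # l * (1ℚ * (E² m N (A j k f) * E² m N (B j k f)))) lenN)))
        where lenN = length-tail₂ len p

  -- Degree at most d as a function on every slice: d + 1 successive
  -- differences along disjoint or repeated pairs vanish.
  Deg : ∀ {n} → ℕ → Fun n → Set
  Deg zero    f = ∀ i j x → B i j f x ≡ 0ℚ
  Deg (suc d) f = ∀ i j → Deg d (B i j f)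

  Deg-cong : ∀ {n} d {f g : Fun n} → f ≗ g → Deg d f → Deg d g
  Deg-cong zero    f≗g deg i j x = trans (sym (D-cong (- 1ℚ) i j f≗g x)) (deg i j x)
  Deg-cong (suc d) f≗g deg i j = Deg-cong d (D-cong (- 1ℚ) i j f≗g) (deg i j)

  Deg-A : ∀ {n} d {f : Fun n} i j → Deg d f → Deg d (A i j f)
  Deg-A zero    {f} i j deg k l x = trans (D-comm 1ℚ (- 1ℚ) k l i j f x)
    (cong₂ (λ p q → ½ * (p + 1ℚ * q)) (deg k l _) (deg k l _))
  Deg-A (suc d) {f} i j deg k l =
    Deg-cong d (λ x → sym (D-comm 1ℚ (- 1ℚ) k l i j f x)) (Deg-A d i j (deg k l))

  module _ {n : ℕ} where

    E²-B-constant : ∀ m N i j (f : Fun n) → Deg 0 f → E² m N (B i j f) ≡ 0ℚ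
    E²-B-constant m N i j f deg = trans
      (E-cong m N (λ x → trans (cong sq (deg i j x)) (sym (*-zeroˡ 0ℚ))))
      (trans (E-* m N 0ℚ (λ _ → 0ℚ)) (*-zeroˡ (E m N (λ _ → 0ℚ))))

    pair-means : ∀ m {L} (f : Fun n) → length L ≡ double (suc m) →
      ∑∑ L (λ i j N → E² m N (A i j f)) + ∑∑ L (λ i j N → E² m N (B i j f)) ≡
      # (double (suc m)) * (odd m * E² (suc m) L f)
    pair-means m {L} f len = trans
      (sym (∑∑-+ L (λ i j N → E² m N (A i j f)) (λ i j N → E² m N (B i j f))))
      (trans (∑∑-cong L (λ i j N _ → sym (E-A-sq m N i j f))) (E-pairs m {L} (λ x → sq (f x)) len))

    -- Averaging over a second pair and commuting the operators reduces the claim to `A k l f` of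
    -- degree d + 1 and `B k l f` of degree d on a smaller slice. The degree gained on the second
    -- half compensates exactly for the two coordinates lost.
    dirichlet : ∀ m d {L} (f : Fun n) → Deg d f → length L ≡ double (suc m) →
      ∑∑ L (λ i j N → E² m N (B i j f)) ≤ # 2 * (# d * (odd m * E² (suc m) L f))
    dirichlet m zero {L} f deg len = ≤-reflexive (trans
      (∑-cong L (λ i M _ → trans (∑-cong M (λ j N _ → E²-B-constant m N i j f deg)) (∑-0 M)))
      (trans (∑-0 L) (sym (vanish (odd m * E² (suc m) L f)))))
      where
      vanish : ∀ e → # 2 * (# 0 * e) ≡ 0ℚ
      vanish = solve-∀ ring
    dirichlet zero (suc d) {L} f deg len = ≤-by-gap
      -- With two coordinates in all, the sum of β is bounded by that of α + β, which is twice the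
      -- second moment of f; degree 1 is already enough.
      (0≤∑∑ L (λ i j N _ → 0≤Esq 0 N (A i j f)) ⊕ 0≤# 2 ⊗ (0≤# d ⊗ (0≤# 1 ⊗ 0≤Esq 1 L f)))
      (gap (∑∑ L (λ i j N → E² 0 N (A i j f))) _ (# d) (odd 0 * E² 1 L f)
        (pair-means 0 {L} f len) (#-suc d))
      where
      gap : ∀ a b d e {d′} → a + b ≡ # 2 * e → d′ ≡ 1ℚ + d → # 2 * (d′ * e) - b ≡ a + # 2 * (d * e)
      gap a b d e means refl = trans (expand b d e) (trans
        (cong (λ z → z - b + # 2 * (d * e)) (sym means)) (collect a b (# 2 * (d * e))))
        where
        expand : ∀ b d e → # 2 * ((1ℚ + d) * e) - b ≡ # 2 * e - b + # 2 * (d * e)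
        expand = solve-∀ ring
        collect : ∀ a b s → a + b - b + s ≡ a + s
        collect = solve-∀ ring
    dirichlet (suc m) (suc d) {L} f deg len =
      ≤-cancel-factor (0<#suc (suc (double (suc m)))) (≤-cancel-factor (0<#suc (double m))
        (≤-by-gap (0≤-gap bound)
          (gap (∑∑ L α) (∑∑ L β) (# (double (suc m))) (# (double (suc (suc m)))) (odd m) (# d) (# (suc d))
            (odd (suc m) * E² (suc (suc m)) L f)
            (trans (#-double-suc (suc m)) (cong (1ℚ +_) (#-suc (double (suc m)))))
            (#-suc d) (pair-means (suc m) {L} f len))))
      where
      open ≡-Reasoning
      α β : Fin n → Fin n → List (Fin n) → ℚ
      α k l N = E² (suc m) N (A k l f)
      β k l N = E² (suc m) N (B k l f)
      second-pair : # (double (suc m)) * (odd m * ∑∑ L β) ≡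
        ∑∑ L (λ k l N → ∑∑ N (λ i j O → E² m O (B i j (A k l f))) +
                        ∑∑ N (λ i j O → E² m O (B i j (B k l f))))
      second-pair = begin
        # (double (suc m)) * (odd m * ∑∑ L β)
          ≡⟨ trans (sym (*-assoc (# (double (suc m))) (odd m) (∑∑ L β)))
               (sym (∑∑-* L (# (double (suc m)) * odd m) β)) ⟩
        ∑∑ L (λ i j N → # (double (suc m)) * odd m * β i j N)
          ≡⟨ ∑∑-cong L (λ i j N p → trans (*-assoc (# (double (suc m))) (odd m) (β i j N))
               (sym (E-pairs m {N} (λ x → sq (B i j f x)) (length-tail₂ len p)))) ⟩
        ∑∑ L (λ i j N → ∑∑ N (λ k l O → E m O (A k l (λ x → sq (B i j f x)))))
          ≡⟨ ∑∑-exchange L (λ i j k l O → E m O (A k l (λ x → sq (B i j f x)))) ⟩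
        ∑∑ L (λ k l N → ∑∑ N (λ i j O → E m O (A k l (λ x → sq (B i j f x)))))
          ≡⟨ ∑∑-cong L (λ k l N _ → trans
               (∑∑-cong N (λ i j O _ → trans (E-A-sq m O k l (B i j f)) (cong₂ _+_
                 (E-cong m O (λ x → cong sq (D-comm (- 1ℚ) 1ℚ k l i j f x)))
                 (E-cong m O (λ x → cong sq (D-comm (- 1ℚ) (- 1ℚ) k l i j f x))))))
               (∑∑-+ N (λ i j O → E² m O (B i j (A k l f))) (λ i j O → E² m O (B i j (B k l f))))) ⟩
        ∑∑ L (λ k l N → ∑∑ N (λ i j O → E² m O (B i j (A k l f))) +
                        ∑∑ N (λ i j O → E² m O (B i j (B k l f)))) ∎
      bound : # (double (suc m)) * (odd m * ∑∑ L β) ≤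
              # 2 * (# (suc d) * odd m) * ∑∑ L α + # 2 * (# d * odd m) * ∑∑ L β
      bound = subst₂ _≤_ (sym second-pair)
        (∑∑-linear L (# 2 * (# (suc d) * odd m)) (# 2 * (# d * odd m)) α β)
        (∑∑-mono L (λ k l N p → +-mono-≤
          (subst (∑∑ N (λ i j O → E² m O (B i j (A k l f))) ≤_)
            (reassociate (# (suc d)) (odd m) (α k l N))
            (dirichlet m (suc d) {N} (A k l f) (Deg-A (suc d) {f} k l deg) (length-tail₂ len p)))
          (subst (∑∑ N (λ i j O → E² m O (B i j (B k l f))) ≤_)
            (reassociate (# d) (odd m) (β k l N))
            (dirichlet m d {N} (B k l f) (deg k l) (length-tail₂ len p)))))
        where
        reassociate : ∀ d o e → # 2 * (d * (o * e)) ≡ # 2 * (d * o) * e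
        reassociate = solve-∀ ring
      gap : ∀ a b n n₂ o d d′ e → n₂ ≡ 1ℚ + (1ℚ + n) → d′ ≡ 1ℚ + d → a + b ≡ n₂ * e →
        o * (n₂ * (# 2 * (d′ * e))) - o * (n₂ * b) ≡
        # 2 * (d′ * o) * a + # 2 * (d * o) * b - n * (o * b)
      gap a b n n₂ o d d′ e refl refl means = trans (pull o n₂ d e b)
        (trans (cong (λ z → # 2 * ((1ℚ + d) * o) * z - o * (n₂ * b)) (sym means)) (collect a b n o d))
        where
        pull : ∀ o n₂ d e b → o * (n₂ * (# 2 * ((1ℚ + d) * e))) - o * (n₂ * b)
               ≡ # 2 * ((1ℚ + d) * o) * (n₂ * e) - o * (n₂ * b)
        pull = solve-∀ ring
        collect : ∀ a b n o d → # 2 * ((1ℚ + d) * o) * (a + b) - o * ((1ℚ + (1ℚ + n)) * b) ≡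
          # 2 * ((1ℚ + d) * o) * a + # 2 * (d * o) * b - n * (o * b)
        collect = solve-∀ ring

    -- The difference xᵢ - xⱼ vanishes unless the two are opposite, where it is 2xᵢ. With n = 2m + 2
    -- coordinates that event has probability n/(2(n-1)).
    Γ-difference : ∀ m {L i j N} (G : Fun n) → length L ≡ double (suc m) → L ↭ i ∷ j ∷ N →
      odd m * (Γ (suc m) i (j ∷ N) G - Γ (suc m) j (i ∷ N) G) ≡
      # (double (suc m)) * E m N (B i j G)
    Γ-difference m {L} {i} {j} {N} G len p = begin
      odd m * (Γ (suc m) i (j ∷ N) G - Γ (suc m) j (i ∷ N) G)
        ≡⟨ distribute (odd m) _ _ ⟩
      odd m * Γ (suc m) i (j ∷ N) G - odd m * Γ (suc m) j (i ∷ N) G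
        ≡⟨ cong₂ _-_ (Γ-row m i (j ∷ N) G) (Γ-row m j (i ∷ N) G) ⟩
      (β + ∑ N φ) - (E m N (B j i G) + ∑ N ψ)
        ≡⟨ cong (λ z → (β + ∑ N φ) - (z + ∑ N ψ))
             (trans (E-cong m N (λ x → trans (B-antisym j i G x) (negate (B i j G x))))
               (E-* m N (- 1ℚ) (B i j G))) ⟩
      (β + ∑ N φ) - (- 1ℚ * β + ∑ N ψ)
        ≡⟨ regroup β (∑ N φ) (∑ N ψ) ⟩
      # 2 * β + (1ℚ * ∑ N φ + - 1ℚ * ∑ N ψ)
        ≡⟨ cong (# 2 * β +_) (trans (sym (∑-linear N 1ℚ (- 1ℚ) φ ψ)) (telescope m N (length-tail₂ len p))) ⟩
      # 2 * β + # (double m) * β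
        ≡⟨ trans (sym (*-distribʳ-+ β (# 2) (# (double m)))) (cong (_* β) (sym (#-+ 2 (double m)))) ⟩
      # (double (suc m)) * β ∎
      where
      open ≡-Reasoning
      β = E m N (B i j G)
      φ ψ : Fin n → List (Fin n) → ℚ
      φ k O = E m (j ∷ O) (B i k G)
      ψ k O = E m (i ∷ O) (B j k G)
      distribute : ∀ o p q → o * (p - q) ≡ o * p - o * q
      distribute = solve-∀ ring
      negate : ∀ p → - p ≡ - 1ℚ * p
      negate = solve-∀ ring
      regroup : ∀ b p q → (b + p) - (- 1ℚ * b + q) ≡ # 2 * b + (1ℚ * p + - 1ℚ * q)
      regroup = solve-∀ ring
      isolate : ∀ a b c → a + b + c ≡ 0ℚ → 1ℚ * (- 1ℚ * c) + - 1ℚ * b ≡ a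
      isolate a b c s≡0 = trans (rewriteSum a b c) (trans (cong (λ z → a - z) s≡0) (minus-0 a))
        where
        rewriteSum : ∀ a b c → 1ℚ * (- 1ℚ * c) + - 1ℚ * b ≡ a - (a + b + c)
        rewriteSum = solve-∀ ring
        minus-0 : ∀ a → a - 0ℚ ≡ a
        minus-0 = solve-∀ ring
      -- The cocycle relation with third index k makes each k contribute one more copy of the mean
      -- of `B i j G`.
      telescope : ∀ m N → length N ≡ double m →
        ∑ N (λ k O → 1ℚ * E m (j ∷ O) (B i k G) + - 1ℚ * E m (i ∷ O) (B j k G)) ≡
        # (double m) * E m N (B i j G)
      telescope zero    [] lenN = sym (*-zeroˡ (E 0 [] (B i j G)))
      telescope (suc m) N  lenN = trans
        (∑-cong N (λ k O q → trans
          (cong (λ z → 1ℚ * z + - 1ℚ * E (suc m) (i ∷ O) (B j k G))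
            (trans (E-cong (suc m) (j ∷ O) (λ x → trans (B-antisym i k G x) (negate (B k i G x))))
              (E-* (suc m) (j ∷ O) (- 1ℚ) (B k i G))))
          (trans (isolate (E (suc m) (k ∷ O) (B i j G)) _ _ (E-cocycle m i j k O G))
            (sym (E-↭ (suc m) (B i j G) lenN q)))))
        (trans (∑-const N _) (cong (λ l → # l * E (suc m) N (B i j G)) lenN))

    -- `Γ-row` expands one factor of γᵢ² as a sum of βᵢⱼ over j. Since β is antisymmetric, the other
    -- factor γᵢ may be replaced by half of γᵢ - γⱼ, which is again a multiple of βᵢⱼ.
    Γ-energy : ∀ m {L} (G : Fun n) → length L ≡ double (suc m) →
      # 2 * (odd m * (odd m * ∑ L (λ i M → sq (Γ (suc m) i M G)))) ≡
      # (double (suc m)) * ∑∑ L (λ i j N → sq (E m N (B i j G)))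
    Γ-energy m {L} G len = begin
      # 2 * (odd m * (odd m * ∑ L (λ i M → sq (Γ (suc m) i M G))))
        ≡⟨ cong (λ z → # 2 * (odd m * z)) (trans (sym (∑-* L (odd m) (λ i M → sq (Γ (suc m) i M G))))
             (∑-cong L row)) ⟩
      # 2 * (odd m * ∑∑ L (λ i j N → γ i j N * β i j N))
        ≡⟨ twice (odd m) (∑∑ L (λ i j N → γ i j N * β i j N)) ⟩
      odd m * (∑∑ L (λ i j N → γ i j N * β i j N) + ∑∑ L (λ i j N → γ i j N * β i j N))
        ≡⟨ cong (λ z → odd m * (∑∑ L (λ i j N → γ i j N * β i j N) + z))
             (∑-swap L (λ i j N → γ i j N * β i j N)) ⟩
      odd m * (∑∑ L (λ i j N → γ i j N * β i j N) + ∑∑ L (λ i j N → γ j i N * β j i N))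
        ≡⟨ cong (odd m *_) (sym (∑∑-+ L (λ i j N → γ i j N * β i j N) (λ i j N → γ j i N * β j i N))) ⟩
      odd m * ∑∑ L (λ i j N → γ i j N * β i j N + γ j i N * β j i N)
        ≡⟨ sym (∑∑-* L (odd m) (λ i j N → γ i j N * β i j N + γ j i N * β j i N)) ⟩
      ∑∑ L (λ i j N → odd m * (γ i j N * β i j N + γ j i N * β j i N))
        ≡⟨ ∑∑-cong L (λ i j N p → trans
             (cong (λ z → odd m * (γ i j N * β i j N + γ j i N * z)) (antisymmetric i j N))
             (trans (factor (odd m) (γ i j N) (γ j i N) (β i j N))
               (trans (cong (_* β i j N) (Γ-difference m G len p))
                 (*-assoc (# (double (suc m))) (β i j N) (β i j N))))) ⟩
      ∑∑ L (λ i j N → # (double (suc m)) * sq (β i j N))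
        ≡⟨ ∑∑-* L (# (double (suc m))) (λ i j N → sq (β i j N)) ⟩
      # (double (suc m)) * ∑∑ L (λ i j N → sq (β i j N)) ∎
      where
      open ≡-Reasoning
      γ β : Fin n → Fin n → List (Fin n) → ℚ
      γ i j N = Γ (suc m) i (j ∷ N) G
      β i j N = E m N (B i j G)
      twice : ∀ o s → # 2 * (o * s) ≡ o * (s + s)
      twice = solve-∀ ring
      factor : ∀ o p q b → o * (p * b + q * (- 1ℚ * b)) ≡ o * (p - q) * b
      factor = solve-∀ ring
      negate : ∀ p → - p ≡ - 1ℚ * p
      negate = solve-∀ ring
      antisymmetric : ∀ i j N → β j i N ≡ - 1ℚ * β i j N
      antisymmetric i j N = trans (E-cong m N (λ x → trans (B-antisym j i G x) (negate (B i j G x))))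
        (E-* m N (- 1ℚ) (B i j G))
      exchange : ∀ o g → o * (g * g) ≡ g * (o * g)
      exchange = solve-∀ ring
      row : ∀ i M → L ↭ i ∷ M → odd m * sq (Γ (suc m) i M G) ≡ ∑ M (λ j N → γ i j N * β i j N)
      row i M p = trans (exchange (odd m) (Γ (suc m) i M G)) (trans
        (cong (Γ (suc m) i M G *_) (Γ-row m i M G))
        (trans (sym (∑-* M (Γ (suc m) i M G) (λ j N → β i j N)))
          (∑-cong M (λ j N q → cong (_* β i j N) (Γ-↭ m i G (length-tail len p) q)))))

  #-mono : ∀ {m n} → m ℕ.≤ n → # m ≤ # n
  #-mono {m} {n} m≤n = ≤-by-gap (0≤# (n ℕ.∸ m)) (trans
    (cong (_- # m) (trans (cong #_ (sym (ℕₚ.m+[n∸m]≡n m≤n))) (#-+ m (n ℕ.∸ m))))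
    (cancel (# m) (# (n ℕ.∸ m))))
    where
    cancel : ∀ a b → a + b - a ≡ b
    cancel = solve-∀ ring

  -- The correlation bound when coordinates are many compared with the degree

  ⅔ : ℚ
  ⅔ = ℤ.+ 2 / 3

  module _ {a b P Q R T x y n o : ℚ}
    (0≤a : 0ℚ ≤ a) (0≤b : 0ℚ ≤ b) (0≤P : 0ℚ ≤ P) (0≤Q : 0ℚ ≤ Q) (0≤R : 0ℚ ≤ R) (0≤T : 0ℚ ≤ T)
    (x²≤PT : sq x ≤ P * T) (y²≤QR : sq y ≤ Q * R) where

    private
      u = b * P + a * R
      v = b * Q + a * T

    -- Here P, Q are to be the second moments of the two halves of f at a pair, R, T those of g, and
    -- a, b the full second moments of f and g; x + y is the mean of `B i j` of the product. The
    -- weights put f and g on the same scale, and v gathers the two moments that the Dirichlet form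
    -- makes small. AM-GM absorbs the cross term 2xy.
    weighted-cauchy-schwarz : a * b * sq (x + y) ≤ u * v
    weighted-cauchy-schwarz = ≤-by-gap
      (0≤a ⊗ 0≤b ⊗ 0≤-gap x²≤PT ⊕ 0≤a ⊗ 0≤b ⊗ 0≤-gap y²≤QR ⊕
       0≤-gap (am-gm {a * b * (x * y)} (0≤b ⊗ 0≤b ⊗ (0≤P ⊗ 0≤Q)) (0≤a ⊗ 0≤a ⊗ (0≤R ⊗ 0≤T)) mixed))
      (identity a b P Q R T x y)
      where
      identity : ∀ a b P Q R T x y →
        (b * P + a * R) * (b * Q + a * T) - a * b * ((x + y) * (x + y)) ≡
        a * b * (P * T - x * x) + a * b * (Q * R - y * y) +
        (b * b * (P * Q) + a * a * (R * T) - # 2 * (a * b * (x * y)))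
      identity = solve-∀ ring
      mixed : sq (a * b * (x * y)) ≤ b * b * (P * Q) * (a * a * (R * T))
      mixed = ≤-by-gap
        (0≤sq (a * b) ⊗ ((0≤Q ⊗ 0≤R) ⊗ 0≤-gap x²≤PT ⊕ 0≤sq x ⊗ 0≤-gap y²≤QR))
        (mixed-identity a b P Q R T x y)
        where
        mixed-identity : ∀ a b P Q R T x y →
          b * b * (P * Q) * (a * a * (R * T)) - (a * b * (x * y)) * (a * b * (x * y)) ≡
          (a * b) * (a * b) * (Q * R * (P * T - x * x) + x * x * (Q * R - y * y))
        mixed-identity = solve-∀ ring

    -- From 18uv ≤ 2(u² + v²) + 9v(u + v).
    weighted-level : 0ℚ ≤ n → n * (P + Q) ≤ # 2 * (o * a) → n * (R + T) ≤ # 2 * (o * b) →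
      n * # 18 * (a * b) * sq (x + y) ≤
      # 4 * n * sq b * (sq P + sq Q) + # 4 * n * sq a * (sq R + sq T) +
      (# 36 * (o * (a * b)) * b * Q + # 36 * (o * (a * b)) * a * T)
    weighted-level 0≤n P+Q≤ R+T≤ = ≤-by-gap
      (0≤n ⊗ (0≤# 18 ⊗ 0≤-gap weighted-cauchy-schwarz) ⊕
       0≤n ⊗ (0≤# 2 ⊗ (0≤sq (b * P - a * R) ⊕ 0≤sq (b * Q - a * T))) ⊕
       -- This is 2u² - 9uv + 11v², the slack in 18uv ≤ 2(u² + v²) + 9v(u + v).
       0≤n ⊗ (0≤⅛ ⊗ (0≤sq (# 4 * u - # 9 * v) ⊕ 0≤# 7 ⊗ 0≤sq v)) ⊕
       -- The two hypotheses give n(u + v) ≤ 4oab, which leaves v linear, so that the Dirichlet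
       -- bound can be applied to its sum over the pairs.
       0≤# 9 ⊗ (0≤b ⊗ 0≤Q ⊕ 0≤a ⊗ 0≤T) ⊗ (0≤b ⊗ 0≤-gap P+Q≤ ⊕ 0≤a ⊗ 0≤-gap R+T≤))
      (identity a b P Q R T (sq (x + y)) n o)
      where
      0≤⅛ : 0ℚ ≤ 1ℤ / 8
      0≤⅛ = nonNegative⁻¹ (1ℤ / 8)
      identity : ∀ a b P Q R T z n o →
        # 4 * n * (b * b) * (P * P + Q * Q) + # 4 * n * (a * a) * (R * R + T * T) +
          (# 36 * (o * (a * b)) * b * Q + # 36 * (o * (a * b)) * a * T) - n * # 18 * (a * b) * z ≡
        n * (# 18 * ((b * P + a * R) * (b * Q + a * T) - a * b * z)) +
        n * (# 2 * ((b * P - a * R) * (b * P - a * R) + (b * Q - a * T) * (b * Q - a * T))) +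
        n * (1ℤ / 8 * ((# 4 * (b * P + a * R) - # 9 * (b * Q + a * T)) *
                       (# 4 * (b * P + a * R) - # 9 * (b * Q + a * T)) +
                       # 7 * ((b * Q + a * T) * (b * Q + a * T)))) +
        # 9 * (b * Q + a * T) * (b * (# 2 * (o * a) - n * (P + Q)) + a * (# 2 * (o * b) - n * (R + T)))
      identity = solve-∀ ring

  infixl 7 _⊗⁺_

  _⊗⁺_ : ∀ {p q} → 0ℚ < p → 0ℚ < q → 0ℚ < p * q
  _⊗⁺_ {p} {q} 0<p 0<q = positive⁻¹ (p * q) {{pos*pos⇒pos p {{positive 0<p}} q {{positive 0<q}}}}

  module _ {n : ℕ} where

    -- By `Γ-energy` the sum is determined by the means of `B i j` of the product, and the product
    -- rule puts a factor `B i j f` or `B i j g` into each of these. Such factors have small total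
    -- because the degree is small compared with the number of coordinates.
    level-bound : ∀ m d {L} (f g : Fun n) → length L ≡ double (suc m) →
      9 ℕ.* suc d ℕ.≤ suc (double (suc m)) → Deg (suc d) f → Deg d g →
      ∑ L (λ i M → sq (Γ (suc m) i M (λ x → f x * g x))) ≤
      # (double (suc m)) * (⅔ * (E² (suc m) L f * E² (suc m) L g))
    level-bound m d {L} f g len 9d≤ deg-f deg-g with E² (suc m) L f * E² (suc m) L g ≟ 0ℚ
    -- The weights a and b have to be cancelled later. If their product vanishes, so does every
    -- correlation.
    ... | yes ab≡0 = subst₂ _≤_ refl
      (trans (∑-const L 0ℚ) (trans (*-zeroʳ (# (length L)))
        (sym (trans (cong (λ z → # (double (suc m)) * (⅔ * z)) ab≡0) (*-zeroʳ (# (double (suc m))))))))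
      (∑-mono L (λ i M p → ≤-trans (Γ-cauchy-schwarz (suc m) i M f g) (≤-reflexive (trans
        (cong₂ _*_ (sym (E-↭ (suc m) _ len p)) (sym (E-↭ (suc m) _ len p))) ab≡0))))
    ... | no ab≢0 = ≤-cancel-factor
      (0<#suc 35 ⊗⁺ (0<#suc (double m) ⊗⁺ 0<#suc (double m)) ⊗⁺ ≤∧≢⇒< (0≤a ⊗ 0≤b) (λ 0≡ab → ab≢0 (sym 0≡ab)))
      (≤-by-gap
      (0≤# 4 ⊗ 0≤# (double (suc m)) ⊗ (0≤sq b ⊗ 0≤-gap (pair-energy-basic m {L} f len) ⊕
                                        0≤sq a ⊗ 0≤-gap (pair-energy-basic m {L} g len)) ⊕
       0≤# 36 ⊗ (0≤o ⊗ (0≤a ⊗ 0≤b)) ⊗ (0≤b ⊗ 0≤-gap (dirichlet m (suc d) {L} f deg-f len) ⊕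
                                         0≤a ⊗ 0≤-gap (dirichlet m d {L} g deg-g len)) ⊕
       -- Once 9(d + 1) ≤ n + 1 has replaced the degree by n, 40 + 48·2m is left over. It is
       -- positive because g has degree d, one less than f.
       0≤sq (a * b) ⊗ 0≤o ⊗ (0≤o ⊗ 0≤# 16 ⊗ 0≤-gap (#-mono 9d≤) ⊕ (0≤# 40 ⊕ 0≤# 48 ⊗ 0≤# (double m))) ⊕
       0≤-gap summed)
      (gap a b (# d) Σ₁ Σ₂ (∑∑ L Q) (∑∑ L T) X (∑ L (λ i M → sq (Γ (suc m) i M h))) (# (double m))
        (#-suc (double m)) (#-double-suc m) (#-suc d)
        (trans (#-* 9 (suc d)) (cong (# 9 *_) (#-suc d))) (#-suc (double (suc m)))
        (Γ-energy m {L} h len)))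
      where
      h : Fun n
      h x = f x * g x
      a = E² (suc m) L f
      b = E² (suc m) L g
      0≤a = 0≤Esq (suc m) L f
      0≤b = 0≤Esq (suc m) L g
      0≤o = 0≤# (suc (double m))
      P Q R T β : Fin n → Fin n → List (Fin n) → ℚ
      P i j N = E² m N (A i j f)
      Q i j N = E² m N (B i j f)
      R i j N = E² m N (A i j g)
      T i j N = E² m N (B i j g)
      β i j N = E m N (B i j h)
      X = ∑∑ L (λ i j N → sq (β i j N))
      Σ₁ = ∑∑ L (λ i j N → sq (P i j N) + sq (Q i j N))
      Σ₂ = ∑∑ L (λ i j N → sq (R i j N) + sq (T i j N))
      c₀ c₁ c₂ c₃ c₄ : ℚ
      c₀ = # (double (suc m)) * # 18 * (a * b)
      c₁ = # 4 * # (double (suc m)) * sq b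
      c₂ = # 4 * # (double (suc m)) * sq a
      c₃ = # 36 * (odd m * (a * b)) * b
      c₄ = # 36 * (odd m * (a * b)) * a
      conditional : ∀ f i j N → L ↭ i ∷ j ∷ N →
        # (double (suc m)) * (E² m N (A i j f) + E² m N (B i j f)) ≤ # 2 * (odd m * E² (suc m) L f)
      conditional f i j N p = subst₂ _≤_
        (cong (# (double (suc m)) *_) (E-A-sq m N i j f))
        (cong (λ z → # 2 * (odd m * z)) (sym (E-↭ (suc m) (λ x → sq (f x)) len p)))
        (E-A-≤ m i j N (length-tail₂ len p) (λ x → 0≤sq (f x)))
      pointwise : ∀ i j N → L ↭ i ∷ j ∷ N → c₀ * sq (β i j N) ≤
        c₁ * (sq (P i j N) + sq (Q i j N)) + c₂ * (sq (R i j N) + sq (T i j N)) +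
        (c₃ * Q i j N + c₄ * T i j N)
      pointwise i j N p = subst (λ z → c₀ * sq z ≤
          c₁ * (sq (P i j N) + sq (Q i j N)) + c₂ * (sq (R i j N) + sq (T i j N)) +
          (c₃ * Q i j N + c₄ * T i j N))
        (sym (trans (E-cong m N (B-* i j f g))
          (E-+ m N (λ x → A i j f x * B i j g x) (λ x → B i j f x * A i j g x))))
        (weighted-level {a = a} {b = b} {P = P i j N} {Q = Q i j N} {R = R i j N} {T = T i j N}
          {E m N (λ x → A i j f x * B i j g x)} {E m N (λ x → B i j f x * A i j g x)}
          {n = # (double (suc m))} {o = odd m}
          0≤a 0≤b (0≤Esq m N (A i j f)) (0≤Esq m N (B i j f)) (0≤Esq m N (A i j g)) (0≤Esq m N (B i j g))
          (E-cauchy-schwarz m N (A i j f) (B i j g)) (E-cauchy-schwarz m N (B i j f) (A i j g))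
          (0≤# (double (suc m))) (conditional f i j N p) (conditional g i j N p))
      summed : c₀ * X ≤ c₁ * Σ₁ + c₂ * Σ₂ + (c₃ * ∑∑ L Q + c₄ * ∑∑ L T)
      summed = subst₂ _≤_
        (∑∑-* L c₀ (λ i j N → sq (β i j N)))
        (trans
          (∑∑-+ L (λ i j N → c₁ * (sq (P i j N) + sq (Q i j N)) + c₂ * (sq (R i j N) + sq (T i j N)))
                  (λ i j N → c₃ * Q i j N + c₄ * T i j N))
          (cong₂ _+_
            (∑∑-linear L c₁ c₂ (λ i j N → sq (P i j N) + sq (Q i j N)) (λ i j N → sq (R i j N) + sq (T i j N)))
            (∑∑-linear L c₃ c₄ Q T)))
        (∑∑-mono L pointwise)
      gap : ∀ a b d s₁ s₂ q t x s e {o n d′ nine n′} → o ≡ 1ℚ + e → n ≡ 1ℚ + o → d′ ≡ 1ℚ + d →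
        nine ≡ # 9 * (1ℚ + d) → n′ ≡ 1ℚ + n → # 2 * (o * (o * s)) ≡ n * x →
        # 36 * (o * o) * (a * b) * (n * (⅔ * (a * b))) - # 36 * (o * o) * (a * b) * s ≡
        # 4 * n * (sq b * (n * (o * sq a) - s₁) + sq a * (n * (o * sq b) - s₂)) +
        # 36 * (o * (a * b)) * (b * (# 2 * (d′ * (o * a)) - q) + a * (# 2 * (d * (o * b)) - t)) +
        sq (a * b) * o * (o * # 16 * (n′ - nine) + (# 40 + # 48 * e)) +
        (# 4 * n * sq b * s₁ + # 4 * n * sq a * s₂ +
          (# 36 * (o * (a * b)) * b * q + # 36 * (o * (a * b)) * a * t) - n * # 18 * (a * b) * x)
      gap a b d s₁ s₂ q t x s e {o} {n} refl refl refl refl refl energy = trans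
        (expose a b o n s)
        (trans (cong (λ z → # 36 * (o * o) * (a * b) * (n * (⅔ * (a * b))) - # 18 * (a * b) * z) energy)
          (identity a b d s₁ s₂ q t x e))
        where
        expose : ∀ a b o n s →
          # 36 * (o * o) * (a * b) * (n * (⅔ * (a * b))) - # 36 * (o * o) * (a * b) * s ≡
          # 36 * (o * o) * (a * b) * (n * (⅔ * (a * b))) - # 18 * (a * b) * (# 2 * (o * (o * s)))
        expose = solve-∀ ring
        identity : ∀ a b d s₁ s₂ q t x e →
          # 36 * ((1ℚ + e) * (1ℚ + e)) * (a * b) * ((1ℚ + (1ℚ + e)) * (⅔ * (a * b))) -
            # 18 * (a * b) * ((1ℚ + (1ℚ + e)) * x) ≡
          # 4 * (1ℚ + (1ℚ + e)) * (b * b * ((1ℚ + (1ℚ + e)) * ((1ℚ + e) * (a * a)) - s₁) +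
                                     a * a * ((1ℚ + (1ℚ + e)) * ((1ℚ + e) * (b * b)) - s₂)) +
          # 36 * ((1ℚ + e) * (a * b)) * (b * (# 2 * ((1ℚ + d) * ((1ℚ + e) * a)) - q) +
                                         a * (# 2 * (d * ((1ℚ + e) * b)) - t)) +
          (a * b) * (a * b) * (1ℚ + e) *
            ((1ℚ + e) * # 16 * (1ℚ + (1ℚ + (1ℚ + e)) - # 9 * (1ℚ + d)) + (# 40 + # 48 * e)) +
          (# 4 * (1ℚ + (1ℚ + e)) * (b * b) * s₁ + # 4 * (1ℚ + (1ℚ + e)) * (a * a) * s₂ +
            (# 36 * ((1ℚ + e) * (a * b)) * b * q + # 36 * ((1ℚ + e) * (a * b)) * a * t) -
            (1ℚ + (1ℚ + e)) * # 18 * (a * b) * x)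
        identity = solve-∀ ring

  -- The fourth moment inequality

  pow : ℚ → ℕ → ℚ
  pow q zero    = 1ℚ
  pow q (suc k) = q * pow q k

  0≤pow : ∀ {q} k → 0ℚ ≤ q → 0ℚ ≤ pow q k
  0≤pow zero    0≤q = 0≤# 1
  0≤pow (suc k) 0≤q = 0≤q ⊗ 0≤pow k 0≤q

  pair-count-cancel : ∀ m {x y} → # (double (suc m)) * (odd m * x) ≤ # (double (suc m)) * (odd m * y) → x ≤ y
  pair-count-cancel m x≤y = ≤-cancel-factor (0<#suc (double m)) (≤-cancel-factor (0<#suc (suc (double m))) x≤y)

  module _ {n : ℕ} where

    E⁴-B-constant : ∀ m N i j (f : Fun n) → Deg 0 f → E⁴ m N (B i j f) ≡ 0ℚ
    E⁴-B-constant m N i j f deg = trans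
      (E-cong m N (λ x → trans (cong (λ z → sq (sq z)) (deg i j x)) (sym (*-zeroˡ 0ℚ))))
      (trans (E-* m N 0ℚ (λ _ → 0ℚ)) (*-zeroˡ (E m N (λ _ → 0ℚ))))

    Γ-constant : ∀ m N j k (f : Fun n) → Deg 0 f → length N ≡ double m → ∀ i O → N ↭ i ∷ O →
      sq (Γ m i O (λ x → A j k f x * B j k f x)) ≤ 0ℚ
    Γ-constant m N j k f deg len i O p = ≤-trans (Γ-cauchy-schwarz m i O (A j k f) (B j k f))
      (≤-reflexive (trans (cong (E² m (i ∷ O) (A j k f) *_) (E²-B-constant m (i ∷ O) j k f deg))
        (*-zeroʳ (E² m (i ∷ O) (A j k f)))))

    -- The two halves of f have degrees d and d - 1, which is the shape that `level-bound` expects.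
    -- For d = 0 the second half is zero, and the correlations vanish with it.
    pair-level : ∀ m d {N} j k (f : Fun n) → length N ≡ double m → 9 ℕ.* d ℕ.≤ suc (double m) → Deg d f →
      ∑ N (λ i O → sq (Γ m i O (λ x → A j k f x * B j k f x))) ≤
      # (double m) * (⅔ * (E² m N (A j k f) * E² m N (B j k f)))
    pair-level m zero {N} j k f len 9d≤ deg = ≤-trans
      (∑-mono N (Γ-constant m N j k f deg len))
      (subst (_≤ # (double m) * (⅔ * (E² m N (A j k f) * E² m N (B j k f)))) (sym (∑-0 N))
        (0≤# (double m) ⊗ (0≤# 2 ⊗ 0≤⅓ ⊗ (0≤Esq m N (A j k f) ⊗ 0≤Esq m N (B j k f)))))
      where
      0≤⅓ : 0ℚ ≤ 1ℤ / 3
      0≤⅓ = nonNegative⁻¹ (1ℤ / 3)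
    pair-level zero    (suc d) j k f len 9d≤ deg with ℕ.s≤s () ← ℕₚ.≤-trans (ℕₚ.m≤m*n 9 (suc d)) 9d≤
    pair-level (suc m) (suc d) {N} j k f len 9d≤ deg =
      level-bound m d {N} (A j k f) (B j k f) len 9d≤ (Deg-A (suc d) {f} j k deg) (deg j k)

    pair-energy-⅔ : ∀ m d {L} (f : Fun n) → length L ≡ double (suc m) → 9 ℕ.* d ℕ.≤ suc (double m) → Deg d f →
      ∑∑ L (λ j k N → sq (E² m N (A j k f)) + ⅔ * (E² m N (A j k f) * E² m N (B j k f)) + sq (E² m N (B j k f))) ≤
      # (double (suc m)) * (odd m * sq (E² (suc m) L f))
    pair-energy-⅔ m d {L} f len 9d≤ deg = subst (_≤ # (double (suc m)) * (odd m * sq (E² (suc m) L f)))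
      (∑∑-cong L (λ j k N _ → simplify (E² m N (A j k f)) (E² m N (B j k f))))
      (pair-energy m {L} f ⅔ len (nonNegative⁻¹ ⅔)
        (λ j k N p → pair-level m d {N} j k f (length-tail₂ len p) 9d≤ deg))
      where
      simplify : ∀ a b → (a + b) * (a + b) - # 2 * ⅔ * (a * b) ≡ a * a + ⅔ * (a * b) + b * b
      simplify = solve-∀ ring

    -- Bonami's step: odd powers of xᵢ average out, and Cauchy-Schwarz bounds the mean of a²b² by
    -- the fourth moments of a and b. The number θ² is the factor by which the constant grows with
    -- each degree.
    fourth-moment-pair : ∀ m N i j (f : Fun n) K θ → 0ℚ ≤ K → 0ℚ ≤ θ →
      E⁴ m N (A i j f) ≤ K * sq θ * sq (E² m N (A i j f)) →
      E⁴ m N (B i j f) ≤ K * sq (E² m N (B i j f)) →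
      E m N (A i j (λ x → sq (sq (f x)))) ≤
      K * (sq θ * sq (E² m N (A i j f)) + # 6 * θ * (E² m N (A i j f) * E² m N (B i j f)) + sq (E² m N (B i j f)))
    fourth-moment-pair m N i j f K θ 0≤K 0≤θ bound-a bound-b = ≤-by-gap
      (0≤-gap bound-a ⊕ 0≤# 6 ⊗ 0≤-gap mixed ⊕ 0≤-gap bound-b)
      (trans
        (cong (λ z → K * (sq θ * sq α + # 6 * θ * (α * β) + sq β) - z) expansion)
        (identity K θ α β (E⁴ m N a) (E m N (λ x → sq (a x) * sq (b x))) (E⁴ m N b)))
      where
      a = A i j f
      b = B i j f
      α = E² m N a
      β = E² m N b
      expansion : E m N (A i j (λ x → sq (sq (f x)))) ≡
                  E⁴ m N a + # 6 * E m N (λ x → sq (a x) * sq (b x)) + E⁴ m N b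
      expansion = trans (E-cong m N (A-pow4 i j f)) (trans
        (E-+ m N (λ x → sq (sq (a x)) + # 6 * (sq (a x) * sq (b x))) (λ x → sq (sq (b x))))
        (cong (_+ E⁴ m N b) (trans
          (E-+ m N (λ x → sq (sq (a x))) (λ x → # 6 * (sq (a x) * sq (b x))))
          (cong (E⁴ m N a +_) (E-* m N (# 6) (λ x → sq (a x) * sq (b x)))))))
      identity : ∀ K θ α β p q r →
        K * (θ * θ * (α * α) + # 6 * θ * (α * β) + β * β) - (p + # 6 * q + r) ≡
        K * (θ * θ) * (α * α) - p + # 6 * (K * θ * (α * β) - q) + (K * (β * β) - r)
      identity = solve-∀ ring
      0≤E⁴ : ∀ g → 0ℚ ≤ E⁴ m N g
      0≤E⁴ g = 0≤Esq m N (λ x → sq (g x))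
      product-≤ : ∀ {p q r s} → 0ℚ ≤ p → 0ℚ ≤ s → p ≤ q → r ≤ s → p * r ≤ q * s
      product-≤ {p} {q} {r} {s} 0≤p 0≤s p≤q r≤s = ≤-by-gap
        (0≤p ⊗ 0≤-gap r≤s ⊕ 0≤s ⊗ 0≤-gap p≤q) (product-identity p q r s)
        where
        product-identity : ∀ p q r s → q * s - p * r ≡ p * (s - r) + s * (q - p)
        product-identity = solve-∀ ring
      rearrange : ∀ K θ α β → K * (θ * θ) * (α * α) * (K * (β * β)) ≡ (K * θ * (α * β)) * (K * θ * (α * β))
      rearrange = solve-∀ ring
      mixed : E m N (λ x → sq (a x) * sq (b x)) ≤ K * θ * (α * β)
      mixed = sq-cancel-≤ (0≤K ⊗ 0≤θ ⊗ (0≤Esq m N a ⊗ 0≤Esq m N b))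
        (≤-trans (E-cauchy-schwarz m N (λ x → sq (a x)) (λ x → sq (b x)))
          (≤-trans (product-≤ (0≤E⁴ a) (0≤K ⊗ 0≤sq β) bound-a bound-b)
            (≤-reflexive (rearrange K θ α β))))

    fourth-moment-step : ∀ m {L} (f : Fun n) K θ → length L ≡ double (suc m) → 0ℚ ≤ K → 0ℚ ≤ θ →
      (∀ i j N → L ↭ i ∷ j ∷ N → E⁴ m N (A i j f) ≤ K * sq θ * sq (E² m N (A i j f))) →
      (∀ i j N → L ↭ i ∷ j ∷ N → E⁴ m N (B i j f) ≤ K * sq (E² m N (B i j f))) →
      # (double (suc m)) * (odd m * E⁴ (suc m) L f) ≤
      K * ∑∑ L (λ i j N → sq θ * sq (E² m N (A i j f)) +
                          # 6 * θ * (E² m N (A i j f) * E² m N (B i j f)) + sq (E² m N (B i j f)))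
    fourth-moment-step m {L} f K θ len 0≤K 0≤θ bound-a bound-b = subst₂ _≤_
      (E-pairs m {L} (λ x → sq (sq (f x))) len)
      (∑∑-* L K (λ i j N → sq θ * sq (E² m N (A i j f)) +
        # 6 * θ * (E² m N (A i j f) * E² m N (B i j f)) + sq (E² m N (B i j f))))
      (∑∑-mono L (λ i j N p → fourth-moment-pair m N i j f K θ 0≤K 0≤θ (bound-a i j N p) (bound-b i j N p)))

    -- The factor 10/7 per pair is what the sharp form 16α² + 24αβ + β² of the
    -- step loses against the energy bound for α² + β².
    fourth-moment-small : ∀ m d {L} (f : Fun n) → Deg d f → length L ≡ double m →
      E⁴ m L f ≤ pow (# 16) d * pow (ℤ.+ 10 / 7) m * sq (E² m L f)
    fourth-moment-small zero d {L} f deg len = ≤-by-gap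
      (0≤-gap (1≤pow d) ⊗ 0≤sq (E² 0 L f))
      (identity (pow (# 16) d) (sq (E² 0 L f)))
      where
      identity : ∀ p e → p * 1ℚ * e - e ≡ (p - 1ℚ) * e
      identity = solve-∀ ring
      1≤pow : ∀ d → 1ℚ ≤ pow (# 16) d
      1≤pow zero    = ≤-refl
      1≤pow (suc d) = ≤-by-gap (0≤# 15 ⊕ 0≤# 16 ⊗ 0≤-gap (1≤pow d)) (pow-identity (pow (# 16) d))
        where
        pow-identity : ∀ p → # 16 * p - 1ℚ ≡ # 15 + # 16 * (p - 1ℚ)
        pow-identity = solve-∀ ring
    fourth-moment-small (suc m) d {L} f deg len = pair-count-cancel m
      (≤-trans (fourth-moment-step m {L} f (K d) (# 4) len (0≤K d) (0≤# 4)
        (λ i j N p → subst (λ c → E⁴ m N (A i j f) ≤ c * sq (E² m N (A i j f)))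
          (sixteenth (pow (# 16) d * pow ρ m))
          (fourth-moment-small m d {N} (A i j f) (Deg-A d {f} i j deg) (length-tail₂ len p)))
        (λ i j N p → bound-b d deg i j N (length-tail₂ len p)))
      (≤-by-gap
        (0≤K d ⊗ (0≤∑∑ L (λ i j N _ → 0≤48/7 ⊗ 0≤sq (α i j N - ℤ.+ 7 / 4 * β i j N) ⊕ 0≤6/7 ⊗ 0≤sq (β i j N)) ⊕
                  -- Here 160/7 = 16 · 10/7 lies slightly above the largest eigenvalue of 16α² +
                  -- 24αβ + β². The difference 160/7 (α² + β²) - (16α² + 24αβ + β²) is the pair of
                  -- squares in the line above.
                  0≤160/7 ⊗ 0≤-gap (pair-energy-basic m {L} f len)))
        (gap (pow (# 16) d) (pow ρ m) (∑∑ L (λ i j N → sq (α i j N) + sq (β i j N)))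
          (∑∑ L (λ i j N → ℤ.+ 48 / 7 * sq (α i j N - ℤ.+ 7 / 4 * β i j N) + ℤ.+ 6 / 7 * sq (β i j N)))
          (# (double (suc m))) (odd m) (sq (E² (suc m) L f)) complete-square)))
      where
      ρ = ℤ.+ 10 / 7
      -- The constant for one degree less. Dividing by 16, instead of lowering the exponent, also
      -- gives a value at degree 0, where `B i j f` is zero and any nonnegative constant serves.
      K : ℕ → ℚ
      K d = 1ℤ / 16 * (pow (# 16) d * pow ρ m)
      0≤K : ∀ d → 0ℚ ≤ K d
      0≤K d = nonNegative⁻¹ (1ℤ / 16) ⊗ (0≤pow d (0≤# 16) ⊗ 0≤pow m (nonNegative⁻¹ ρ))
      0≤48/7 : 0ℚ ≤ ℤ.+ 48 / 7
      0≤48/7 = nonNegative⁻¹ (ℤ.+ 48 / 7)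
      0≤6/7 : 0ℚ ≤ ℤ.+ 6 / 7
      0≤6/7 = nonNegative⁻¹ (ℤ.+ 6 / 7)
      0≤160/7 : 0ℚ ≤ ℤ.+ 160 / 7
      0≤160/7 = nonNegative⁻¹ (ℤ.+ 160 / 7)
      α β : Fin n → Fin n → List (Fin n) → ℚ
      α i j N = E² m N (A i j f)
      β i j N = E² m N (B i j f)
      sixteenth : ∀ p → p ≡ 1ℤ / 16 * p * (# 4 * # 4)
      sixteenth = solve-∀ ring
      bound-b : ∀ d → Deg d f → ∀ i j N → length N ≡ double m → E⁴ m N (B i j f) ≤ K d * sq (β i j N)
      bound-b zero    deg i j N lenN = subst (_≤ K 0 * sq (β i j N))
        (sym (E⁴-B-constant m N i j f deg))
        (0≤K 0 ⊗ 0≤sq (β i j N))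
      bound-b (suc d) deg i j N lenN = subst (λ c → E⁴ m N (B i j f) ≤ c * sq (β i j N))
        (unscale (pow (# 16) d) (pow ρ m))
        (fourth-moment-small m d {N} (B i j f) (deg i j) lenN)
        where
        unscale : ∀ p r → p * r ≡ 1ℤ / 16 * (# 16 * p * r)
        unscale = solve-∀ ring
      complete-square :
        ∑∑ L (λ i j N → sq (# 4) * sq (α i j N) + # 6 * # 4 * (α i j N * β i j N) + sq (β i j N)) ≡
        ℤ.+ 160 / 7 * ∑∑ L (λ i j N → sq (α i j N) + sq (β i j N)) + - 1ℚ *
        ∑∑ L (λ i j N → ℤ.+ 48 / 7 * sq (α i j N - ℤ.+ 7 / 4 * β i j N) + ℤ.+ 6 / 7 * sq (β i j N))
      complete-square = trans
        (∑∑-cong L (λ i j N _ → square (α i j N) (β i j N)))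
        (∑∑-linear L (ℤ.+ 160 / 7) (- 1ℚ) (λ i j N → sq (α i j N) + sq (β i j N))
          (λ i j N → ℤ.+ 48 / 7 * sq (α i j N - ℤ.+ 7 / 4 * β i j N) + ℤ.+ 6 / 7 * sq (β i j N)))
        where
        square : ∀ a b → # 4 * # 4 * (a * a) + # 6 * # 4 * (a * b) + b * b ≡
          ℤ.+ 160 / 7 * (a * a + b * b) + - 1ℚ *
          (ℤ.+ 48 / 7 * ((a - ℤ.+ 7 / 4 * b) * (a - ℤ.+ 7 / 4 * b)) + ℤ.+ 6 / 7 * (b * b))
        square = solve-∀ ring
      gap : ∀ p r s u n o e {t} → t ≡ ℤ.+ 160 / 7 * s + - 1ℚ * u →
        n * (o * (p * (ℤ.+ 10 / 7 * r) * e)) - 1ℤ / 16 * (p * r) * t ≡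
        1ℤ / 16 * (p * r) * (u + ℤ.+ 160 / 7 * (n * (o * e) - s))
      gap p r s u n o e refl = identity p r s n o e u
        where
        identity : ∀ p r s n o e u →
          n * (o * (p * (ℤ.+ 10 / 7 * r) * e)) - 1ℤ / 16 * (p * r) * (ℤ.+ 160 / 7 * s + - 1ℚ * u) ≡
          1ℤ / 16 * (p * r) * (u + ℤ.+ 160 / 7 * (n * (o * e) - s))
        identity = solve-∀ ring

  -- The exponent m can be as large as 9d/2, which need not be an integer, so the two sides are
  -- compared after squaring.
  pow-≤ : ∀ m d → double m ℕ.≤ 9 ℕ.* d → pow (# 16) d * pow (ℤ.+ 10 / 7) m ≤ pow (# 81) d
  pow-≤ m d 2m≤9d = sq-cancel-≤ (0≤pow d (0≤# 81)) (begin
    sq (pow (# 16) d * pow ρ m)                       ≡⟨ split (pow (# 16) d) (pow ρ m) ⟩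
    sq (pow (# 16) d) * sq (pow ρ m)                  ≡⟨ cong (sq (pow (# 16) d) *_) (sq-pow m) ⟩
    sq (pow (# 16) d) * pow ρ (double m)              ≤⟨ *-monoˡ-≤-nonNeg (sq (pow (# 16) d))
                                                          {{nonNegative (0≤sq (pow (# 16) d))}} (pow-mono 2m≤9d) ⟩
    sq (pow (# 16) d) * pow ρ (9 ℕ.* d)               ≤⟨ by-degree d ⟩
    sq (pow (# 81) d)                                 ∎)
    where
    open ≤-Reasoning
    ρ = ℤ.+ 10 / 7
    0≤ρ = nonNegative⁻¹ ρ
    split : ∀ p q → (p * q) * (p * q) ≡ (p * p) * (q * q)
    split = solve-∀ ring
    sq-pow : ∀ m → sq (pow ρ m) ≡ pow ρ (double m)
    sq-pow zero    = refl
    sq-pow (suc m) = trans (regroup ρ (pow ρ m)) (cong (λ z → ρ * (ρ * z)) (sq-pow m))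
      where
      regroup : ∀ r p → (r * p) * (r * p) ≡ r * (r * (p * p))
      regroup = solve-∀ ring
    pow-suc : ∀ k → pow ρ k ≤ pow ρ (suc k)
    pow-suc k = ≤-by-gap (nonNegative⁻¹ (ℤ.+ 3 / 7) ⊗ 0≤pow k 0≤ρ) (identity (pow ρ k))
      where
      identity : ∀ p → ℤ.+ 10 / 7 * p - p ≡ ℤ.+ 3 / 7 * p
      identity = solve-∀ ring
    pow-mono′ : ∀ {k l} → k ℕ.≤′ l → pow ρ k ≤ pow ρ l
    pow-mono′ (ℕ.≤′-reflexive refl) = ≤-refl
    pow-mono′ {l = suc l} (ℕ.≤′-step k≤l) = ≤-trans (pow-mono′ k≤l) (pow-suc l)
    pow-mono : ∀ {k l} → k ℕ.≤ l → pow ρ k ≤ pow ρ l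
    pow-mono k≤l = pow-mono′ (ℕₚ.≤⇒≤′ k≤l)
    -- Numerically 256 (10/7)^9 is about 6344, below 6561 = 81². This is where the base 16, the loss
    -- 10/7 and the threshold 9d have to fit together.
    0≤excess : 0ℚ ≤ # 6561 - # 256 * pow ρ 9
    0≤excess = nonNegative⁻¹ (# 6561 - # 256 * pow ρ 9)
    by-degree : ∀ d → sq (pow (# 16) d) * pow ρ (9 ℕ.* d) ≤ sq (pow (# 81) d)
    by-degree zero    = ≤-refl
    by-degree (suc d) = subst (λ k → sq (pow (# 16) (suc d)) * pow ρ k ≤ sq (pow (# 81) (suc d)))
      (sym (ℕₚ.*-suc 9 d))
      (≤-by-gap
        (0≤# 256 ⊗ 0≤pow 9 0≤ρ ⊗ 0≤-gap (by-degree d) ⊕ 0≤excess ⊗ 0≤sq (pow (# 81) d))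
        (identity (pow (# 16) d) (pow (# 81) d) (pow ρ (9 ℕ.* d))))
      where
      identity : ∀ p q r →
        (# 81 * q) * (# 81 * q) - (# 16 * p) * (# 16 * p) *
          (ρ * (ρ * (ρ * (ρ * (ρ * (ρ * (ρ * (ρ * (ρ * r))))))))) ≡
        # 256 * pow ρ 9 * (q * q - p * p * r) + (# 6561 - # 256 * pow ρ 9) * (q * q)
      identity = solve-∀ ring

  module _ {n : ℕ} where

    -- Above the threshold a step costs nothing, since 81α² + 54αβ + β² is 81 times the form
    -- controlled by `pair-energy-⅔`, minus 80β². Along `A i j f` the induction lowers m at fixed d
    -- until 2m ≤ 9d, where `fourth-moment-small` takes over.
    fourth-moment : ∀ m d {L} (f : Fun n) → Deg d f → length L ≡ double m →
      E⁴ m L f ≤ pow (# 81) d * sq (E² m L f)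
    fourth-moment m d {L} f deg len with double m ℕₚ.≤? 9 ℕ.* d
    ... | yes 2m≤9d = ≤-trans (fourth-moment-small m d {L} f deg len)
      (*-monoʳ-≤-nonNeg (sq (E² m L f)) {{nonNegative (0≤sq (E² m L f))}} (pow-≤ m d 2m≤9d))
    fourth-moment zero d f deg len | no 2m≰9d = ⊥-elim (2m≰9d ℕ.z≤n)
    fourth-moment (suc m) d {L} f deg len | no 2m≰9d = pair-count-cancel m
      (≤-trans (fourth-moment-step m {L} f (K d) (# 9) len (0≤K d) (0≤# 9)
        (λ i j N p → subst (λ c → E⁴ m N (A i j f) ≤ c * sq (E² m N (A i j f)))
          (scale (pow (# 81) d))
          (fourth-moment m d {N} (A i j f) (Deg-A d {f} i j deg) (length-tail₂ len p)))
        (λ i j N p → bound-b d deg i j N (length-tail₂ len p)))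
      (≤-by-gap
        -- For n = 2m + 2 the failed comparison n ≤ 9d gives 9d ≤ 2m + 1. This exceeds by one the
        -- number of coordinates outside a pair, as the hypothesis of `pair-level` allows.
        (0≤pow d (0≤# 81) ⊗ 0≤-gap (pair-energy-⅔ m d {L} f len (ℕ.s≤s⁻¹ {9 ℕ.* d} {suc (double m)} (ℕₚ.≰⇒> 2m≰9d)) deg) ⊕
         0≤K d ⊗ (0≤# 80 ⊗ 0≤∑∑ L {λ i j N → sq (β i j N)} (λ i j N _ → 0≤sq (β i j N))))
        (gap (pow (# 81) d) (∑∑ L (λ i j N → sq (α i j N) + ⅔ * (α i j N * β i j N) + sq (β i j N)))
          (∑∑ L (λ i j N → sq (β i j N))) (# (double (suc m))) (odd m) (sq (E² (suc m) L f)) compare)))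
      where
      K : ℕ → ℚ
      K d = 1ℤ / 81 * pow (# 81) d
      0≤K : ∀ d → 0ℚ ≤ K d
      0≤K d = nonNegative⁻¹ (1ℤ / 81) ⊗ 0≤pow d (0≤# 81)
      α β : Fin n → Fin n → List (Fin n) → ℚ
      α i j N = E² m N (A i j f)
      β i j N = E² m N (B i j f)
      scale : ∀ p → p ≡ 1ℤ / 81 * p * (# 9 * # 9)
      scale = solve-∀ ring
      bound-b : ∀ d → Deg d f → ∀ i j N → length N ≡ double m → E⁴ m N (B i j f) ≤ K d * sq (β i j N)
      bound-b zero    deg i j N lenN = subst (_≤ K 0 * sq (β i j N)) (sym (E⁴-B-constant m N i j f deg))
        (0≤K 0 ⊗ 0≤sq (β i j N))
      bound-b (suc d) deg i j N lenN = subst (λ c → E⁴ m N (B i j f) ≤ c * sq (β i j N))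
        (unscale (pow (# 81) d))
        (fourth-moment m d {N} (B i j f) (deg i j) lenN)
        where
        unscale : ∀ p → p ≡ 1ℤ / 81 * (# 81 * p)
        unscale = solve-∀ ring
      compare :
        ∑∑ L (λ i j N → sq (# 9) * sq (α i j N) + # 6 * # 9 * (α i j N * β i j N) + sq (β i j N)) ≡
        # 81 * ∑∑ L (λ i j N → sq (α i j N) + ⅔ * (α i j N * β i j N) + sq (β i j N)) +
        - # 80 * ∑∑ L (λ i j N → sq (β i j N))
      compare = trans
        (∑∑-cong L (λ i j N _ → identity (α i j N) (β i j N)))
        (∑∑-linear L (# 81) (- # 80) (λ i j N → sq (α i j N) + ⅔ * (α i j N * β i j N) + sq (β i j N))
          (λ i j N → sq (β i j N)))
        where
        identity : ∀ a b → # 9 * # 9 * (a * a) + # 6 * # 9 * (a * b) + b * b ≡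
          # 81 * (a * a + ⅔ * (a * b) + b * b) + - # 80 * (b * b)
        identity = solve-∀ ring
      gap : ∀ p s v n o e {t} → t ≡ # 81 * s + - # 80 * v →
        n * (o * (p * e)) - 1ℤ / 81 * p * t ≡ p * (n * (o * e) - s) + 1ℤ / 81 * p * (# 80 * v)
      gap p s v n o e refl = identity p s v n o e
        where
        identity : ∀ p s v n o e → n * (o * (p * e)) - 1ℤ / 81 * p * (# 81 * s + - # 80 * v) ≡
          p * (n * (o * e) - s) + 1ℤ / 81 * p * (# 80 * v)
        identity = solve-∀ ring

  -- The slice

  -- The value at the predecessor, or 0 when the supply of signs is exhausted. Since `δ` is built
  -- from it too, adding a sign to a vector matches the recursion of `patternSum` by computation.
  lower : ℕ → (ℕ → ℚ) → ℚ
  lower zero    φ = 0ℚ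
  lower (suc k) φ = φ k

  lower-cong : ∀ k {φ ψ} → (∀ j → φ j ≡ ψ j) → lower k φ ≡ lower k ψ
  lower-cong zero    eq = refl
  lower-cong (suc k) eq = eq k

  lower-linear : ∀ k c d φ ψ → lower k (λ j → c * φ j + d * ψ j) ≡ c * lower k φ + d * lower k ψ
  lower-linear zero    c d φ ψ = sym (identity c d)
    where
    identity : ∀ c d → c * 0ℚ + d * 0ℚ ≡ 0ℚ
    identity = solve-∀ ring
  lower-linear (suc k) c d φ ψ = refl

  δ : ℕ → ℕ → ℚ
  δ zero    zero    = 1ℚ
  δ zero    (suc b) = 0ℚ
  δ (suc a) b       = lower b (δ a)

  module _ {n : ℕ} where

    -- The sum of F over the sign patterns on L with p plus and q minus signs.
    patternSum : ℕ → ℕ → List (Fin n) → Fun n → Fun n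
    patternSum p q []      F x = δ 0 p * δ 0 q * F x
    patternSum p q (i ∷ L) F x =
      lower p (λ p′ → patternSum p′ q L F (shift ⊹ i x)) +
      lower q (λ q′ → patternSum p q′ L F (shift ⊖ i x))

    patternSum-linear : ∀ p q L c d F G x →
      patternSum p q L (λ y → c * F y + d * G y) x ≡ c * patternSum p q L F x + d * patternSum p q L G x
    patternSum-linear p q []      c d F G x = identity (δ 0 p * δ 0 q) c d (F x) (G x)
      where
      identity : ∀ e c d a b → e * (c * a + d * b) ≡ c * (e * a) + d * (e * b)
      identity = solve-∀ ring
    patternSum-linear p q (i ∷ L) c d F G x = trans
      (cong₂ _+_
        (trans (lower-cong p (λ p′ → patternSum-linear p′ q L c d F G (shift ⊹ i x)))
          (lower-linear p c d (λ p′ → patternSum p′ q L F (shift ⊹ i x)) (λ p′ → patternSum p′ q L G (shift ⊹ i x))))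
        (trans (lower-cong q (λ q′ → patternSum-linear p q′ L c d F G (shift ⊖ i x)))
          (lower-linear q c d (λ q′ → patternSum p q′ L F (shift ⊖ i x)) (λ q′ → patternSum p q′ L G (shift ⊖ i x)))))
      (identity c d (lower p (λ p′ → patternSum p′ q L F (shift ⊹ i x))) (lower p (λ p′ → patternSum p′ q L G (shift ⊹ i x)))
                    (lower q (λ q′ → patternSum p q′ L F (shift ⊖ i x))) (lower q (λ q′ → patternSum p q′ L G (shift ⊖ i x))))
      where
      identity : ∀ c d a b a′ b′ → (c * a + d * b) + (c * a′ + d * b′) ≡ c * (a + a′) + d * (b + b′)
      identity = solve-∀ ring

    patternSum-shift : ∀ p q L F s i x →
      patternSum p q L (λ y → F (shift s i y)) x ≡ patternSum p q L F (shift s i x)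
    patternSum-shift p q []      F s i x = refl
    patternSum-shift p q (k ∷ L) F s i x = cong₂ _+_
      (lower-cong p (λ p′ → trans (patternSum-shift p′ q L F s i (shift ⊹ k x))
        (cong (patternSum p′ q L F) (shift-comm s i ⊹ k x))))
      (lower-cong q (λ q′ → trans (patternSum-shift p q′ L F s i (shift ⊖ k x))
        (cong (patternSum p q′ L F) (shift-comm s i ⊖ k x))))

    patternSum-A : ∀ p q L i k F x → patternSum p q L (A i k F) x ≡
      ½ * patternSum p q L F (shift ⊖ k (shift ⊹ i x)) + ½ * patternSum p q L F (shift ⊹ k (shift ⊖ i x))
    patternSum-A p q L i k F x = trans
      (trans (patternSum-cong p q L expand x)
        (patternSum-linear p q L ½ ½ (λ y → F (shift ⊹ i (shift ⊖ k y))) (λ y → F (shift ⊖ i (shift ⊹ k y))) x))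
      (cong₂ (λ a b → ½ * a + ½ * b) (move ⊹ ⊖) (move ⊖ ⊹))
      where
      expand : ∀ y → A i k F y ≡ ½ * F (shift ⊹ i (shift ⊖ k y)) + ½ * F (shift ⊖ i (shift ⊹ k y))
      expand y = identity (F (shift ⊹ i (shift ⊖ k y))) (F (shift ⊖ i (shift ⊹ k y)))
        where
        identity : ∀ a b → ½ * (a + 1ℚ * b) ≡ ½ * a + ½ * b
        identity = solve-∀ ring
      patternSum-cong : ∀ p q L {F G : Fun n} → F ≗ G → patternSum p q L F ≗ patternSum p q L G
      patternSum-cong p q []      F≗G x = cong (δ 0 p * δ 0 q *_) (F≗G x)
      patternSum-cong p q (i ∷ L) F≗G x = cong₂ _+_
        (lower-cong p (λ p′ → patternSum-cong p′ q L F≗G (shift ⊹ i x)))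
        (lower-cong q (λ q′ → patternSum-cong p q′ L F≗G (shift ⊖ i x)))
      move : ∀ s s′ → patternSum p q L (λ y → F (shift s i (shift s′ k y))) x ≡
                      patternSum p q L F (shift s′ k (shift s i x))
      move s s′ = trans (patternSum-shift p q L (λ y → F (shift s i y)) s′ k x)
        (trans (patternSum-shift p q L F s i (shift s′ k x))
          (cong (patternSum p q L F) (shift-comm s i s′ k x)))

    -- A pattern with q + 1 minus signs arises from q + 1 choices of one of them.
    choose-minus : ∀ p q L F x →
      ∑ L (λ k M → patternSum p q M F (shift ⊖ k x)) ≡ # (suc q) * patternSum p (suc q) L F x
    choose-minus p q []      F x = sym (identity (# (suc q)) (δ 0 p) (F x))
      where
      identity : ∀ k d a → k * (d * 0ℚ * a) ≡ 0ℚ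
      identity = solve-∀ ring
    choose-minus p q (i ∷ L) F x = begin
      s + ∑ L (λ k M → lower p (λ p′ → patternSum p′ q M F (shift ⊹ i (shift ⊖ k x))) +
                       lower q (λ q′ → patternSum p q′ M F (shift ⊖ i (shift ⊖ k x))))
        ≡⟨ cong (s +_) (∑-+ L _ (λ k M → lower q (λ q′ → patternSum p q′ M F (shift ⊖ i (shift ⊖ k x))))) ⟩
      s + (∑ L (λ k M → lower p (λ p′ → patternSum p′ q M F (shift ⊹ i (shift ⊖ k x)))) +
           ∑ L (λ k M → lower q (λ q′ → patternSum p q′ M F (shift ⊖ i (shift ⊖ k x)))))
        ≡⟨ cong (s +_) (cong₂ _+_ (plus-part p) (minus-part q)) ⟩
      s + (# (suc q) * r + # q * s)
        ≡⟨ identity s r (# q) (# (suc q)) (#-suc q) ⟩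
      # (suc q) * (r + s) ∎
      where
      open ≡-Reasoning
      r = lower p (λ p′ → patternSum p′ (suc q) L F (shift ⊹ i x))
      s = patternSum p q L F (shift ⊖ i x)
      plus-part : ∀ p → ∑ L (λ k M → lower p (λ p′ → patternSum p′ q M F (shift ⊹ i (shift ⊖ k x)))) ≡
                  # (suc q) * lower p (λ p′ → patternSum p′ (suc q) L F (shift ⊹ i x))
      plus-part zero    = trans (∑-0 L) (sym (*-zeroʳ (# (suc q))))
      plus-part (suc p) = trans
        (∑-cong L (λ k M _ → cong (patternSum p q M F) (shift-comm ⊹ i ⊖ k x)))
        (choose-minus p q L F (shift ⊹ i x))
      minus-part : ∀ q → ∑ L (λ k M → lower q (λ q′ → patternSum p q′ M F (shift ⊖ i (shift ⊖ k x)))) ≡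
                   # q * patternSum p q L F (shift ⊖ i x)
      minus-part zero    = trans (∑-0 L) (sym (*-zeroˡ (patternSum p 0 L F (shift ⊖ i x))))
      minus-part (suc q) = trans
        (∑-cong L (λ k M _ → cong (patternSum p q M F) (shift-comm ⊖ i ⊖ k x)))
        (choose-minus p q L F (shift ⊖ i x))
      identity : ∀ s r q q′ → q′ ≡ 1ℚ + q → s + (q′ * r + q * s) ≡ q′ * (r + s)
      identity s r q _ refl = solved s r q
        where
        solved : ∀ s r q → s + ((1ℚ + q) * r + q * s) ≡ (1ℚ + q) * (r + s)
        solved = solve-∀ ring

    choose-plus : ∀ p q L F x →
      ∑ L (λ k M → patternSum p q M F (shift ⊹ k x)) ≡ # (suc p) * patternSum (suc p) q L F x
    choose-plus p q []      F x = sym (identity (# (suc p)) (δ 0 q) (F x))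
      where
      identity : ∀ k d a → k * (0ℚ * d * a) ≡ 0ℚ
      identity = solve-∀ ring
    choose-plus p q (i ∷ L) F x = begin
      s + ∑ L (λ k M → lower p (λ p′ → patternSum p′ q M F (shift ⊹ i (shift ⊹ k x))) +
                       lower q (λ q′ → patternSum p q′ M F (shift ⊖ i (shift ⊹ k x))))
        ≡⟨ cong (s +_) (∑-+ L _ (λ k M → lower q (λ q′ → patternSum p q′ M F (shift ⊖ i (shift ⊹ k x))))) ⟩
      s + (∑ L (λ k M → lower p (λ p′ → patternSum p′ q M F (shift ⊹ i (shift ⊹ k x)))) +
           ∑ L (λ k M → lower q (λ q′ → patternSum p q′ M F (shift ⊖ i (shift ⊹ k x)))))
        ≡⟨ cong (s +_) (cong₂ _+_ (plus-part p) (minus-part q)) ⟩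
      s + (# p * s + # (suc p) * r)
        ≡⟨ identity s r (# p) (# (suc p)) (#-suc p) ⟩
      # (suc p) * (s + r) ∎
      where
      open ≡-Reasoning
      r = lower q (λ q′ → patternSum (suc p) q′ L F (shift ⊖ i x))
      s = patternSum p q L F (shift ⊹ i x)
      plus-part : ∀ p → ∑ L (λ k M → lower p (λ p′ → patternSum p′ q M F (shift ⊹ i (shift ⊹ k x)))) ≡
                  # p * patternSum p q L F (shift ⊹ i x)
      plus-part zero    = trans (∑-0 L) (sym (*-zeroˡ (patternSum 0 q L F (shift ⊹ i x))))
      plus-part (suc p) = trans
        (∑-cong L (λ k M _ → cong (patternSum p q M F) (shift-comm ⊹ i ⊹ k x)))
        (choose-plus p q L F (shift ⊹ i x))
      minus-part : ∀ q → ∑ L (λ k M → lower q (λ q′ → patternSum p q′ M F (shift ⊖ i (shift ⊹ k x)))) ≡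
                   # (suc p) * lower q (λ q′ → patternSum (suc p) q′ L F (shift ⊖ i x))
      minus-part zero    = trans (∑-0 L) (sym (*-zeroʳ (# (suc p))))
      minus-part (suc q) = trans
        (∑-cong L (λ k M _ → cong (patternSum p q M F) (shift-comm ⊖ i ⊹ k x)))
        (choose-plus p q L F (shift ⊖ i x))
      identity : ∀ s r p p′ → p′ ≡ 1ℚ + p → s + (p * s + p′ * r) ≡ p′ * (s + r)
      identity s r p _ refl = solved s r p
        where
        solved : ∀ s r p → s + (p * s + (1ℚ + p) * r) ≡ (1ℚ + p) * (s + r)
        solved = solve-∀ ring

    -- The reciprocal of the number of balanced sign patterns on 2m coordinates.
    weight : ℕ → ℚ
    weight zero    = 1ℚ
    weight (suc m) = odd⁻¹ m * (½ * (# (suc m) * weight m))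

    -- In a balanced pattern on 2m + 2 coordinates the first entry has m + 1 possible partners of
    -- opposite sign. This number is the same for all patterns, so the random matching produces the
    -- uniform distribution.
    E-patternSum : ∀ m L F → length L ≡ double m →
      E m L F ≡ weight m * patternSum m m L F (replicate n 0ℚ)
    E-patternSum zero    []      F len = sym (identity (F (replicate n 0ℚ)))
      where
      identity : ∀ a → 1ℚ * (1ℚ * 1ℚ * a) ≡ a
      identity = solve-∀ ring
    E-patternSum (suc m) (i ∷ L) F len = begin
      odd⁻¹ m * ∑ L (λ k M → E m M (A i k F))
        ≡⟨ cong (odd⁻¹ m *_) (∑-cong L (λ k M p → trans
             (E-patternSum m M (A i k F) (length-tail (ℕₚ.suc-injective len) p))
             (trans (cong (weight m *_) (patternSum-A m m M i k F x₀))
               (distribute (weight m) (patternSum m m M F (shift ⊖ k (shift ⊹ i x₀)))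
                                      (patternSum m m M F (shift ⊹ k (shift ⊖ i x₀))))))) ⟩
      odd⁻¹ m * ∑ L (λ k M → ½ * weight m * patternSum m m M F (shift ⊖ k (shift ⊹ i x₀)) +
                             ½ * weight m * patternSum m m M F (shift ⊹ k (shift ⊖ i x₀)))
        ≡⟨ cong (odd⁻¹ m *_) (∑-linear L (½ * weight m) (½ * weight m)
             (λ k M → patternSum m m M F (shift ⊖ k (shift ⊹ i x₀)))
             (λ k M → patternSum m m M F (shift ⊹ k (shift ⊖ i x₀)))) ⟩
      odd⁻¹ m * (½ * weight m * ∑ L (λ k M → patternSum m m M F (shift ⊖ k (shift ⊹ i x₀))) +
                 ½ * weight m * ∑ L (λ k M → patternSum m m M F (shift ⊹ k (shift ⊖ i x₀))))
        ≡⟨ cong₂ (λ a b → odd⁻¹ m * (½ * weight m * a + ½ * weight m * b))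
             (choose-minus m m L F (shift ⊹ i x₀)) (choose-plus m m L F (shift ⊖ i x₀)) ⟩
      odd⁻¹ m * (½ * weight m * (# (suc m) * patternSum m (suc m) L F (shift ⊹ i x₀)) +
                 ½ * weight m * (# (suc m) * patternSum (suc m) m L F (shift ⊖ i x₀)))
        ≡⟨ collect (odd⁻¹ m) (weight m) (# (suc m)) (patternSum m (suc m) L F (shift ⊹ i x₀))
             (patternSum (suc m) m L F (shift ⊖ i x₀)) ⟩
      odd⁻¹ m * (½ * (# (suc m) * weight m)) *
        (patternSum m (suc m) L F (shift ⊹ i x₀) + patternSum (suc m) m L F (shift ⊖ i x₀)) ∎
      where
      open ≡-Reasoning
      x₀ = replicate n 0ℚ
      distribute : ∀ w a b → w * (½ * a + ½ * b) ≡ ½ * w * a + ½ * w * b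
      distribute = solve-∀ ring
      collect : ∀ o w c a b → o * (½ * w * (c * a) + ½ * w * (c * b)) ≡ o * (½ * (c * w)) * (a + b)
      collect = solve-∀ ring

    E-1 : ∀ m L → length L ≡ double m → E {n} m L (λ _ → 1ℚ) ≡ 1ℚ
    E-1 zero    L       len = refl
    E-1 (suc m) (i ∷ L) len = begin
      odd⁻¹ m * ∑ L (λ k M → E m M (λ _ → ½ * (1ℚ + 1ℚ * 1ℚ)))
        ≡⟨ cong (odd⁻¹ m *_) (∑-cong L (λ k M p → E-1 m M (length-tail (ℕₚ.suc-injective len) p))) ⟩
      odd⁻¹ m * ∑ L (λ _ _ → 1ℚ)
        ≡⟨ cong (odd⁻¹ m *_) (trans (∑-const L 1ℚ) (cong (λ l → # l * 1ℚ) (ℕₚ.suc-injective len))) ⟩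
      odd⁻¹ m * (odd m * 1ℚ)
        ≡⟨ trans (cong (odd⁻¹ m *_) (*-identityʳ (odd m)))
             (trans (*-comm (odd⁻¹ m) (odd m)) (odd*odd⁻¹ m)) ⟩
      1ℚ ∎
      where open ≡-Reasoning

  -- Comparison with the list of balanced sign vectors

  sumℚ : List ℚ → ℚ
  sumℚ = List.foldr _+_ 0ℚ

  sumℚ-++ : ∀ ps qs → sumℚ (ps List.++ qs) ≡ sumℚ ps + sumℚ qs
  sumℚ-++ []       qs = sym (+-identityˡ (sumℚ qs))
  sumℚ-++ (p ∷ ps) qs = trans (cong (p +_) (sumℚ-++ ps qs)) (sym (+-assoc p (sumℚ ps) (sumℚ qs)))

  sum-cube : ∀ n (φ : Vec Sign (suc n) → ℚ) → sumℚ (List.map φ (cube (suc n))) ≡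
    sumℚ (List.map (λ x → φ (⊹ ∷ x)) (cube n)) + sumℚ (List.map (λ x → φ (⊖ ∷ x)) (cube n))
  sum-cube n φ = begin
    sumℚ (List.map φ (List.map (⊹ ∷_) (cube n) List.++ (List.map (⊖ ∷_) (cube n) List.++ [])))
      ≡⟨ cong (λ xs → sumℚ (List.map φ (List.map (⊹ ∷_) (cube n) List.++ xs)))
           (Listₚ.++-identityʳ (List.map (⊖ ∷_) (cube n))) ⟩
    sumℚ (List.map φ (List.map (⊹ ∷_) (cube n) List.++ List.map (⊖ ∷_) (cube n)))
      ≡⟨ cong sumℚ (Listₚ.map-++ φ (List.map (⊹ ∷_) (cube n)) (List.map (⊖ ∷_) (cube n))) ⟩
    sumℚ (List.map φ (List.map (⊹ ∷_) (cube n)) List.++ List.map φ (List.map (⊖ ∷_) (cube n)))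
      ≡⟨ sumℚ-++ (List.map φ (List.map (⊹ ∷_) (cube n))) (List.map φ (List.map (⊖ ∷_) (cube n))) ⟩
    sumℚ (List.map φ (List.map (⊹ ∷_) (cube n))) + sumℚ (List.map φ (List.map (⊖ ∷_) (cube n)))
      ≡⟨ cong₂ (λ ps qs → sumℚ ps + sumℚ qs) (Listₚ.map-∘ (cube n)) (Listₚ.map-∘ (cube n)) ⟨
    sumℚ (List.map (λ x → φ (⊹ ∷ x)) (cube n)) + sumℚ (List.map (λ x → φ (⊖ ∷ x)) (cube n)) ∎
    where open ≡-Reasoning

  pluses minuses : ∀ {n} → Vec Sign n → ℕ
  pluses []       = 0
  pluses (⊹ ∷ x)  = suc (pluses x)
  pluses (⊖ ∷ x)  = pluses x
  minuses []      = 0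
  minuses (⊹ ∷ x) = minuses x
  minuses (⊖ ∷ x) = suc (minuses x)

  δ-refl : ∀ a → δ a a ≡ 1ℚ
  δ-refl zero    = refl
  δ-refl (suc a) = δ-refl a

  δ-≢ : ∀ a b → a ≢ b → δ a b ≡ 0ℚ
  δ-≢ zero    zero    a≢b = ⊥-elim (a≢b refl)
  δ-≢ zero    (suc b) a≢b = refl
  δ-≢ (suc a) zero    a≢b = refl
  δ-≢ (suc a) (suc b) a≢b = δ-≢ a b (λ a≡b → a≢b (cong suc a≡b))

  indices : ∀ n → List (Fin n)
  indices zero    = []
  indices (suc n) = zero ∷ List.map suc (indices n)

  length-indices : ∀ n → length (indices n) ≡ n
  length-indices zero    = refl
  length-indices (suc n) = cong suc (trans (Listₚ.length-map suc (indices n)) (length-indices n))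

  toPoint : ∀ {n} → Vec Sign n → Vec ℚ n
  toPoint = Vec.map sgn

  opaque
    unfolding shift

    patternSum-suc : ∀ {n} p q L (F : Fun (suc n)) c x →
      patternSum p q (List.map suc L) F (c ∷ x) ≡ patternSum p q L (λ y → F (c ∷ y)) x
    patternSum-suc p q []      F c x = refl
    patternSum-suc p q (i ∷ L) F c x = cong₂ _+_
      (lower-cong p (λ p′ → patternSum-suc p′ q L F c (shift ⊹ i x)))
      (lower-cong q (λ q′ → patternSum-suc p q′ L F c (shift ⊖ i x)))

    patternSum-zero : ∀ {n} p q L (F : Fun (suc n)) x →
      patternSum p q (zero ∷ List.map suc L) F (0ℚ ∷ x) ≡
      lower p (λ p′ → patternSum p′ q L (λ y → F (1ℚ ∷ y)) x) +
      lower q (λ q′ → patternSum p q′ L (λ y → F (- 1ℚ ∷ y)) x)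
    patternSum-zero p q L F x = cong₂ _+_
      (lower-cong p (λ p′ → patternSum-suc p′ q L F 1ℚ x))
      (lower-cong q (λ q′ → patternSum-suc p q′ L F (- 1ℚ) x))

  patternSum-cube : ∀ n p q (F : Fun n) →
    sumℚ (List.map (λ x → δ (pluses x) p * δ (minuses x) q * F (toPoint x)) (cube n)) ≡
    patternSum p q (indices n) F (replicate n 0ℚ)
  patternSum-cube zero    p q F = +-identityʳ (δ 0 p * δ 0 q * F [])
  patternSum-cube (suc n) p q F = trans
    (sum-cube n (λ x → δ (pluses x) p * δ (minuses x) q * F (toPoint x)))
    (trans (cong₂ _+_ (plus-part p) (minus-part q))
      (sym (patternSum-zero p q (indices n) F (replicate n 0ℚ))))
    where
    sum-zero : ∀ (φ : Vec Sign n → ℚ) → (∀ x → φ x ≡ 0ℚ) → ∀ xs → sumℚ (List.map φ xs) ≡ 0ℚ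
    sum-zero φ φ≡0 []       = refl
    sum-zero φ φ≡0 (x ∷ xs) = cong₂ _+_ (φ≡0 x) (sum-zero φ φ≡0 xs)
    zero-first : ∀ b a → 0ℚ * b * a ≡ 0ℚ
    zero-first = solve-∀ ring
    zero-second : ∀ b a → b * 0ℚ * a ≡ 0ℚ
    zero-second = solve-∀ ring
    plus-part : ∀ p →
      sumℚ (List.map (λ x → lower p (δ (pluses x)) * δ (minuses x) q * F (1ℚ ∷ toPoint x)) (cube n)) ≡
      lower p (λ p′ → patternSum p′ q (indices n) (λ y → F (1ℚ ∷ y)) (replicate n 0ℚ))
    plus-part zero    = sum-zero _ (λ x → zero-first (δ (minuses x) q) (F (1ℚ ∷ toPoint x))) (cube n)
    plus-part (suc p) = patternSum-cube n p q (λ y → F (1ℚ ∷ y))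
    minus-part : ∀ q →
      sumℚ (List.map (λ x → δ (pluses x) p * lower q (δ (minuses x)) * F (- 1ℚ ∷ toPoint x)) (cube n)) ≡
      lower q (λ q′ → patternSum p q′ (indices n) (λ y → F (- 1ℚ ∷ y)) (replicate n 0ℚ))
    minus-part zero    = sum-zero _ (λ x → zero-second (δ (pluses x) p) (F (- 1ℚ ∷ toPoint x))) (cube n)
    minus-part (suc q) = patternSum-cube n p q (λ y → F (- 1ℚ ∷ y))

  pluses+minuses : ∀ {n} (x : Vec Sign n) → pluses x ℕ.+ minuses x ≡ n
  pluses+minuses []      = refl
  pluses+minuses (⊹ ∷ x) = cong suc (pluses+minuses x)
  pluses+minuses (⊖ ∷ x) = trans (ℕₚ.+-suc (pluses x) (minuses x)) (cong suc (pluses+minuses x))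

  sumℤ-⊖ : ∀ {n} (x : Vec Sign n) → sumℤ x ≡ pluses x ℤ.⊖ minuses x
  sumℤ-⊖ []      = refl
  sumℤ-⊖ (⊹ ∷ x) = trans (cong (λ z → 1ℤ ℤ.+ z) (sumℤ-⊖ x)) (ℤₚ.distribʳ-⊖-+-pos 1 (pluses x) (minuses x))
  sumℤ-⊖ (⊖ ∷ x) = trans (cong (λ z → ℤ.-[1+ 0 ] ℤ.+ z) (sumℤ-⊖ x)) (ℤₚ.distribʳ-⊖-+-neg 0 (pluses x) (minuses x))

  double-+ : ∀ m → double m ≡ m ℕ.+ m
  double-+ zero    = refl
  double-+ (suc m) = cong suc (trans (cong suc (double-+ m)) (sym (ℕₚ.+-suc m m)))

  double-injective : ∀ {a b} → double a ≡ double b → a ≡ b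
  double-injective {zero}  {zero}  eq = refl
  double-injective {suc a} {suc b} eq =
    cong suc (double-injective (ℕₚ.suc-injective (ℕₚ.suc-injective eq)))

  module _ {n m : ℕ} (n≡2m : n ≡ double m) where

    balanced-weight : (x : Vec Sign n) → Balanced x → δ (pluses x) m * δ (minuses x) m ≡ 1ℚ
    balanced-weight x bal = cong₂ _*_ (trans (cong (λ k → δ k m) p≡m) (δ-refl m))
                                      (trans (cong (λ k → δ k m) (trans (sym p≡q) p≡m)) (δ-refl m))
      where
      p≡q : pluses x ≡ minuses x
      p≡q = ℤₚ.+-injective (ℤₚ.i-j≡0⇒i≡j (ℤ.+ pluses x) (ℤ.+ minuses x)
        (trans (ℤₚ.m-n≡m⊖n (pluses x) (minuses x)) (trans (sym (sumℤ-⊖ x)) bal)))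
      p≡m : pluses x ≡ m
      p≡m = double-injective (trans (double-+ (pluses x))
        (trans (cong (pluses x ℕ.+_) p≡q) (trans (pluses+minuses x) n≡2m)))

    unbalanced-weight : (x : Vec Sign n) → ¬ Balanced x → δ (pluses x) m * δ (minuses x) m ≡ 0ℚ
    unbalanced-weight x unbal with pluses x ℕₚ.≟ m | minuses x ℕₚ.≟ m
    ... | no p≢m | _ = trans (cong (_* δ (minuses x) m) (δ-≢ (pluses x) m p≢m)) (*-zeroˡ (δ (minuses x) m))
    ... | yes _  | no q≢m = trans (cong (δ (pluses x) m *_) (δ-≢ (minuses x) m q≢m)) (*-zeroʳ (δ (pluses x) m))
    ... | yes p≡m | yes q≡m = ⊥-elim (unbal (trans (sumℤ-⊖ x)
            (trans (cong₂ ℤ._⊖_ p≡m q≡m) (ℤₚ.n⊖n≡0 m))))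

    -- A vector of length 2m is balanced exactly when it has m signs of each kind, so the two `δ`
    -- factors form the indicator of the slice and the filter becomes a weighted sum over all
    -- vectors.
    sum-balanced : ∀ (φ : Vec Sign n → ℚ) xs → sumℚ (List.map φ (List.filter balanced? xs)) ≡
      sumℚ (List.map (λ x → δ (pluses x) m * δ (minuses x) m * φ x) xs)
    sum-balanced φ []       = refl
    sum-balanced φ (x ∷ xs) = step (balanced? x)
      where
      step : Dec (Balanced x) → sumℚ (List.map φ (List.filter balanced? (x ∷ xs))) ≡
        sumℚ (List.map (λ x → δ (pluses x) m * δ (minuses x) m * φ x) (x ∷ xs))
      step (yes bal) = trans
        (cong (λ ys → sumℚ (List.map φ ys)) (Listₚ.filter-accept balanced? {x} {xs} bal))
        (cong₂ _+_ (trans (sym (*-identityˡ (φ x))) (cong (_* φ x) (sym (balanced-weight x bal))))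
          (sum-balanced φ xs))
      step (no unbal) = trans
        (cong (λ ys → sumℚ (List.map φ ys)) (Listₚ.filter-reject balanced? {x} {xs} unbal))
        (trans (sum-balanced φ xs) (trans (sym (+-identityˡ _))
          (cong (_+ sumℚ (List.map (λ x → δ (pluses x) m * δ (minuses x) m * φ x) xs))
            (trans (sym (*-zeroˡ (φ x))) (cong (_* φ x) (sym (unbalanced-weight x unbal)))))))

    sumSlice : Fun n → ℚ
    sumSlice F = sumℚ (List.map (λ x → F (toPoint x)) (slice n))

    length-2m : length (indices n) ≡ double m
    length-2m = trans (length-indices n) n≡2m

    E-sumSlice : ∀ F → E m (indices n) F ≡ weight {n} m * sumSlice F
    E-sumSlice F = trans (E-patternSum m (indices n) F length-2m)
      (cong (weight {n} m *_) (sym (trans (sum-balanced (λ x → F (toPoint x)) (cube n)) (patternSum-cube n m m F))))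

    -- The size of the slice is not computed as a binomial coefficient: the constant function 1 has
    -- mean 1, so the weight times the length of the list is 1.
    slice-mean : .{{_ : ℕ.NonZero (length (slice n))}} → ∀ F →
      1ℤ / length (slice n) * sumSlice F ≡ E m (indices n) F
    slice-mean F = trans (cong (_* sumSlice F) (sym weight≡)) (sym (E-sumSlice F))
      where
      sum-1 : ∀ {A : Set} (xs : List A) → sumℚ (List.map (λ _ → 1ℚ) xs) ≡ # (length xs)
      sum-1 []       = refl
      sum-1 (x ∷ xs) = trans (cong (1ℚ +_) (sum-1 xs)) (sym (#-suc (length xs)))
      w*len : weight {n} m * # (length (slice n)) ≡ 1ℚ
      w*len = trans (cong (weight {n} m *_) (sym (sum-1 (slice n))))
        (trans (sym (E-sumSlice (λ _ → 1ℚ))) (E-1 m (indices n) length-2m))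
      weight≡ : weight {n} m ≡ 1ℤ / length (slice n)
      weight≡ = begin
        weight {n} m
          ≡⟨ *-identityʳ (weight {n} m) ⟨
        weight {n} m * 1ℚ
          ≡⟨ cong (weight {n} m *_) (sym (#-inverse (length (slice n)))) ⟩
        weight {n} m * (# (length (slice n)) * (1ℤ / length (slice n)))
          ≡⟨ *-assoc (weight {n} m) (# (length (slice n))) (1ℤ / length (slice n)) ⟨
        weight {n} m * # (length (slice n)) * (1ℤ / length (slice n))
          ≡⟨ trans (cong (_* (1ℤ / length (slice n))) w*len) (*-identityˡ (1ℤ / length (slice n))) ⟩
        1ℤ / length (slice n) ∎
        where open ≡-Reasoning

    slice-fourth-moment : .{{_ : ℕ.NonZero (length (slice n))}} → ∀ d F → Deg d F →
      1ℤ / length (slice n) * sumSlice (λ x → sq (sq (F x))) ≤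
      pow (# 81) d * sq (1ℤ / length (slice n) * sumSlice (λ x → sq (F x)))
    slice-fourth-moment d F deg = subst₂ _≤_
      (sym (slice-mean (λ x → sq (sq (F x)))))
      (cong (λ e → pow (# 81) d * sq e) (sym (slice-mean (λ x → sq (F x)))))
      (fourth-moment m d {indices n} F deg length-2m)

  -- Degree of multilinear polynomials in terms of differences

  Deg-suc : ∀ {n} d {f : Fun n} → Deg d f → Deg (suc d) f
  Deg-suc zero    deg i j k l x = cong₂ (λ p q → ½ * (p + - 1ℚ * q)) (deg i j _) (deg i j _)
  Deg-suc (suc d) deg i j = Deg-suc d (deg i j)

  Deg-mono : ∀ {n k d} {f : Fun n} → k ℕ.≤′ d → Deg k f → Deg d f
  Deg-mono (ℕ.≤′-reflexive refl) deg = deg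
  Deg-mono {d = suc d} {f} (ℕ.≤′-step k≤d) deg = Deg-suc d {f} (Deg-mono {f = f} k≤d deg)

  Deg-linear : ∀ {n} d c e {f g : Fun n} → Deg d f → Deg d g → Deg d (λ x → c * f x + e * g x)
  Deg-linear zero    c e {f} {g} deg-f deg-g i j x = trans (D-linear (- 1ℚ) i j c e f g x)
    (trans (cong₂ (λ p q → c * p + e * q) (deg-f i j x) (deg-g i j x)) (vanish c e))
    where
    vanish : ∀ c e → c * 0ℚ + e * 0ℚ ≡ 0ℚ
    vanish = solve-∀ ring
  Deg-linear (suc d) c e {f} {g} deg-f deg-g i j =
    Deg-cong d (λ x → sym (D-linear (- 1ℚ) i j c e f g x)) (Deg-linear d c e (deg-f i j) (deg-g i j))

  Deg-constant : ∀ {n} d c → Deg {n} d (λ _ → c)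
  Deg-constant {n} d c = Deg-mono {f = λ _ → c} (ℕₚ.≤⇒≤′ (ℕ.z≤n {d})) (λ i j x → vanish c)
    where
    vanish : ∀ c → ½ * (c + - 1ℚ * c) ≡ 0ℚ
    vanish = solve-∀ ring

  Affine : ∀ {n} → Fun n → Set
  Affine {n} h = Σ[ c ∈ (Fin n → ℚ) ] ∀ s i x → h (shift s i x) ≡ h x + sgn s * c i

  -- The product rule: the two shifted points change `h` by cᵢ - cⱼ and by its negative, so `B i j`
  -- of the product is h · `B i j f` + (cᵢ - cⱼ) · `A i j f`.
  Deg-affine-* : ∀ {n} d {h f : Fun n} → Affine h → Deg d f → Deg (suc d) (λ x → h x * f x)
  Deg-affine-* d {h} {f} (c , affine) deg i j = Deg-cong d
    (λ x → sym (trans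
      (cong₂ (λ p q → ½ * (p * f (shift ⊹ i (shift ⊖ j x)) + - 1ℚ * (q * f (shift ⊖ i (shift ⊹ j x)))))
        (trans (affine ⊹ i (shift ⊖ j x)) (cong (_+ 1ℚ * c i) (affine ⊖ j x)))
        (trans (affine ⊖ i (shift ⊹ j x)) (cong (_+ - 1ℚ * c i) (affine ⊹ j x))))
      (identity (h x) (c i) (c j) (f (shift ⊹ i (shift ⊖ j x))) (f (shift ⊖ i (shift ⊹ j x))))))
    (Deg-linear d 1ℚ (c i - c j) (h*B d deg) (Deg-A d {f} i j deg))
    where
    identity : ∀ h ci cj p q →
      ½ * ((h + - 1ℚ * cj + 1ℚ * ci) * p + - 1ℚ * ((h + 1ℚ * cj + - 1ℚ * ci) * q)) ≡
      1ℚ * (h * (½ * (p + - 1ℚ * q))) + (ci - cj) * (½ * (p + 1ℚ * q))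
    identity = solve-∀ ring
    h*B : ∀ d → Deg d f → Deg d (λ x → h x * B i j f x)
    h*B zero    deg = Deg-cong 0 (λ x → sym (trans (cong (h x *_) (deg i j x)) (*-zeroʳ (h x)))) (Deg-constant 0 0ℚ)
    h*B (suc d) deg = Deg-affine-* d {h} (c , affine) (deg i j)

  coordinate-affine : ∀ {n} (k : Fin n) → Affine (λ x → Vec.lookup x k)
  coordinate-affine k = unit k , λ s i x → lookup-shift s i x k
    where
    unit : ∀ {n} → Fin n → Fin n → ℚ
    unit zero    zero    = 1ℚ
    unit zero    (suc i) = 0ℚ
    unit (suc k) zero    = 0ℚ
    unit (suc k) (suc i) = unit k i
    opaque
      unfolding shift
      lookup-shift : ∀ {n} s (i : Fin n) x k →
        Vec.lookup (shift s i x) k ≡ Vec.lookup x k + sgn s * unit k i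
      lookup-shift s zero    (x ∷ xs) zero    = commute (sgn s) x
        where
        commute : ∀ s x → s + x ≡ x + s * 1ℚ
        commute = solve-∀ ring
      lookup-shift s zero    (x ∷ xs) (suc k) = unchanged (sgn s) (Vec.lookup xs k)
        where
        unchanged : ∀ s x → x ≡ x + s * 0ℚ
        unchanged = solve-∀ ring
      lookup-shift s (suc i) (x ∷ xs) zero    = unchanged (sgn s) x
        where
        unchanged : ∀ s x → x ≡ x + s * 0ℚ
        unchanged = solve-∀ ring
      lookup-shift s (suc i) (x ∷ xs) (suc k) = lookup-shift s i xs k

  productℚ : ∀ {k} → Subset k → (Fin k → ℚ) → ℚ
  productℚ []      h = 1ℚ
  productℚ (b ∷ S) h = if b then h zero * productℚ S (λ i → h (suc i)) else productℚ S (λ i → h (suc i))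

  -- The factors form a family indexed independently of the coordinates, because the induction
  -- shortens `S` while the points keep their dimension.
  Deg-product : ∀ {n k} (S : Subset k) (h : Fin k → Fun n) → (∀ i → Affine (h i)) →
                Deg ∣ S ∣ˢ (λ x → productℚ S (λ i → h i x))
  Deg-product []          h affine = Deg-constant 0 1ℚ
  Deg-product (true ∷ S)  h affine = Deg-affine-* ∣ S ∣ˢ {h zero} (affine zero)
    (Deg-product S (λ i → h (suc i)) (λ i → affine (suc i)))
  Deg-product (false ∷ S) h affine = Deg-product S (λ i → h (suc i)) (λ i → affine (suc i))

  evalℚ : ∀ {n} → (Subset n → ℚ) → Fun n
  evalℚ {n} G x = sumℚ (List.map (λ S → G S * productℚ S (Vec.lookup x)) (subsets n))

  Deg-eval : ∀ {n} d (G : Subset n → ℚ) → (∀ S → d ℕ.< ∣ S ∣ˢ → G S ≡ 0ℚ) → Deg d (evalℚ G)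
  Deg-eval {n} d G degree = go (subsets n)
    where
    term : ∀ S → Deg d (λ x → G S * productℚ S (Vec.lookup x))
    term S with ∣ S ∣ˢ ℕₚ.≤? d
    ... | yes S≤d = Deg-cong d (λ x → drop-zero (G S) (productℚ S (Vec.lookup x)))
      (Deg-linear d (G S) 0ℚ deg-S deg-S)
      where
      deg-S = Deg-mono {f = λ x → productℚ S (Vec.lookup x)} (ℕₚ.≤⇒≤′ S≤d)
        (Deg-product S (λ i x → Vec.lookup x i) coordinate-affine)
      drop-zero : ∀ c p → c * p + 0ℚ * p ≡ c * p
      drop-zero = solve-∀ ring
    ... | no S≰d = Deg-cong d
      (λ x → sym (trans (cong (_* productℚ S (Vec.lookup x)) (degree S (ℕₚ.≰⇒> S≰d)))
                        (*-zeroˡ (productℚ S (Vec.lookup x)))))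
      (Deg-constant d 0ℚ)
    go : ∀ Ss → Deg d (λ x → sumℚ (List.map (λ S → G S * productℚ S (Vec.lookup x)) Ss))
    go []       = Deg-constant d 0ℚ
    go (S ∷ Ss) = Deg-cong d
      (λ x → one-one (G S * productℚ S (Vec.lookup x)) (sumℚ (List.map (λ S → G S * productℚ S (Vec.lookup x)) Ss)))
      (Deg-linear d 1ℚ 1ℚ (term S) (go Ss))
      where
      one-one : ∀ a b → 1ℚ * a + 1ℚ * b ≡ a + b
      one-one = solve-∀ ring

  -- 81^d is 9^(2d), and the remaining factor 12d is at least 1.
  pow-81-≤ : ∀ d → 1 ℕ.≤ d → pow (# 81) d ≤ # (12 ℕ.* d ℕ.* 9 ℕ.^ (2 ℕ.* d))
  pow-81-≤ d 1≤d = subst (_≤ # (12 ℕ.* d ℕ.* 9 ℕ.^ (2 ℕ.* d))) (sym (pow-# d))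
    (#-mono (subst (ℕ._≤ 12 ℕ.* d ℕ.* 9 ℕ.^ (2 ℕ.* d)) (sym (ℕₚ.^-*-assoc 9 2 d))
      (ℕₚ.m≤n*m (9 ℕ.^ (2 ℕ.* d)) (12 ℕ.* d) {{ℕ.>-nonZero (ℕₚ.≤-trans 1≤d (ℕₚ.m≤n*m d 12))}})))
    where
    pow-# : ∀ d → pow (# 81) d ≡ # (81 ℕ.^ d)
    pow-# zero    = refl
    pow-# (suc d) = trans (cong (# 81 *_) (pow-# d)) (sym (#-* 81 (81 ℕ.^ d)))

  meanℚ : ∀ {n} → 2 ∣ n → (Subset n → ℚ) → (ℚ → ℚ) → ℚ
  meanℚ {n} even G φ = (1ℤ / length (slice n)) {{slice-nonEmpty even}} *
                       sumℚ (List.map (λ x → φ (evalℚ G (toPoint x))) (slice n))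

  polynomial-fourth-moment : ∀ {n} d → 1 ℕ.≤ d → (even : 2 ∣ n) (G : Subset n → ℚ) →
    (∀ S → d ℕ.< ∣ S ∣ˢ → G S ≡ 0ℚ) →
    meanℚ even G (λ v → sq (sq v)) ≤ # (12 ℕ.* d ℕ.* 9 ℕ.^ (2 ℕ.* d)) * sq (meanℚ even G sq)
  polynomial-fourth-moment {n} d 1≤d even G degree = ≤-trans
    (slice-fourth-moment n≡2m {{slice-nonEmpty even}} d (evalℚ G) (Deg-eval d G degree))
    (*-monoʳ-≤-nonNeg (sq (meanℚ even G sq)) {{nonNegative (0≤sq (meanℚ even G sq))}} (pow-81-≤ d 1≤d))
    where
    double-* : ∀ k → k ℕ.* 2 ≡ double k
    double-* zero    = refl
    double-* (suc k) = cong (λ l → suc (suc l)) (double-* k)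
    n≡2m : n ≡ double (quotient even)
    n≡2m = trans (_∣_.equality even) (double-* (quotient even))

open RationalMoments
  using (ring; #_; sq; 0≤sq; sq-cancel-≤; sgn; ⊹; ⊖; double; sumℚ; toPoint;
         productℚ; evalℚ; meanℚ; polynomial-fourth-moment)
open import Defs

-- From rational to real coefficients

interleave : (ℕ → ℚ) → (ℕ → ℚ) → ℕ → ℚ
interleave s t zero    = s 0
interleave s t (suc n) = interleave t (λ k → s (suc k)) n

interleave-even : ∀ s t k → interleave s t (double k) ≡ s k
interleave-even s t zero    = refl
interleave-even s t (suc k) = interleave-even (λ k → s (suc k)) (λ k → t (suc k)) k

interleave-odd : ∀ s t k → interleave s t (suc (double k)) ≡ t k
interleave-odd s t k = interleave-even t (λ k → s (suc k)) k

-- The witness k is n/2 rounded down; n ≤ 2k + 1 carries a threshold for n over to k.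
interleave-entry : ∀ s t n →
  ∃[ k ] n ℕ.≤ suc (double k) × (interleave s t n ≡ s k ⊎ interleave s t n ≡ t k)
interleave-entry s t zero          = 0 , ℕ.z≤n , inj₁ refl
interleave-entry s t (suc zero)    = 0 , ℕ.s≤s ℕ.z≤n , inj₂ refl
interleave-entry s t (suc (suc n))
  with k , n≤ , entry ← interleave-entry (λ k → s (suc k)) (λ k → t (suc k)) n =
  suc k , ℕ.s≤s (ℕ.s≤s n≤) , entry

halve-≤ : ∀ N k → double N ℕ.≤ suc (double k) → N ℕ.≤ k
halve-≤ zero    k       le = ℕ.z≤n
halve-≤ (suc N) zero    (ℕ.s≤s ())
halve-≤ (suc N) (suc k) (ℕ.s≤s (ℕ.s≤s le)) = ℕ.s≤s (halve-≤ N k le)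

n≤double : ∀ n → n ℕ.≤ double n
n≤double zero    = ℕ.z≤n
n≤double (suc n) = ℕ.s≤s (ℕₚ.m≤n⇒m≤1+n (n≤double n))

⅓ : ℚ
⅓ = 1ℤ ℚ./ 3

0<⅓* : ∀ {ε} → 0ℚ ℚ.< ε → 0ℚ ℚ.< ⅓ ℚ.* ε
0<⅓* {ε} ε>0 = ℚₚ.positive⁻¹ _ {{ℚₚ.pos*pos⇒pos ⅓ ε {{ℚ.positive ε>0}}}}

-- This replaces a proof that sums, products and powers respect `≃`: those operations yield Cauchy
-- sequences, so applied to the interleaved real they have nearby values at late even and odd
-- indices, that is, along `x` and along `y`.
interleave-cauchy : ∀ x y → x ≃ y → IsCauchy (interleave (seq x) (seq y))
interleave-cauchy x y x≃y ε ε>0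
  with N₁ , x-close  ← cauchy x (⅓ ℚ.* ε) (0<⅓* ε>0)
     | N₂ , xy-close ← x≃y (⅓ ℚ.* ε) (0<⅓* ε>0) = double N , close
  where
  N = N₁ ℕ.⊔ N₂
  v = interleave (seq x) (seq y)
  near : ∀ m → double N ℕ.≤ m → ∃[ k ] N ℕ.≤ k × ℚ.∣ seq x k ℚ.- v m ∣ ℚ.< ⅓ ℚ.* ε
  near m 2N≤m with interleave-entry (seq x) (seq y) m
  ... | k , m≤ , inj₁ eq = k , halve-≤ N k (ℕₚ.≤-trans 2N≤m m≤) ,
        subst (ℚ._< ⅓ ℚ.* ε) (sym (trans (cong (λ z → ℚ.∣ seq x k ℚ.- z ∣) eq)
          (cong ℚ.∣_∣ (ℚₚ.+-inverseʳ (seq x k))))) (0<⅓* ε>0)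
  ... | k , m≤ , inj₂ eq = k , N≤k ,
        subst (λ z → ℚ.∣ seq x k ℚ.- z ∣ ℚ.< ⅓ ℚ.* ε) (sym eq) (xy-close k (ℕₚ.m⊔n≤o⇒n≤o N₁ N₂ N≤k))
    where N≤k = halve-≤ N k (ℕₚ.≤-trans 2N≤m m≤)
  close : ∀ m n → double N ℕ.≤ m → double N ℕ.≤ n → ℚ.∣ v m ℚ.- v n ∣ ℚ.< ε
  close m n 2N≤m 2N≤n
    with k , N≤k , k-near ← near m 2N≤m | l , N≤l , l-near ← near n 2N≤n = begin-strict
    ℚ.∣ v m ℚ.- v n ∣
      ≡⟨ cong ℚ.∣_∣ (split (v m) (seq x k) (seq x l) (v n)) ⟩
    ℚ.∣ (v m ℚ.- seq x k) ℚ.+ (seq x k ℚ.- seq x l) ℚ.+ (seq x l ℚ.- v n) ∣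
      ≤⟨ ℚₚ.≤-trans (ℚₚ.∣p+q∣≤∣p∣+∣q∣ ((v m ℚ.- seq x k) ℚ.+ (seq x k ℚ.- seq x l)) (seq x l ℚ.- v n))
           (ℚₚ.+-monoˡ-≤ ℚ.∣ seq x l ℚ.- v n ∣ (ℚₚ.∣p+q∣≤∣p∣+∣q∣ (v m ℚ.- seq x k) (seq x k ℚ.- seq x l))) ⟩
    ℚ.∣ v m ℚ.- seq x k ∣ ℚ.+ ℚ.∣ seq x k ℚ.- seq x l ∣ ℚ.+ ℚ.∣ seq x l ℚ.- v n ∣
      <⟨ ℚₚ.+-mono-< (ℚₚ.+-mono-<
           (subst (ℚ._< ⅓ ℚ.* ε) (∣-∣-swap (seq x k) (v m)) k-near)
           (x-close k l (ℕₚ.m⊔n≤o⇒m≤o N₁ N₂ N≤k) (ℕₚ.m⊔n≤o⇒m≤o N₁ N₂ N≤l))) l-near ⟩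
    ⅓ ℚ.* ε ℚ.+ ⅓ ℚ.* ε ℚ.+ ⅓ ℚ.* ε
      ≡⟨ thirds ε ⟩
    ε ∎
    where
    open ℚₚ.≤-Reasoning
    split : ∀ a b c d → a ℚ.- d ≡ (a ℚ.- b) ℚ.+ (b ℚ.- c) ℚ.+ (c ℚ.- d)
    split = solve-∀ ring
    thirds : ∀ e → ⅓ ℚ.* e ℚ.+ ⅓ ℚ.* e ℚ.+ ⅓ ℚ.* e ≡ e
    thirds = solve-∀ ring
    flip : ∀ a b → a ℚ.- b ≡ ℚ.- (b ℚ.- a)
    flip = solve-∀ ring
    ∣-∣-swap : ∀ a b → ℚ.∣ a ℚ.- b ∣ ≡ ℚ.∣ b ℚ.- a ∣
    ∣-∣-swap a b = trans (cong ℚ.∣_∣ (flip a b)) (ℚₚ.∣-p∣≡∣p∣ (b ℚ.- a))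

p≤∣p∣ : ∀ p → p ℚ.≤ ℚ.∣ p ∣
p≤∣p∣ p = sq-cancel-≤ (ℚₚ.0≤∣p∣ p) (ℚₚ.≤-reflexive
  (trans (sym (ℚₚ.0≤p⇒∣p∣≡p (0≤sq p))) (ℚₚ.∣p*q∣≡∣p∣*∣q∣ p p)))

seq-sum : ∀ xs k → seq (sumℝ xs) k ≡ sumℚ (List.map (λ x → seq x k) xs)
seq-sum []       k = refl
seq-sum (x ∷ xs) k = cong (seq x k ℚ.+_) (seq-sum xs k)

seq-sum-map : ∀ {A : Set} (f : A → ℝ) (φ : A → ℚ) k → (∀ a → seq (f a) k ≡ φ a) → ∀ as →
              seq (sumℝ (List.map f as)) k ≡ sumℚ (List.map φ as)
seq-sum-map f φ k eq as = trans (seq-sum (List.map f as) k)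
  (cong sumℚ (trans (sym (Listₚ.map-∘ as)) (Listₚ.map-cong eq as)))

seq-monomial : ∀ {n} (S : Subset n) (x : Vec Sign n) k →
  seq (monomial S (Vec.map (λ s → fromℤ (signToℤ s)) x)) k ≡ productℚ S (Vec.lookup (toPoint x))
seq-monomial []          []      k = refl
seq-monomial (true ∷ S)  (s ∷ x) k = cong₂ ℚ._*_ (seq-sign s) (seq-monomial S x k)
  where
  seq-sign : ∀ s → seq (fromℤ (signToℤ s)) k ≡ sgn s
  seq-sign ⊹ = refl
  seq-sign ⊖ = refl
seq-monomial (false ∷ S) (s ∷ x) k = seq-monomial S x k

module _ {n} (g : MultilinearPolynomial n) where

  coefficients : ℕ → Subset n → ℚ
  coefficients k S = seq (g S) k

  -- Real operations act term by term and the signs are constant sequences, so the k-th term is the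
  -- value of the rational polynomial formed by the k-th terms of the coefficients.
  seq-eval : ∀ x k → seq (evalSigns g x) k ≡ evalℚ (coefficients k) (toPoint x)
  seq-eval x k = seq-sum-map _ (λ S → coefficients k S ℚ.* productℚ S (Vec.lookup (toPoint x))) k
    (λ S → cong (coefficients k S ℚ.*_) (seq-monomial S x k)) (subsets n)

  seq-𝔼-pow2 : ∀ (even : 2 ∣ n) k → seq (𝔼-slice even (λ x → evalSigns g x ^ 2)) k ≡
               meanℚ even (coefficients k) sq
  seq-𝔼-pow2 even k = cong ((1ℤ ℚ./ length (slice n)) {{slice-nonEmpty even}} ℚ.*_)
    (seq-sum-map _ (λ x → sq (evalℚ (coefficients k) (toPoint x))) k
      (λ x → trans (square (seq (evalSigns g x) k)) (cong sq (seq-eval x k))) (slice n))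
    where
    square : ∀ v → v ℚ.* (v ℚ.* 1ℚ) ≡ v ℚ.* v
    square = solve-∀ ring

  seq-𝔼-pow4 : ∀ (even : 2 ∣ n) k → seq (𝔼-slice even (λ x → evalSigns g x ^ 4)) k ≡
               meanℚ even (coefficients k) (λ v → sq (sq v))
  seq-𝔼-pow4 even k = cong ((1ℤ ℚ./ length (slice n)) {{slice-nonEmpty even}} ℚ.*_)
    (seq-sum-map _ (λ x → sq (sq (evalℚ (coefficients k) (toPoint x)))) k
      (λ x → trans (fourth (seq (evalSigns g x) k)) (cong (λ v → sq (sq v)) (seq-eval x k))) (slice n))
    where
    fourth : ∀ v → v ℚ.* (v ℚ.* (v ℚ.* (v ℚ.* 1ℚ))) ≡ v ℚ.* v ℚ.* (v ℚ.* v)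
    fourth = solve-∀ ring

-- A coefficient of degree above d vanishes as a real number, but the rational
-- sequence representing it need not. Interleaving each coefficient with its
-- truncation to degree d gives a polynomial h that has the approximations of g
-- at even and exact polynomials of degree d at odd indices; as both moments of
-- h are Cauchy, the rational inequality at odd indices passes to even ones.
corollary4p8 : (d n : ℕ) → 1 ℕ.≤ d → 0 ℕ.< n → (even : 2 ∣ n) →
    (g : MultilinearPolynomial n) → DegreeAtMost d g →
    𝔼-slice even (λ x → evalSigns g x ^ 4)
      ≤ fromℕ (12 ℕ.* d ℕ.* 9 ℕ.^ (2 ℕ.* d)) * 𝔼-slice even (λ x → evalSigns g x ^ 2) ^ 2
corollary4p8 d n 1≤d 0<n even g degree ε ε>0 = N₁ ℕ.⊔ N₂ , bound
  where
  c = 12 ℕ.* d ℕ.* 9 ℕ.^ (2 ℕ.* d)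
  lhs rhs : MultilinearPolynomial n → ℝ
  lhs g = 𝔼-slice even (λ x → evalSigns g x ^ 4)
  rhs g = fromℕ c * 𝔼-slice even (λ x → evalSigns g x ^ 2) ^ 2
  lhsℚ rhsℚ : (Subset n → ℚ) → ℚ
  lhsℚ G = meanℚ even G (λ v → sq (sq v))
  rhsℚ G = # c ℚ.* sq (meanℚ even G sq)

  seq-lhs : ∀ g k → seq (lhs g) k ≡ lhsℚ (coefficients g k)
  seq-lhs g k = seq-𝔼-pow4 g even k

  seq-rhs : ∀ g k → seq (rhs g) k ≡ rhsℚ (coefficients g k)
  seq-rhs g k = cong (# c ℚ.*_) (trans (square (seq (𝔼-slice even (λ x → evalSigns g x ^ 2)) k)) (cong sq (seq-𝔼-pow2 g even k)))
    where
    square : ∀ v → v ℚ.* (v ℚ.* 1ℚ) ≡ v ℚ.* v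
    square = solve-∀ ring

  truncated : MultilinearPolynomial n
  truncated S with ∣ S ∣ˢ ℕₚ.≤? d
  ... | yes _ = g S
  ... | no _  = 0ℝ

  ≃-truncated : ∀ S → g S ≃ truncated S
  ≃-truncated S with ∣ S ∣ˢ ℕₚ.≤? d
  ... | yes _  = λ δ δ>0 → 0 , λ k _ →
        subst (ℚ._< δ) (sym (cong ℚ.∣_∣ (ℚₚ.+-inverseʳ (seq (g S) k)))) δ>0
  ... | no S≰d = degree S (ℕₚ.≰⇒> S≰d)

  truncated-degree : ∀ k S → d ℕ.< ∣ S ∣ˢ → coefficients truncated k S ≡ 0ℚ
  truncated-degree k S d<S with ∣ S ∣ˢ ℕₚ.≤? d
  ... | yes S≤d = ⊥-elim (ℕₚ.<⇒≱ d<S S≤d)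
  ... | no _    = refl

  h : MultilinearPolynomial n
  h S = mkℝ (interleave (seq (g S)) (seq (truncated S))) (interleave-cauchy (g S) (truncated S) (≃-truncated S))

  evalℚ-cong : ∀ {G H : Subset n → ℚ} → (∀ S → G S ≡ H S) → ∀ x → evalℚ G x ≡ evalℚ H x
  evalℚ-cong eq x = cong sumℚ (Listₚ.map-cong
    (λ S → cong (ℚ._* productℚ S (Vec.lookup x)) (eq S)) (subsets n))

  meanℚ-cong : ∀ {G H : Subset n → ℚ} φ → (∀ S → G S ≡ H S) → meanℚ even G φ ≡ meanℚ even H φ
  meanℚ-cong φ eq = cong (λ s → (1ℤ ℚ./ length (slice n)) {{slice-nonEmpty even}} ℚ.* sumℚ s)
    (Listₚ.map-cong (λ x → cong φ (evalℚ-cong eq (toPoint x))) (slice n))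

  even-entry : ∀ k S → coefficients h (double k) S ≡ coefficients g k S
  even-entry k S = interleave-even (seq (g S)) (seq (truncated S)) k

  odd-entry : ∀ k S → coefficients h (suc (double k)) S ≡ coefficients truncated k S
  odd-entry k S = interleave-odd (seq (g S)) (seq (truncated S)) k

  0<½ε : 0ℚ ℚ.< ½ ℚ.* ε
  0<½ε = ℚₚ.positive⁻¹ _ {{ℚₚ.pos*pos⇒pos ½ ε {{ℚ.positive ε>0}}}}

  -- Half of ε pays for passing from an even index to the next odd one on the left side, the other
  -- half for the way back on the right side.
  lhs-cauchy = cauchy (lhs h) (½ ℚ.* ε) 0<½ε
  rhs-cauchy = cauchy (rhs h) (½ ℚ.* ε) 0<½ε
  N₁ = proj₁ lhs-cauchy
  N₂ = proj₁ rhs-cauchy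

  <-from-close : ∀ a b {δ} → ℚ.∣ a ℚ.- b ∣ ℚ.< δ → a ℚ.< b ℚ.+ δ
  <-from-close a b {δ} close = subst (ℚ._< b ℚ.+ δ) (cancel a b)
    (ℚₚ.+-monoʳ-< b (ℚₚ.≤-<-trans (p≤∣p∣ (a ℚ.- b)) close))
    where
    cancel : ∀ a b → b ℚ.+ (a ℚ.- b) ≡ a
    cancel = solve-∀ ring

  bound : ∀ k → N₁ ℕ.⊔ N₂ ℕ.≤ k → seq (lhs g) k ℚ.< seq (rhs g) k ℚ.+ ε
  bound k N≤k = begin-strict
    seq (lhs g) k                                       ≡⟨ seq-lhs g k ⟩
    lhsℚ (coefficients g k)                             ≡⟨ meanℚ-cong (λ v → sq (sq v)) (even-entry k) ⟨
    lhsℚ (coefficients h 2k)                            ≡⟨ seq-lhs h 2k ⟨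
    seq (lhs h) 2k                                      <⟨ <-from-close (seq (lhs h) 2k) (seq (lhs h) (suc 2k)) (proj₂ lhs-cauchy 2k (suc 2k)
                                                             (ℕₚ.m⊔n≤o⇒m≤o N₁ N₂ N≤2k) (ℕₚ.m⊔n≤o⇒m≤o N₁ N₂ N≤1+2k)) ⟩
    seq (lhs h) (suc 2k) ℚ.+ ½ ℚ.* ε                    ≡⟨ cong (ℚ._+ ½ ℚ.* ε) (trans (seq-lhs h (suc 2k))
                                                             (meanℚ-cong (λ v → sq (sq v)) (odd-entry k))) ⟩
    lhsℚ (coefficients truncated k) ℚ.+ ½ ℚ.* ε         ≤⟨ ℚₚ.+-monoˡ-≤ (½ ℚ.* ε) (polynomial-fourth-moment d 1≤d even
                                                             (coefficients truncated k) (truncated-degree k)) ⟩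
    rhsℚ (coefficients truncated k) ℚ.+ ½ ℚ.* ε         ≡⟨ cong (ℚ._+ ½ ℚ.* ε) (trans (seq-rhs h (suc 2k))
                                                             (cong (λ e → # c ℚ.* sq e) (meanℚ-cong sq (odd-entry k)))) ⟨
    seq (rhs h) (suc 2k) ℚ.+ ½ ℚ.* ε                    <⟨ ℚₚ.+-monoˡ-< (½ ℚ.* ε) (<-from-close (seq (rhs h) (suc 2k)) (seq (rhs h) 2k) (proj₂ rhs-cauchy (suc 2k) 2k
                                                             (ℕₚ.m⊔n≤o⇒n≤o N₁ N₂ N≤1+2k) (ℕₚ.m⊔n≤o⇒n≤o N₁ N₂ N≤2k))) ⟩
    seq (rhs h) 2k ℚ.+ ½ ℚ.* ε ℚ.+ ½ ℚ.* ε              ≡⟨ halves (seq (rhs h) 2k) ε ⟩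
    seq (rhs h) 2k ℚ.+ ε                                ≡⟨ cong (ℚ._+ ε) (trans (seq-rhs h 2k)
                                                             (cong (λ e → # c ℚ.* sq e) (meanℚ-cong sq (even-entry k)))) ⟩
    rhsℚ (coefficients g k) ℚ.+ ε                       ≡⟨ cong (ℚ._+ ε) (seq-rhs g k) ⟨
    seq (rhs g) k ℚ.+ ε                                 ∎
    where
    open ℚₚ.≤-Reasoning
    2k = double k
    N≤2k = ℕₚ.≤-trans N≤k (n≤double k)
    N≤1+2k = ℕₚ.m≤n⇒m≤1+n N≤2k
    halves : ∀ a e → a ℚ.+ ½ ℚ.* e ℚ.+ ½ ℚ.* e ≡ a ℚ.+ e
    halves = solve-∀ ring
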